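{- Let $k$ be a positive integer. Every $(12k-1)$-edge connected, essentially $(2k+1)$-unbalanced signed graph $(G,\sigma)$ has a modulo $(2k+1)$-orientation.
   Context: A signed graph is a pair $(G,\sigma)$ where $G$ is a graph and $\sigma:E(G)\to\{1,-1\}$; edges with $\sigma(e)=1$ are positive, those with $\sigma(e)=-1$ negative. An orientation $\tau$ of $(G,\sigma)$ orients each positive edge $e=xy$ from one end to the other (if from $x$ to $y$, then $e\in E^+_\tau(x)\cap E^-_\tau(y)$), and labels each negative edge $e=xy$ either as a sink edge, with $e\in E^+_\tau(x)\cap E^+_\tau(y)$, or as a source edge, with $e\in E^-_\tau(x)\cap E^-_\tau(y)$. Write $d^\pm_\tau(x)=|E^\pm_\tau(x)|$. A modulo $(2k+1)$-orientation is an orientation $\tau$ with $d^+_\tau(x)-d^-_\tau(x)\equiv 0\pmod{2k+1}$ for every vertex $x$. Switching at a vertex $v$ negates the sign of every edge incident to $v$. Two signed graphs on the same underlying graph are equivalent if one is obtained from the other by a sequence of switchings. $(G,\sigma)$ is essentially $(2k+1)$-unbalanced if every signed graph equivalent to it has either an even number of negative edges or at least $2k+1$ negative edges. Edge connectivity refers to $G$. -}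

module Defs where

open import Data.Bool.Base using (if_then_else_)
open import Data.Fin.Base using (Fin)
open import Data.Fin.Patterns using (0F; 1F)
import Data.Fin.Properties as Fin
open import Data.Fin.Subset using (Subset; ∣_∣; _∉_)
open import Data.Integer.Base using (+_; _-_)
import Data.Integer.Divisibility as ℤ
open import Data.List.Base using (List; allFin; cartesianProduct; filter; foldl; length)
open import Data.Nat.Base using (ℕ; _≤_; _<_)
open import Data.Nat.Divisibility using (_∣_)
open import Data.Product.Base using (_×_; _,_; ∃-syntax)
open import Data.Sign.Base as Sign using (Sign; opposite)
import Data.Sign.Properties as Sign
open import Data.Sum.Base using (_⊎_)
open import Relation.Binary.Construct.Closure.ReflexiveTransitive using (Star)
open import Relation.Binary.PropositionalEquality using (_≡_; _≗_)
open import Relation.Nullary.Decidable using (does; _×-dec_)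

-- Finite multigraphs. An edge is an index with two ends, so parallel edges and
-- loops are allowed; the numbering of the ends carries no orientation.
record Graph : Set where
  field
    order : ℕ
    size  : ℕ
    end   : Fin size → Fin 2 → Fin order

  Vertex : Set
  Vertex = Fin order

  Edge : Set
  Edge = Fin size

  HalfEdge : Set
  HalfEdge = Edge × Fin 2

  halfEdges : List HalfEdge
  halfEdges = cartesianProduct (allFin size) (allFin 2)

  Joins : Edge → Vertex → Vertex → Set
  Joins e x y = (end e 0F ≡ x × end e 1F ≡ y) ⊎ (end e 0F ≡ y × end e 1F ≡ x)

  -- The graph obtained by deleting the edges of F is connected.
  ConnectedWithout : Subset size → Set
  ConnectedWithout F = ∀ x y → Star (λ u v → ∃[ e ] e ∉ F × Joins e u v) x y

  -- The one-vertex graph is not excluded.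
  EdgeConnected : ℕ → Set
  EdgeConnected d = ∀ F → ∣ F ∣ < d → ConnectedWithout F

open Graph public using (EdgeConnected)

Signature : Graph → Set
Signature G = Graph.Edge G → Sign

module _ (G : Graph) where
  open Graph G

  negativeEdges : Signature G → List Edge
  negativeEdges σ = filter (λ e → σ e Sign.≟ Sign.-) (allFin size)

  -- One sign change per end at v: a non-loop edge incident to v is negated,
  -- while a loop at v is negated twice, i.e. keeps its sign.
  switch : Signature G → Vertex → Signature G
  switch σ v e = flip (end e 0F) (flip (end e 1F) (σ e))
    where
    flip : Vertex → Sign → Sign
    flip u s = if does (u Fin.≟ v) then opposite s else s

  Equivalent : Signature G → Signature G → Set
  Equivalent σ σ′ = ∃[ vs ] σ′ ≗ foldl switch σ vs

  EssentiallyUnbalanced : ℕ → Signature G → Set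
  EssentiallyUnbalanced m σ = ∀ σ′ → Equivalent σ σ′ →
    2 ∣ length (negativeEdges σ′) ⊎ m ≤ length (negativeEdges σ′)

-- dir e i ≡ s means e ∈ Eˢ(end e i). A positive edge runs from its end marked +
-- to its end marked -; a negative edge is a sink edge if both ends are marked +
-- and a source edge if both are marked -.
record Orientation (G : Graph) (σ : Signature G) : Set where
  open Graph G
  field
    dir      : Edge → Fin 2 → Sign
    positive : ∀ e → σ e ≡ Sign.+ → dir e 1F ≡ opposite (dir e 0F)
    negative : ∀ e → σ e ≡ Sign.- → dir e 1F ≡ dir e 0F

  -- Eˢ(x), listed as half-edges so that a negative loop at x counts twice.
  E : Sign → Vertex → List HalfEdge
  E s x = filter (λ (e , i) → end e i Fin.≟ x ×-dec dir e i Sign.≟ s) halfEdges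

  d⁺ d⁻ : Vertex → ℕ
  d⁺ x = length (E Sign.+ x)
  d⁻ x = length (E Sign.- x)

  Modulo : ℕ → Set
  Modulo m = ∀ x → (+ m) ℤ.∣ (+ d⁺ x - + d⁻ x)

HasModuloOrientation : ℕ → (G : Graph) → Signature G → Set
HasModuloOrientation m G σ = ∃[ τ ] Orientation.Modulo {G} {σ} τ m

-- Among all switchings take one in which no cut has more negative than positive
-- edges. Every cut then has at least 6k positive edges. If the number of negative
-- edges is even or at least 2k+1, they can be split into sinks and sources whose
-- numbers agree modulo 2k+1. It remains to orient the positive
-- edges with prescribed out-degrees modulo p = 2k+1, which is the theorem of
-- Lovász, Thomassen, Wu and Zhang that 6k-edge-connected graphs admit this.
--
-- That theorem is proved by induction for a graph with one further vertex z whose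
-- edges are already directed. The hypothesis is that every vertex set A avoiding z
-- has an admissible out-degree such that at least h = p − 1 edges leave and at
-- least h edges enter A. If A is neither a single vertex nor everything but z,
-- and no admissible out-degree leaves p edges in both directions, contract A and
-- then contract its complement into z. Otherwise all these sets have slack, and
-- only single vertices obstruct the deletion of a directed edge xy: x must allow
-- p leaving and y must allow p entering edges. A vertex that allows neither has
-- degree 2h and may be lifted away; this is the exceptional vertex below. If there
-- is no such vertex and no deletable edge, then, up to reversal, every vertex
-- allows p leaving edges. In that case an edge from z to x may be replaced by h
-- edges from x to z, which leaves the problem unchanged modulo p, and gives x
-- the slack needed to delete an edge yx.

module Submission where

open import Data.Nat using (ℕ; _+_; _*_; _∸_; _≤_)
open import Defs

open import Data.Bool using (Bool; true; false; _∧_; _∨_; _xor_; not; if_then_else_)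
import Data.Bool.Properties as Bool
open import Data.Bool.Properties using (xor-comm; ∧-comm)
open import Data.Empty using (⊥-elim)
open import Data.Fin.Base as Fin using (Fin; zero; suc)
open import Data.Fin.Patterns using (0F; 1F)
import Data.Fin.Properties as Fin
open import Data.Fin.Subset as Subset using (∣_∣)
open import Data.Fin.Subset.Properties using (anySubset?)
import Data.Integer.Base as ℤ
import Data.Integer.Divisibility as ℤ
import Data.Integer.Properties as ℤ
open import Data.List.Base
  using (List; []; _∷_; _++_; map; length; replicate; filter; foldl; allFin; tabulate; cartesianProduct)
open import Data.List.Membership.Propositional using () renaming (_∈_ to _∈ˡ_)
open import Data.List.Membership.Propositional.Properties using (∈-allFin)
open import Data.List.Properties using (length-++; length-map; map-tabulate)
open import Data.List.Relation.Unary.All as All using (All; []; _∷_)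
open import Data.List.Relation.Unary.All.Properties using (map⁺)
open import Data.List.Relation.Unary.Any using (here; there)
open import Data.Nat
open import Data.Nat.Divisibility using (_∣_; divides; n∣m*n; _∣0)
open import Data.Nat.DivMod
open import Data.Nat.Properties
open import Data.Nat.Tactic.RingSolver using (solve-∀)
open import Data.Product using (∃; ∃₂; _×_; _,_; proj₁; proj₂; swap; map₂)
open import Data.Sign.Base as Sign using (Sign; opposite)
import Data.Sign.Properties as Sign
open import Data.Sum as Sum using (_⊎_; inj₁; inj₂; [_,_])
import Data.Vec.Base as Vec
import Data.Vec.Properties as Vec
open import Function.Base using (_∘_; id)
open import Relation.Binary.Bundles using (Setoid)
open import Relation.Binary.Construct.Closure.ReflexiveTransitive using (Star; ε; _◅_)
open import Relation.Binary.Definitions using (Tri; tri<; tri≈; tri>)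
open import Relation.Binary.PropositionalEquality hiding ([_])
import Relation.Binary.Reasoning.Setoid as SetoidReasoning
open import Relation.Binary.Structures using (IsEquivalence)
open import Relation.Nullary using (Dec; yes; no; does; ¬_)
open import Relation.Nullary.Decidable
  using (dec-true; dec-false; map′; ¬?; _×-dec_; _→-dec_; decidable-stable)
open import Relation.Unary using (Decidable)

-- An admissible out-degree of a set counts the fixed edges at z together with the free ones and
-- need not respect their directions, so by itself it does not guarantee free edges on the boundary
-- of the set. This is repaired by the condition `Balanced` on z. It says that the degree of z has
-- no split of the right residue with at least `p` edges in both directions. The absence of slack at
-- a set A is the same condition, seen from the other side, so it is inherited when everything
-- outside A becomes the new z. With it, `cut` turns admissible out-degrees of the two sides of a
-- cut into a lower bound on the number of free edges between them.
--
-- The demands on the positive edges must add up to the number of positive edges modulo `p`. This is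
-- what the congruence of sinks and sources provides. Switching costs nothing: undoing it exchanges
-- out- and in-degree at the switched vertices.

-- Congruences and degree splits modulo `p`

module Congruence (h : ℕ) where

  p : ℕ
  p = suc h

  infix 4 _≈_
  -- A record instead of a bare equation of remainders, so that `x` and `y` can be inferred from a
  -- congruence.
  record _≈_ (x y : ℕ) : Set where
    constructor same-remainder
    field
      remainder : x % p ≡ y % p

  open _≈_

  ≈-isEquivalence : IsEquivalence _≈_
  ≈-isEquivalence = record
    { refl  = same-remainder refl
    ; sym   = λ x≈y → same-remainder (sym (remainder x≈y))
    ; trans = λ x≈y y≈z → same-remainder (trans (remainder x≈y) (remainder y≈z))
    }

  ≈-setoid : Setoid _ _
  ≈-setoid = record { isEquivalence = ≈-isEquivalence }

  open Setoid ≈-setoid using () renaming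
    (refl to ≈-refl; sym to ≈-sym; trans to ≈-trans; reflexive to ≈-reflexive) public
  module ≈-Reasoning = SetoidReasoning ≈-setoid

  +-cong-≈ : ∀ {x y z w} → x ≈ y → z ≈ w → x + z ≈ y + w
  +-cong-≈ {x} {y} {z} {w} x≈y z≈w = same-remainder (begin
    (x + z) % p           ≡⟨ %-distribˡ-+ x z p ⟩
    (x % p + z % p) % p   ≡⟨ cong₂ (λ u v → (u + v) % p) (remainder x≈y) (remainder z≈w) ⟩
    (y % p + w % p) % p   ≡⟨ %-distribˡ-+ y w p ⟨
    (y + w) % p           ∎)
    where open ≡-Reasoning

  +-multiple-≈ : ∀ x q → x + q * p ≈ x
  +-multiple-≈ x q = same-remainder ([m+kn]%n≡m%n x q p)

  +-p-≈ : ∀ x → x + p ≈ x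
  +-p-≈ x = same-remainder ([m+n]%n≡m%n x p)

  +-cancelʳ-≈ : ∀ z {x y} → x + z ≈ y + z → x ≈ y
  +-cancelʳ-≈ z {x} {y} eq = begin
    x                   ≈⟨ +-multiple-≈ x z ⟨
    x + z * p           ≡⟨ arrange x ⟩
    x + z + z * h       ≈⟨ +-cong-≈ eq ≈-refl ⟩
    y + z + z * h       ≡⟨ arrange y ⟨
    y + z * p           ≈⟨ +-multiple-≈ y z ⟩
    y                   ∎
    where
    open ≈-Reasoning
    arrange : ∀ x → x + z * p ≡ x + z + z * h
    arrange x = trans (cong (x +_) (*-suc z h)) (sym (+-assoc x z (z * h)))

  ≈-split : ∀ {x y} → x ≈ y →
    x ≡ y ⊎ (∃ λ q → x ≡ y + suc q * p) ⊎ (∃ λ q → y ≡ x + suc q * p)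
  ≈-split {x} {y} x≈y = compare-quotients (<-cmp (x / p) (y / p))
    where
    larger : ∀ {x y} → x ≈ y → x / p < y / p → ∃ λ q → y ≡ x + suc q * p
    larger {x} {y} x≈y lt = q , (begin
      y                                   ≡⟨ m≡m%n+[m/n]*n y p ⟩
      y % p + y / p * p                   ≡⟨ cong₂ (λ u v → u + v * p) (sym (remainder x≈y)) (sym eq) ⟩
      x % p + (suc (x / p) + q) * p       ≡⟨ arrange (x % p) (x / p) q p ⟩
      x % p + x / p * p + suc q * p       ≡⟨ cong (_+ suc q * p) (m≡m%n+[m/n]*n x p) ⟨
      x + suc q * p                       ∎)
      where
      open ≡-Reasoning
      q = y / p ∸ suc (x / p)
      eq : suc (x / p) + q ≡ y / p
      eq = m+[n∸m]≡n lt
      arrange : ∀ r u q p → r + (suc u + q) * p ≡ r + u * p + suc q * p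
      arrange = solve-∀
    compare-quotients : Tri (x / p < y / p) (x / p ≡ y / p) (x / p > y / p) →
      x ≡ y ⊎ (∃ λ q → x ≡ y + suc q * p) ⊎ (∃ λ q → y ≡ x + suc q * p)
    compare-quotients (tri< lt _ _) = inj₂ (inj₂ (larger x≈y lt))
    compare-quotients (tri≈ _ eq _) = inj₁ (begin
      x                    ≡⟨ m≡m%n+[m/n]*n x p ⟩
      x % p + x / p * p    ≡⟨ cong₂ (λ u v → u + v * p) (remainder x≈y) eq ⟩
      y % p + y / p * p    ≡⟨ m≡m%n+[m/n]*n y p ⟨
      y                    ∎)
      where open ≡-Reasoning
    compare-quotients (tri> _ _ gt) = inj₂ (inj₁ (larger {y} {x} (≈-sym x≈y) gt))

  -- α edges leave and γ edges enter the vertex z.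
  Balanced : ℕ → ℕ → Set
  Balanced α γ = α ≤ p + h × γ ≤ p + h × (α ≤ h ⊎ γ ≤ h)

  -- x and x′ are the total out- and in-demands of the two sides of a cut with
  -- e edges.
  cut-bound : ∀ {e α γ x x′ m} → Balanced α γ →
    x + x′ ≡ e + e + (α + γ) → x ≈ e + γ → m ≤ x → m ≤ x′ → m ≤ e + h
  cut-bound {e} {α} {γ} {x} {x′} {m} (α≤ , γ≤ , low) total x≈ m≤x m≤x′ =
    cases (≈-split x≈)
    where
    open ≤-Reasoning
    opposite-side : ∀ e α γ x′ → e + γ + x′ ≡ e + e + (α + γ) → x′ ≡ e + α
    opposite-side e α γ x′ eq = +-cancelˡ-≡ (e + γ) x′ (e + α) (trans eq (arrange e α γ))
      where
      arrange : ∀ e α γ → e + e + (α + γ) ≡ e + γ + (e + α)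
      arrange = solve-∀
    far : ∀ {z t} q → t ≤ p + h → z + suc q * p ≡ e + t → m ≤ z → m ≤ e + h
    far {z} {t} q t≤ eq m≤z = +-cancelʳ-≤ p m (e + h) (begin
      m + p              ≤⟨ +-mono-≤ m≤z (m≤m+n p (q * p)) ⟩
      z + suc q * p      ≡⟨ eq ⟩
      e + t              ≤⟨ +-monoʳ-≤ e t≤ ⟩
      e + (p + h)        ≡⟨ cong (e +_) (+-comm p h) ⟩
      e + (h + p)        ≡⟨ +-assoc e h p ⟨
      e + h + p          ∎)
    cases : x ≡ e + γ ⊎ (∃ λ q → x ≡ e + γ + suc q * p) ⊎ (∃ λ q → e + γ ≡ x + suc q * p) →
      m ≤ e + h
    -- If `x` is `e + γ`, then `x′` is `e + α`, and whichever of `α` and `γ` is at most `h` gives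
    -- the bound. In the other cases `x′` falls short of `e + α`, or `x` of `e + γ`, by at least
    -- `p`, and the bound `p + h` on `α` and `γ` suffices.
    cases (inj₁ refl) = [ (λ α≤h → begin
        m      ≤⟨ m≤x′ ⟩
        x′     ≡⟨ opposite-side e α γ x′ total ⟩
        e + α  ≤⟨ +-monoʳ-≤ e α≤h ⟩
        e + h  ∎) , (λ γ≤h → ≤-trans m≤x (+-monoʳ-≤ e γ≤h)) ] low
    cases (inj₂ (inj₁ (q , refl))) = far {x′} {α} q α≤
      (opposite-side e α γ _ (trans (arrange (e + γ) x′ (suc q * p)) total)) m≤x′
      where
      arrange : ∀ u x′ w → u + (x′ + w) ≡ u + w + x′
      arrange = solve-∀
    cases (inj₂ (inj₂ (q , eq))) = far {x} {γ} q γ≤ (sym eq) m≤x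

  -- A split of a degree into an out- and an in-degree that violates the bounds
  -- can be shifted by a multiple of p so that both parts are at least p.
  balanced-or-large : ∀ γ α → Balanced α γ ⊎
    (∃₂ λ c c′ → p ≤ c × p ≤ c′ × γ + α ≡ c + c′ × γ ≈ c)
  balanced-or-large γ α with α ≤? p + h | γ ≤? p + h | α ≤? h | γ ≤? h
  ... | yes a | yes b | yes c | _     = inj₁ (a , b , inj₁ c)
  ... | yes a | yes b | no _  | yes d = inj₁ (a , b , inj₂ d)
  ... | yes a | yes b | no c  | no d  =
    inj₂ (γ , α , ≰⇒> d , ≰⇒> c , refl , ≈-refl)
  -- Here `α` is at least `p + p`, so `p` can be moved over to `γ` and at least `p` remain.
  ... | no a | _ | _ | _ = inj₂ (γ + p , α ∸ p , m≤n+m p γ , m+n≤o⇒m≤o∸n p p+p≤ ,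
      (begin
        γ + α                ≡⟨ cong (γ +_) (m+[n∸m]≡n (m+n≤o⇒m≤o p p+p≤)) ⟨
        γ + (p + (α ∸ p))    ≡⟨ +-assoc γ p (α ∸ p) ⟨
        γ + p + (α ∸ p)      ∎) ,
      ≈-sym (+-p-≈ γ))
    where
    open ≡-Reasoning
    p+p≤ : p + p ≤ α
    p+p≤ = ≤-trans (≤-reflexive (+-suc p h)) (≰⇒> a)
  ... | yes _ | no b | _ | _ = inj₂ (γ ∸ p , α + p , m+n≤o⇒m≤o∸n p p+p≤ , m≤n+m p α ,
      (begin
        γ + α                ≡⟨ cong (_+ α) (m∸n+n≡m p≤γ) ⟨
        γ ∸ p + p + α        ≡⟨ +-assoc (γ ∸ p) p α ⟩
        γ ∸ p + (p + α)      ≡⟨ cong (γ ∸ p +_) (+-comm p α) ⟩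
        γ ∸ p + (α + p)      ∎) ,
      ≈-trans (≈-reflexive (sym (m∸n+n≡m p≤γ))) (+-p-≈ (γ ∸ p)))
    where
    open ≡-Reasoning
    p+p≤ : p + p ≤ γ
    p+p≤ = ≤-trans (≤-reflexive (+-suc p h)) (≰⇒> b)
    p≤γ = m+n≤o⇒m≤o p p+p≤

  -- c and c′ are prospective out- and in-degrees of a vertex set of degree g;
  -- the prescribed residue l − r of c is kept as a pair to avoid subtraction.
  record Split (g l r c c′ : ℕ) : Set where
    constructor _,_
    field
      degree : g ≡ c + c′
      out    : l ≈ r + c

  leave : ∀ {g l r c c′} → Split (suc g) l r (suc c) c′ → Split g l (suc r) c c′
  leave {r = r} {c} (eq , con) =
    suc-injective eq , ≈-trans con (≈-reflexive (+-suc r c))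

  enter : ∀ {g l r c c′} → Split (suc g) l r c (suc c′) → Split g l r c c′
  enter {c = c} {c′} (eq , con) = suc-injective (trans eq (+-suc c c′)) , con

  leave-+ : ∀ {g l r c c′} k → Split (suc g) l r (c + suc k) c′ → Split g l (suc r) (c + k) c′
  leave-+ {g} {l} {r} {c} {c′} k sp = leave (subst (λ t → Split (suc g) l r t c′) (+-suc c k) sp)

  enter-+ : ∀ {g l r c c′} k → Split (suc g) l r c (c′ + suc k) → Split g l r c (c′ + k)
  enter-+ {g} {l} {r} {c} {c′} k sp = enter (subst (Split (suc g) l r c) (+-suc c′ k) sp)

  inside : ∀ {g l s e c c′} → Split g l (s + suc e) c c′ → Split g l (suc s + e) c c′
  inside {s = s} {e} {c} (eq , con) = eq , ≈-trans con (≈-reflexive (cong (_+ c) (+-suc s e)))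

  -- Both equations compare changes by cross-addition: the degree changes as much as the sum of the
  -- two parts, and `l` changes modulo `p` as much as the residue side `r + c`.
  transfer : ∀ {g l r c c′ g₁ l₁ r₁ c₁ c₁′} → Split g l r c c′ →
    g₁ + (c + c′) ≡ g + (c₁ + c₁′) → l₁ + (r + c) ≈ l + (r₁ + c₁) →
    Split g₁ l₁ r₁ c₁ c₁′
  transfer {g} {l} {r} {c} {c′} {g₁} {l₁} {r₁} {c₁} {c₁′} (refl , l≈) eq con =
    +-cancelʳ-≡ (c + c′) g₁ (c₁ + c₁′) (trans eq (+-comm (c + c′) (c₁ + c₁′))) ,
    +-cancelʳ-≈ (r + c) (begin
      l₁ + (r + c)            ≈⟨ con ⟩
      l + (r₁ + c₁)           ≈⟨ +-cong-≈ l≈ ≈-refl ⟩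
      r + c + (r₁ + c₁)       ≡⟨ +-comm (r + c) (r₁ + c₁) ⟩
      r₁ + c₁ + (r + c)       ∎)
    where open ≈-Reasoning

  -- In this and the following lemmas a set has `d` free boundary edges, `a` edges from z and `b`
  -- edges to z, and its demand is `o`. An edge to z leaves the set, so it counts in the residue as
  -- well as in the degree.
  drop-out : ∀ d a b o {r c c′} →
    Split (d + (a + suc b)) (o + suc b) r (suc c) c′ → Split (d + (a + b)) (o + b) r c c′
  drop-out d a b o {r} {c} {c′} sp =
    transfer sp (arrange d a b c c′) (≈-reflexive (arrange′ o b r c))
    where
    arrange : ∀ d a b c c′ → d + (a + b) + (suc c + c′) ≡ d + (a + suc b) + (c + c′)
    arrange = solve-∀
    arrange′ : ∀ o b r c → o + b + (r + suc c) ≡ o + suc b + (r + c)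
    arrange′ = solve-∀

  drop-in : ∀ d a b {l r c c′} →
    Split (d + (suc a + b)) l r c (suc c′) → Split (d + (a + b)) l r c c′
  drop-in d a b {l} {r} {c} {c′} sp = transfer sp (arrange d a b c c′) ≈-refl
    where
    arrange : ∀ d a b c c′ → d + (a + b) + (c + suc c′) ≡ d + (suc a + b) + (c + c′)
    arrange = solve-∀

  add-out : ∀ d a b o {r c c′} →
    Split (d + (a + b)) (o + b) r c c′ → Split (d + (a + suc b)) (o + suc b) r (suc c) c′
  add-out d a b o {r} {c} {c′} sp =
    transfer sp (arrange d a b c c′) (≈-reflexive (arrange′ o b r c))
    where
    arrange : ∀ d a b c c′ → d + (a + suc b) + (c + c′) ≡ d + (a + b) + (suc c + c′)
    arrange = solve-∀
    arrange′ : ∀ o b r c → o + suc b + (r + c) ≡ o + b + (r + suc c)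
    arrange′ = solve-∀

  add-in : ∀ d a b {l r c c′} →
    Split (d + (a + b)) l r c c′ → Split (d + (suc a + b)) l r c (suc c′)
  add-in d a b {l} {r} {c} {c′} sp = transfer sp (arrange d a b c c′) ≈-refl
    where
    arrange : ∀ d a b c c′ → d + (suc a + b) + (c + c′) ≡ d + (a + b) + (c + suc c′)
    arrange = solve-∀

  -- The residue grows by `h`, which is -1 modulo `p`, so the out-part may drop by one. The degree
  -- grows by `h − 1`, so the in-part grows by `h`.
  in⇒outs : ∀ d a b o {r c c′} → Split (d + (suc a + b)) (o + b) r (suc c) c′ →
    Split (d + (a + (h + b))) (o + (h + b)) r c (c′ + h)
  in⇒outs d a b o {r} {c} {c′} sp = transfer sp (arrange d a h b c c′)
    (≈-trans (≈-reflexive (arrange′ o h b r c)) (+-p-≈ (o + b + (r + c))))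
    where
    arrange : ∀ d a h b c c′ →
      d + (a + (h + b)) + (suc c + c′) ≡ d + (suc a + b) + (c + (c′ + h))
    arrange = solve-∀
    arrange′ : ∀ o h b r c → o + (h + b) + (r + suc c) ≡ o + b + (r + c) + suc h
    arrange′ = solve-∀

  -- The residue drops by one, which is the same as growing by `h`. This is added to the out-part,
  -- and the in-part pays one because the degree grows by `h − 1` only.
  out⇒ins : ∀ d a b o {r c c′} → Split (d + (a + suc b)) (o + suc b) r c (suc c′) →
    Split (d + (h + a + b)) (o + b) r (c + h) c′
  out⇒ins d a b o {r} {c} {c′} sp = transfer sp (arrange d a h b c c′)
    (≈-sym (≈-trans (≈-reflexive (arrange′ o h b r c)) (+-p-≈ (o + b + (r + c)))))
    where
    arrange : ∀ d a h b c c′ →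
      d + (h + a + b) + (c + suc c′) ≡ d + (a + suc b) + (c + h + c′)
    arrange = solve-∀
    arrange′ : ∀ o h b r c → o + suc b + (r + (c + h)) ≡ o + b + (r + c) + suc h
    arrange′ = solve-∀

-- Counting list entries in vertex sets

ι : Bool → ℕ
ι false = 0
ι true  = 1

module _ {V : Set} where

  # : (V → Bool) → List V → ℕ
  # B []      = 0
  # B (v ∷ l) = ι (B v) + # B l

  #-++ : ∀ (B : V → Bool) l l′ → # B (l ++ l′) ≡ # B l + # B l′
  #-++ B []      l′ = refl
  #-++ B (v ∷ l) l′ = trans (cong (ι (B v) +_) (#-++ B l l′)) (sym (+-assoc (ι (B v)) _ _))

  #-cong : ∀ {B B′ : V → Bool} → B ≗ B′ → ∀ l → # B l ≡ # B′ l
  #-cong eq []      = refl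
  #-cong eq (v ∷ l) = cong₂ _+_ (cong ι (eq v)) (#-cong eq l)

  #-replicate-∈ : ∀ (B : V → Bool) {v} k → B v ≡ true → # B (replicate k v) ≡ k
  #-replicate-∈ B zero    eq = refl
  #-replicate-∈ B (suc k) eq rewrite eq = cong suc (#-replicate-∈ B k eq)

  #-replicate-∉ : ∀ (B : V → Bool) {v} k → B v ≡ false → # B (replicate k v) ≡ 0
  #-replicate-∉ B zero    eq = refl
  #-replicate-∉ B (suc k) eq rewrite eq = #-replicate-∉ B k eq

  infix 4 _∈_ _∉_ _⊑_
  _∈_ _∉_ : V → (V → Bool) → Set
  v ∈ B = B v ≡ true
  v ∉ B = B v ≡ false

  ∈∉-elim : ∀ {A : Set} {B : V → Bool} {v} → v ∈ B → v ∉ B → A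
  ∈∉-elim v∈ v∉ with () ← trans (sym v∈) v∉

  ∈⊎∉ : ∀ (B : V → Bool) v → v ∈ B ⊎ v ∉ B
  ∈⊎∉ B v with B v
  ... | true  = inj₁ refl
  ... | false = inj₂ refl

  _⊑_ : (V → Bool) → (V → Bool) → Set
  B ⊑ U = ∀ {v} → v ∈ B → v ∈ U

  ∉-⊑ : ∀ {B A : V → Bool} {v} → B ⊑ A → v ∉ A → v ∉ B
  ∉-⊑ {B = B} {A} {v} sub v∉A with ∈⊎∉ B v
  ... | inj₁ v∈ = ∈∉-elim {B = A} (sub v∈) v∉A
  ... | inj₂ v∉ = v∉

  #-mono-≤ : ∀ {B U : V → Bool} → B ⊑ U → ∀ l → # B l ≤ # U l
  #-mono-≤ sub [] = z≤n
  #-mono-≤ {B = B} {U} sub (v ∷ l) with B v in eq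
  ... | false = ≤-trans (#-mono-≤ sub l) (m≤n+m _ _)
  ... | true rewrite sub eq = s≤s (#-mono-≤ sub l)

  #-mono-< : ∀ {B U : V → Bool} → B ⊑ U → ∀ {v l} → v ∈ˡ l → v ∈ U → v ∉ B → # B l < # U l
  #-mono-< sub {l = _ ∷ l} (here refl) v∈ v∉ rewrite v∈ | v∉ = s≤s (#-mono-≤ sub l)
  #-mono-< {B = B} {U} sub {l = w ∷ l} (there v∈l) v∈ v∉ with B w in eq
  ... | false = ≤-trans (#-mono-< sub v∈l v∈ v∉) (m≤n+m _ _)
  ... | true rewrite sub eq = s≤s (#-mono-< sub v∈l v∈ v∉)

  ∁ : (V → Bool) → (V → Bool) → V → Bool
  ∁ U B v = U v ∧ not (B v)

  ∁-⊑ : ∀ {U B : V → Bool} → ∁ U B ⊑ U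
  ∁-⊑ {U = U} {v = v} eq with true ← U v = refl

  ∁-∈ : ∀ {U B : V → Bool} {v} → v ∈ U → v ∉ B → v ∈ ∁ U B
  ∁-∈ v∈ v∉ rewrite v∈ | v∉ = refl

  ∁-∉ : ∀ {U B : V → Bool} {v} → v ∈ U → v ∈ B → v ∉ ∁ U B
  ∁-∉ v∈U v∈B rewrite v∈U | v∈B = refl

  #-∁ : ∀ {U B : V → Bool} → B ⊑ U → ∀ l → # U l ≡ # B l + # (∁ U B) l
  #-∁ sub [] = refl
  #-∁ {U = U} {B} sub (v ∷ l) with B v in eq
  ... | true rewrite sub eq = cong suc (#-∁ sub l)
  ... | false with U v
  ...   | true  = trans (cong suc (#-∁ sub l)) (sym (+-suc _ _))
  ...   | false = #-∁ sub l

  data Pick : List V → V → List V → Set where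
    here  : ∀ {x l} → Pick (x ∷ l) x l
    there : ∀ {x y l l′} → Pick l x l′ → Pick (y ∷ l) x (y ∷ l′)

  pick-# : ∀ (B : V → Bool) {l x l′} → Pick l x l′ → # B l ≡ ι (B x) + # B l′
  pick-# B here = refl
  pick-# B {x = x} (there {y = y} {l} {l′} pk) =
    trans (cong (ι (B y) +_) (pick-# B pk)) (arrange (ι (B y)) (ι (B x)) (# B l′))
    where
    arrange : ∀ a b c → a + (b + c) ≡ b + (a + c)
    arrange = solve-∀

  pick-token : ∀ (B : V → Bool) l → (∃₂ λ x l′ → x ∈ B × Pick l x l′) ⊎ # B l ≡ 0
  pick-token B [] = inj₂ refl
  pick-token B (x ∷ l) with B x in eq | pick-token B l
  ... | true  | _ = inj₁ (x , l , eq , here)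
  ... | false | inj₁ (y , l′ , y∈ , pk) = inj₁ (y , x ∷ l′ , y∈ , there pk)
  ... | false | inj₂ none = inj₂ none

#-map : ∀ {V W : Set} (B : W → Bool) (f : V → W) l → # B (map f l) ≡ # (B ∘ f) l
#-map B f []      = refl
#-map B f (v ∷ l) = cong (ι (B (f v)) +_) (#-map B f l)

-- Edge lists: cuts, induced edges and orientations

module _ {V : Set} where

  Ends : Set
  Ends = V × V

  d e : (V → Bool) → List Ends → ℕ
  d B []            = 0
  d B ((x , y) ∷ E) = ι (B x xor B y) + d B E
  e B []            = 0
  e B ((x , y) ∷ E) = ι (B x ∧ B y) + e B E

  src tgt : List Ends → List V
  src = map proj₁
  tgt = map proj₂

  d-cong : ∀ {B B′ : V → Bool} → B ≗ B′ → ∀ E → d B E ≡ d B′ E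
  d-cong eq []            = refl
  d-cong eq ((x , y) ∷ E) = cong₂ _+_ (cong ι (cong₂ _xor_ (eq x) (eq y))) (d-cong eq E)

  e-cong : ∀ {B B′ : V → Bool} → B ≗ B′ → ∀ E → e B E ≡ e B′ E
  e-cong eq []            = refl
  e-cong eq ((x , y) ∷ E) = cong₂ _+_ (cong ι (cong₂ _∧_ (eq x) (eq y))) (e-cong eq E)

  Within : (V → Bool) → List Ends → Set
  Within U = All (λ (x , y) → x ∈ U × y ∈ U)

  d-∁ : ∀ {U B : V → Bool} E → Within U E → d (∁ U B) E ≡ d B E
  d-∁ [] [] = refl
  d-∁ {U} {B} ((x , y) ∷ E) ((x∈ , y∈) ∷ w) rewrite x∈ | y∈ with B x | B y
  ... | true  | true  = d-∁ E w
  ... | true  | false = cong suc (d-∁ E w)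
  ... | false | true  = cong suc (d-∁ E w)
  ... | false | false = d-∁ E w

  length-split : ∀ {U B : V → Bool} E → Within U E →
    length E ≡ e B E + e (∁ U B) E + d B E
  length-split [] [] = refl
  length-split {U} {B} ((x , y) ∷ E) ((x∈ , y∈) ∷ w) rewrite x∈ | y∈ with B x | B y
  ... | true  | true  = cong suc (length-split E w)
  ... | true  | false = trans (cong suc (length-split E w)) (sym (+-suc _ _))
  ... | false | true  = trans (cong suc (length-split E w)) (sym (+-suc _ _))
  ... | false | false = trans (cong suc (length-split E w))
    (cong (_+ d B E) (sym (+-suc _ _)))

  data PickEdge : List Ends → V → V → List Ends → Set where
    here  : ∀ {x y E} → PickEdge ((x , y) ∷ E) x y E
    here′ : ∀ {x y E} → PickEdge ((y , x) ∷ E) x y E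
    there : ∀ {x y f E E′} → PickEdge E x y E′ → PickEdge (f ∷ E) x y (f ∷ E′)

  pick-sym : ∀ {E x y E′} → PickEdge E x y E′ → PickEdge E y x E′
  pick-sym here       = here′
  pick-sym here′      = here
  pick-sym (there pk) = there (pick-sym pk)

  pick-d : ∀ B {E x y E′} → PickEdge E x y E′ → d B E ≡ ι (B x xor B y) + d B E′
  pick-d B here = refl
  pick-d B {x = x} {y} (here′ {E = E}) = cong (λ u → ι u + d B E) (xor-comm (B y) (B x))
  pick-d B {x = x} {y} (there {f = u , v} {E} {E′} pk) =
    trans (cong (ι (B u xor B v) +_) (pick-d B pk))
      (arrange (ι (B u xor B v)) (ι (B x xor B y)) (d B E′))
    where
    arrange : ∀ a b c → a + (b + c) ≡ b + (a + c)
    arrange = solve-∀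

  pick-e : ∀ B {E x y E′} → PickEdge E x y E′ → e B E ≡ ι (B x ∧ B y) + e B E′
  pick-e B here = refl
  pick-e B {x = x} {y} (here′ {E = E}) = cong (λ u → ι u + e B E) (∧-comm (B y) (B x))
  pick-e B {x = x} {y} (there {f = u , v} {E} {E′} pk) =
    trans (cong (ι (B u ∧ B v) +_) (pick-e B pk))
      (arrange (ι (B u ∧ B v)) (ι (B x ∧ B y)) (e B E′))
    where
    arrange : ∀ a b c → a + (b + c) ≡ b + (a + c)
    arrange = solve-∀

  pick-length : ∀ {E x y E′} → PickEdge E x y E′ → length E ≡ suc (length E′)
  pick-length here       = refl
  pick-length here′      = refl
  pick-length (there pk) = cong suc (pick-length pk)

  pick-within : ∀ {U E x y E′} → PickEdge E x y E′ → Within U E →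
    (x ∈ U × y ∈ U) × Within U E′
  pick-within here       (q ∷ w) = q , w
  pick-within here′      (q ∷ w) = swap q , w
  pick-within (there pk) (q ∷ w) = map₂ (q ∷_) (pick-within pk w)

  pick-edge : ∀ (P : V → V → Bool) E →
    (∃ λ x → ∃₂ λ y E′ → P x y ≡ true × PickEdge E x y E′) ⊎
    All (λ (x , y) → P x y ≡ false × P y x ≡ false) E
  pick-edge P [] = inj₂ []
  pick-edge P ((x , y) ∷ E) with P x y in eq | P y x in eq′ | pick-edge P E
  ... | true  | _     | _ = inj₁ (x , y , E , eq , here)
  ... | false | true  | _ = inj₁ (y , x , E , eq′ , here′)
  ... | false | false | inj₁ (u , v , E′ , q , pk) = inj₁ (u , v , _ , q , there pk)
  ... | false | false | inj₂ none = inj₂ ((eq , eq′) ∷ none)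

  pick-crossing : ∀ B E →
    (∃ λ x → ∃₂ λ y E′ → x ∈ B × y ∉ B × PickEdge E x y E′) ⊎ d B E ≡ 0
  pick-crossing B E with pick-edge (λ x y → B x ∧ not (B y)) E
  ... | inj₁ (x , y , E′ , q , pk) = inj₁ (x , y , E′ , ∧-left (B x) (B y) q , ∧-right (B x) (B y) q , pk)
    where
    ∧-left : ∀ u v → u ∧ not v ≡ true → u ≡ true
    ∧-left true v q = refl
    ∧-right : ∀ u v → u ∧ not v ≡ true → v ≡ false
    ∧-right true false q = refl
  ... | inj₂ none = inj₂ (no-crossing E none)
    where
    no-crossing : ∀ E → All (λ (x , y) → (B x ∧ not (B y)) ≡ false × (B y ∧ not (B x)) ≡ false) E → d B E ≡ 0
    no-crossing [] [] = refl
    no-crossing ((x , y) ∷ E) ((q , q′) ∷ none) with B x | B y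
    ... | true  | true  = no-crossing E none
    ... | false | false = no-crossing E none
    no-crossing ((x , y) ∷ E) (((), q′) ∷ none) | true | false
    no-crossing ((x , y) ∷ E) ((q , ()) ∷ none) | false | true

  -- Orient E D : D lists the edges of E, each directed from its first to its
  -- second component.
  data Orient : List Ends → List Ends → Set where
    []   : Orient [] []
    keep : ∀ {x y E D} → Orient E D → Orient ((x , y) ∷ E) ((x , y) ∷ D)
    turn : ∀ {x y E D} → Orient E D → Orient ((x , y) ∷ E) ((y , x) ∷ D)

  orient-pick : ∀ {E x y E′ D′} → PickEdge E x y E′ → Orient E′ D′ →
    ∃ λ D → Orient E D × (∀ B → # B (src D) ≡ ι (B x) + # B (src D′))
  orient-pick here  or = _ , keep or , λ _ → refl
  orient-pick here′ or = _ , turn or , λ _ → refl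
  orient-pick {x = x} (there pk) (keep {u} {v} or) =
    let D , or′ , eq = orient-pick pk or in
    _ , keep or′ , λ B → trans (cong (ι (B u) +_) (eq B)) (arrange (ι (B u)) (ι (B x)) _)
    where
    arrange : ∀ a b c → a + (b + c) ≡ b + (a + c)
    arrange = solve-∀
  orient-pick {x = x} (there pk) (turn {u} {v} or) =
    let D , or′ , eq = orient-pick pk or in
    _ , turn or′ , λ B → trans (cong (ι (B v) +_) (eq B)) (arrange (ι (B v)) (ι (B x)) _)
    where
    arrange : ∀ a b c → a + (b + c) ≡ b + (a + c)
    arrange = solve-∀

  orient-length : ∀ {E D} → Orient E D → length D ≡ length E
  orient-length []        = refl
  orient-length (keep or) = cong suc (orient-length or)
  orient-length (turn or) = cong suc (orient-length or)

  orient-within : ∀ {U E D} → Orient E D → Within U E → Within U D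
  orient-within []        w       = []
  orient-within (keep or) (q ∷ w) = q ∷ orient-within or w
  orient-within (turn or) (q ∷ w) = swap q ∷ orient-within or w

  -- An edge inside `B` has its source in `B` in either direction. Of the crossing edges the first
  -- `u` are directed out of `B` and the others into it.
  orient-with-out : ∀ B E {u} → u ≤ d B E →
    ∃ λ D → Orient E D × # B (src D) ≡ u + e B E
  orient-with-out B [] z≤n = [] , [] , refl
  orient-with-out B ((x , y) ∷ E) {u} u≤ with B x in eqx | B y in eqy
  ... | true  | true  = let D , or , eq = orient-with-out B E u≤ in
    _ , keep {x} {y} or , trans (cong₂ _+_ (cong ι eqx) eq) (sym (+-suc u _))
  ... | false | false = let D , or , eq = orient-with-out B E u≤ in
    _ , keep {x} {y} or , trans (cong₂ _+_ (cong ι eqx) eq) refl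
  orient-with-out B ((x , y) ∷ E) {zero} u≤ | true | false =
    let D , or , eq = orient-with-out B E z≤n in _ , turn {x} {y} or , cong₂ _+_ (cong ι eqy) eq
  orient-with-out B ((x , y) ∷ E) {suc u} (s≤s u≤) | true | false =
    let D , or , eq = orient-with-out B E u≤ in _ , keep {x} {y} or , cong₂ _+_ (cong ι eqx) eq
  orient-with-out B ((x , y) ∷ E) {zero} u≤ | false | true =
    let D , or , eq = orient-with-out B E z≤n in _ , keep {x} {y} or , cong₂ _+_ (cong ι eqx) eq
  orient-with-out B ((x , y) ∷ E) {suc u} (s≤s u≤) | false | true =
    let D , or , eq = orient-with-out B E u≤ in _ , turn {x} {y} or , cong₂ _+_ (cong ι eqy) eq

-- Finite search and finite sums

search : ∀ {m} {P Q : Fin m → Set} → (∀ v → P v ⊎ Q v) → ∃ P ⊎ (∀ v → Q v)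
search {zero}  f = inj₂ λ ()
search {suc m} f with f Fin.zero | search (f ∘ Fin.suc)
... | inj₁ q | _            = inj₁ (Fin.zero , q)
... | inj₂ q | inj₁ (v , r) = inj₁ (Fin.suc v , r)
... | inj₂ q | inj₂ all     = inj₂ (Fin.∀-cons q all)

∑ : ∀ {m} → (Fin m → ℕ) → ℕ
∑ {zero}  f = 0
∑ {suc m} f = f zero + ∑ (f ∘ suc)

∑-cong : ∀ {m} {f g : Fin m → ℕ} → (∀ i → f i ≡ g i) → ∑ f ≡ ∑ g
∑-cong {zero}  eq = refl
∑-cong {suc m} eq = cong₂ _+_ (eq zero) (∑-cong (eq ∘ suc))

∑-+ : ∀ {m} (f g : Fin m → ℕ) → ∑ (λ i → f i + g i) ≡ ∑ f + ∑ g
∑-+ {zero}  f g = refl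
∑-+ {suc m} f g = trans (cong (f zero + g zero +_) (∑-+ (f ∘ suc) (g ∘ suc)))
  (arrange (f zero) (g zero) (∑ (f ∘ suc)) (∑ (g ∘ suc)))
  where
  arrange : ∀ w x y z → w + x + (y + z) ≡ w + y + (x + z)
  arrange = solve-∀

∑-≈ : ∀ h → let open Congruence h in ∀ {m} {f g : Fin m → ℕ} → (∀ i → f i ≈ g i) → ∑ f ≈ ∑ g
∑-≈ h {zero}  eq = Congruence.≈-refl h
∑-≈ h {suc m} eq = Congruence.+-cong-≈ h (eq zero) (∑-≈ h (eq ∘ suc))

module _ {A : Set} where

  gather : ∀ {m} → (Fin m → List A) → List A
  gather {zero}  f = []
  gather {suc m} f = f zero ++ gather (f ∘ suc)

  #-gather : ∀ (B : A → Bool) {m} (f : Fin m → List A) → # B (gather f) ≡ ∑ (λ i → # B (f i))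
  #-gather B {zero}  f = refl
  #-gather B {suc m} f = trans (#-++ B (f zero) _) (cong (# B (f zero) +_) (#-gather B (f ∘ suc)))

  length-gather : ∀ {m} (f : Fin m → List A) → length (gather f) ≡ ∑ (λ i → length (f i))
  length-gather {zero}  f = refl
  length-gather {suc m} f = trans (length-++ (f zero)) (cong (length (f zero) +_) (length-gather (f ∘ suc)))

  d-++ : ∀ (B : A → Bool) E E′ → d B (E ++ E′) ≡ d B E + d B E′
  d-++ B []            E′ = refl
  d-++ B ((x , y) ∷ E) E′ = trans (cong (ι (B x xor B y) +_) (d-++ B E E′)) (sym (+-assoc (ι (B x xor B y)) _ _))

d-gather : ∀ {A : Set} (B : A → Bool) {m} (f : Fin m → List (A × A)) → d B (gather f) ≡ ∑ (λ i → d B (f i))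
d-gather B {zero}  f = refl
d-gather B {suc m} f = trans (d-++ B (f zero) _) (cong (d B (f zero) +_) (d-gather B (f ∘ suc)))

module _ {A : Set} {P : A → Set} (P? : Decidable P) where

  length-filter-∷ : ∀ x l → length (filter P? (x ∷ l)) ≡ ι (does (P? x)) + length (filter P? l)
  length-filter-∷ x l with does (P? x)
  ... | true  = refl
  ... | false = refl

  length-filter-tabulate : ∀ {m} (f : Fin m → A) →
    length (filter P? (tabulate f)) ≡ ∑ (λ i → ι (does (P? (f i))))
  length-filter-tabulate {zero}  f = refl
  length-filter-tabulate {suc m} f = trans (length-filter-∷ (f zero) _)
    (cong (ι (does (P? (f zero))) +_) (length-filter-tabulate (f ∘ suc)))

length-filter-pairs : ∀ {A : Set} {P : A × Fin 2 → Set} (P? : Decidable P) {m} (f : Fin m → A) →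
  length (filter P? (cartesianProduct (tabulate f) (allFin 2))) ≡
  ∑ (λ i → ι (does (P? (f i , 0F))) + ι (does (P? (f i , 1F))))
length-filter-pairs P? {zero} f = refl
length-filter-pairs P? {suc m} f = begin
  length (filter P? ((f zero , 0F) ∷ (f zero , 1F) ∷ rest))
    ≡⟨ length-filter-∷ P? (f zero , 0F) _ ⟩
  ι (does (P? (f zero , 0F))) + length (filter P? ((f zero , 1F) ∷ rest))
    ≡⟨ cong (ι (does (P? (f zero , 0F))) +_) (length-filter-∷ P? (f zero , 1F) rest) ⟩
  ι (does (P? (f zero , 0F))) + (ι (does (P? (f zero , 1F))) + length (filter P? rest))
    ≡⟨ +-assoc (ι (does (P? (f zero , 0F)))) _ _ ⟨
  ι (does (P? (f zero , 0F))) + ι (does (P? (f zero , 1F))) + length (filter P? rest)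
    ≡⟨ cong (ι (does (P? (f zero , 0F))) + ι (does (P? (f zero , 1F))) +_) (length-filter-pairs P? (f ∘ suc)) ⟩
  ∑ (λ i → ι (does (P? (f i , 0F))) + ι (does (P? (f i , 1F)))) ∎
  where
  open ≡-Reasoning
  rest = cartesianProduct (tabulate (f ∘ suc)) (allFin 2)

∣tabulate∣ : ∀ {m} (f : Fin m → Bool) → ∣ Vec.tabulate f ∣ ≡ ∑ (ι ∘ f)
∣tabulate∣ {zero}  f = refl
∣tabulate∣ {suc m} f with f zero
... | true  = cong suc (∣tabulate∣ (f ∘ suc))
... | false = ∣tabulate∣ (f ∘ suc)

has : Sign → Sign → Bool
has s t = does (t Sign.≟ s)

-- States, admissible out-degrees and the induction hypothesis

module ModuloOrientation (n h′ : ℕ) where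

  h : ℕ
  h = suc h′

  open Congruence h

  V : Set
  V = Fin n

  VSet : Set
  VSet = V → Bool

  ⁅_⁆ : V → VSet
  ⁅ x ⁆ u = does (u Fin.≟ x)

  x∈⁅x⁆ : ∀ {x} → x ∈ ⁅ x ⁆
  x∈⁅x⁆ {x} = dec-true (x Fin.≟ x) refl

  ∉⁅⁆ : ∀ {x u} → u ≢ x → u ∉ ⁅ x ⁆
  ∉⁅⁆ {x} {u} u≢x = dec-false (u Fin.≟ x) u≢x

  ∈⁅⁆⇒≡ : ∀ {x u} → u ∈ ⁅ x ⁆ → u ≡ x
  ∈⁅⁆⇒≡ {x} {u} u∈ with yes eq ← u Fin.≟ x = eq

  ⁅⁆-⊑ : ∀ {U : VSet} {x} → x ∈ U → ⁅ x ⁆ ⊑ U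
  ⁅⁆-⊑ {x = x} x∈ {u} u∈ with refl ← ∈⁅⁆⇒≡ {x} {u} u∈ = x∈

  ∈∉⇒≢ : ∀ {B : VSet} {x y} → x ∈ B → y ∉ B → x ≢ y
  ∈∉⇒≢ {B} {x} x∈ y∉ refl = ∈∉-elim {B = B} {v = x} x∈ y∉

  singleton-or-more : ∀ B {x} → x ∈ B → (∃ λ u → u ∈ B × u ≢ x) ⊎ B ≗ ⁅ x ⁆
  singleton-or-more B {x} x∈ with Fin.any? (λ u → (B u Bool.≟ true) ×-dec ¬? (u Fin.≟ x))
  ... | yes more = inj₁ more
  ... | no none  = inj₂ same
    where
    same : B ≗ ⁅ x ⁆
    same u with u Fin.≟ x
    ... | yes refl = x∈
    ... | no u≢x   with ∈⊎∉ B u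
    ...   | inj₁ u∈ = ⊥-elim (none (u , u∈ , u≢x))
    ...   | inj₂ u∉ = u∉

  -- A graph with edges E, to be oriented such that the out-degree of v, plus the
  -- number of occurrences of v in s, is congruent to the number of occurrences
  -- of v in o. One further vertex z has its edges oriented already: a lists the
  -- heads of the edges leaving z, and b the tails of the edges entering z.
  record State : Set where
    constructor state
    field
      E       : List (Ends {V})
      o s a b : List V

  open State

  deg : State → VSet → ℕ
  deg S B = d B (E S) + (# B (a S) + # B (b S))

  -- Summed over `B`, the prescribed out-degrees are `# B o − # B s`. The edges inside `B` supply
  -- `e B E` of this whatever their directions, and the edges from `B` to z are added because `c`
  -- stands for all edges leaving `B`. Only the residue of `c` is tied to the demands; the actual
  -- directions at z do not bound it.
  Rep : State → VSet → ℕ → ℕ → Set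
  Rep S B = Split (deg S B) (# B (o S) + # B (b S)) (# B (s S) + e B (E S))

  AtLeast : ℕ → ℕ → State → VSet → Set
  AtLeast m m′ S B = ∃₂ λ c c′ → m ≤ c × m′ ≤ c′ × Rep S B c c′

  Good Strong Out In : State → VSet → Set
  Good   = AtLeast h h
  Strong = AtLeast p p
  Out    = AtLeast p h
  In     = AtLeast h p

  weaken : ∀ {m₁ m₁′ m m′ S B} → m ≤ m₁ → m′ ≤ m₁′ → AtLeast m₁ m₁′ S B → AtLeast m m′ S B
  weaken m≤ m′≤ (c , c′ , q , q′ , r) = c , c′ , ≤-trans m≤ q , ≤-trans m′≤ q′ , r

  h≤p : h ≤ p
  h≤p = n≤1+n h

  rep-cong : ∀ {S B B′ c c′} → B ≗ B′ → Rep S B c c′ → Rep S B′ c c′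
  rep-cong {S} {B} {B′} eq r
    rewrite d-cong eq (E S) | e-cong eq (E S) | #-cong eq (a S) | #-cong eq (b S) |
      #-cong eq (o S) | #-cong eq (s S) = r

  atLeast-cong : ∀ {S B B′ m m′} → B ≗ B′ → AtLeast m m′ S B → AtLeast m m′ S B′
  atLeast-cong {S} eq (c , c′ , q , q′ , r) = c , c′ , q , q′ , rep-cong {S} eq r

  -- The exceptional vertex, if any, is the element of X. It may have small degree,
  -- but is balanced: half of its edges may leave it.
  record Valid (U X : VSet) (S : State) : Set where
    field
      within      : Within U (E S)
      total       : # U (o S) ≈ # U (s S) + length (E S)
      balanced    : Balanced (# U (a S)) (# U (b S))
      good        : ∀ B → B ⊑ U → ∀ {x y} → x ∈ B → x ∉ X → y ∈ U → y ∉ B → Good S B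
      exceptional : ∀ {v} → v ∈ U → v ∈ X → ∃ λ m → Rep S ⁅ v ⁆ m m
      unique      : ∀ {u v} → u ∈ U → v ∈ U → u ∈ X → v ∈ X → u ≡ v

  open Valid

  -- The edges at z do not occur here; they matter only for `Valid`. Hence states that differ in `a`
  -- and `b` alone have the same solutions, and a solution after `lift-in` or `flip-in` also solves
  -- a mere `delete`.
  Sol : VSet → State → Set
  Sol U S = ∃ λ D → Orient (E S) D × (∀ {v} → v ∈ U → # ⁅ v ⁆ (o S) ≈ # ⁅ v ⁆ (s S) + # ⁅ v ⁆ (src D))

  size : VSet → ℕ
  size U = # U (allFin n)

  -- The out-parts of the two sides together account for one end of each crossing edge and for all
  -- edges into z, modulo `p`. Balance at z then bounds the number of free edges from below by
  -- `cut-bound`.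
  cut : ∀ {U X S B c c′ c₁ c₁′ m} → Valid U X S → B ⊑ U →
    Rep S B c c′ → Rep S (∁ U B) c₁ c₁′ → m ≤ c + c₁ → m ≤ c′ + c₁′ → m ≤ d B (E S) + h
  cut {U} {X} {S} {B} {c} {c′} {c₁} {c₁′} val sub (eq , con) (eq₁ , con₁) =
    cut-bound {d B (E S)} {# U (a S)} {# U (b S)} (balanced val) sizes demands
    where
    A = ∁ U B
    sizes : c + c₁ + (c′ + c₁′) ≡ d B (E S) + d B (E S) + (# U (a S) + # U (b S))
    sizes = begin
      c + c₁ + (c′ + c₁′)     ≡⟨ swap-middle c c₁ c′ c₁′ ⟩
      c + c′ + (c₁ + c₁′)     ≡⟨ cong₂ _+_ eq eq₁ ⟨
      deg S B + deg S A       ≡⟨ cong (λ t → deg S B + (t + (# A (a S) + # A (b S)))) (d-∁ (E S) (within val)) ⟩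
      deg S B + (d B (E S) + (# A (a S) + # A (b S)))
        ≡⟨ arrange (d B (E S)) (# B (a S)) (# B (b S)) (# A (a S)) (# A (b S)) ⟩
      d B (E S) + d B (E S) + ((# B (a S) + # A (a S)) + (# B (b S) + # A (b S)))
        ≡⟨ cong₂ (λ t t′ → d B (E S) + d B (E S) + (t + t′)) (#-∁ sub (a S)) (#-∁ sub (b S)) ⟨
      d B (E S) + d B (E S) + (# U (a S) + # U (b S)) ∎
      where
      open ≡-Reasoning
      swap-middle : ∀ w x y z → w + x + (y + z) ≡ w + y + (x + z)
      swap-middle = solve-∀
      arrange : ∀ d a b a₁ b₁ → d + (a + b) + (d + (a₁ + b₁)) ≡ d + d + ((a + a₁) + (b + b₁))
      arrange = solve-∀
    demands : c + c₁ ≈ d B (E S) + # U (b S)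
    demands = +-cancelʳ-≈ (# U (s S) + (e B (E S) + e A (E S))) (begin
      c + c₁ + (# U (s S) + (e B (E S) + e A (E S)))
        ≡⟨ cong (λ t → c + c₁ + (t + (e B (E S) + e A (E S)))) (#-∁ sub (s S)) ⟩
      c + c₁ + (# B (s S) + # A (s S) + (e B (E S) + e A (E S)))
        ≡⟨ arrange c c₁ (# B (s S)) (# A (s S)) (e B (E S)) (e A (E S)) ⟩
      # B (s S) + e B (E S) + c + (# A (s S) + e A (E S) + c₁)
        ≈⟨ +-cong-≈ con con₁ ⟨
      # B (o S) + # B (b S) + (# A (o S) + # A (b S))
        ≡⟨ swap-middle (# B (o S)) (# B (b S)) (# A (o S)) (# A (b S)) ⟩
      # B (o S) + # A (o S) + (# B (b S) + # A (b S))
        ≡⟨ cong₂ _+_ (#-∁ sub (o S)) (#-∁ sub (b S)) ⟨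
      # U (o S) + # U (b S)
        ≈⟨ +-cong-≈ (total val) ≈-refl ⟩
      # U (s S) + length (E S) + # U (b S)
        ≡⟨ cong (λ t → # U (s S) + t + # U (b S)) (length-split (E S) (within val)) ⟩
      # U (s S) + (e B (E S) + e A (E S) + d B (E S)) + # U (b S)
        ≡⟨ arrange′ (# U (s S)) (e B (E S) + e A (E S)) (d B (E S)) (# U (b S)) ⟩
      d B (E S) + # U (b S) + (# U (s S) + (e B (E S) + e A (E S))) ∎)
      where
      open ≈-Reasoning
      swap-middle : ∀ w x y z → w + x + (y + z) ≡ w + y + (x + z)
      swap-middle = solve-∀
      arrange : ∀ c c₁ s s₁ e e₁ → c + c₁ + (s + s₁ + (e + e₁)) ≡ s + e + c + (s₁ + e₁ + c₁)
      arrange = solve-∀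
      arrange′ : ∀ s e d b → s + (e + d) + b ≡ d + b + (s + e)
      arrange′ = solve-∀

  -- Operations on states and their effect on splits

  drop-in-state drop-out-state : State → List V → State
  drop-in-state  S a′ = record S { a = a′ }
  drop-out-state S b′ = record S { b = b′ }

  delete : State → V → List Ends → State
  delete S x E′ = record S { E = E′ ; s = x ∷ s S }

  -- Lifting replaces two edges at v by one edge that avoids v. In lift-in and
  -- lift-out one of the two edges, and hence the new edge, is incident with z.
  lift-in lift-out : State → V → V → List Ends → List V → State
  lift-in  S v y E′ a′ = state E′ (o S) (v ∷ s S) (y ∷ a′) (b S)
  lift-out S v y E′ b′ = state E′ (o S) (y ∷ s S) (a S) (y ∷ b′)

  lift : State → V → V → V → List Ends → State
  lift S v y y′ E′ = state ((y , y′) ∷ E′) (o S) (v ∷ s S) (a S) (b S)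

  -- An edge between z and x is replaced by h edges in the opposite direction, and
  -- the edge xy is deleted, directed towards x in flip-in and away from x in flip-out.
  flip-in flip-out : State → V → V → List Ends → List V → State
  flip-in  S x y E′ a′ = state E′ (o S) (y ∷ s S) a′ (replicate h x ++ b S)
  flip-out S x y E′ b′ = state E′ (o S) (x ∷ s S) (replicate h x ++ a S) b′

  module _ {S : State} {x : V} {a′ : List V} (pa : Pick (a S) x a′) (B : VSet) where

    drop-in-∈ : x ∈ B → ∀ {c c′} → Rep S B c (suc c′) → Rep (drop-in-state S a′) B c c′
    drop-in-∈ x∈ r rewrite pick-# B pa | x∈ = drop-in (d B (E S)) (# B a′) (# B (b S)) r

    drop-in-∉ : x ∉ B → ∀ {c c′} → Rep S B c c′ → Rep (drop-in-state S a′) B c c′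
    drop-in-∉ x∉ r rewrite pick-# B pa | x∉ = r

  module _ {S : State} {x : V} {b′ : List V} (pb : Pick (b S) x b′) (B : VSet) where

    drop-out-∈ : x ∈ B → ∀ {c c′} → Rep S B (suc c) c′ → Rep (drop-out-state S b′) B c c′
    drop-out-∈ x∈ r rewrite pick-# B pb | x∈ = drop-out (d B (E S)) _ _ (# B (o S)) r

    drop-out-∉ : x ∉ B → ∀ {c c′} → Rep S B c c′ → Rep (drop-out-state S b′) B c c′
    drop-out-∉ x∉ r rewrite pick-# B pb | x∉ = r

  module _ {S : State} {x y : V} {E′ : List Ends} (pk : PickEdge (E S) x y E′) (B : VSet) where

    delete-∈∈ : x ∈ B → y ∈ B → ∀ {c c′} → Rep S B c c′ → Rep (delete S x E′) B c c′
    delete-∈∈ x∈ y∈ r rewrite pick-d B pk | pick-e B pk | x∈ | y∈ = inside r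

    delete-∈∉ : x ∈ B → y ∉ B → ∀ {c c′} → Rep S B (suc c) c′ → Rep (delete S x E′) B c c′
    delete-∈∉ x∈ y∉ r rewrite pick-d B pk | pick-e B pk | x∈ | y∉ = leave r

    delete-∉∈ : x ∉ B → y ∈ B → ∀ {c c′} → Rep S B c (suc c′) → Rep (delete S x E′) B c c′
    delete-∉∈ x∉ y∈ r rewrite pick-d B pk | pick-e B pk | x∉ | y∈ = enter r

    delete-∉∉ : x ∉ B → y ∉ B → ∀ {c c′} → Rep S B c c′ → Rep (delete S x E′) B c c′
    delete-∉∉ x∉ y∉ r rewrite pick-d B pk | pick-e B pk | x∉ | y∉ = r

  module _ {S : State} {v y : V} {E′ : List Ends} {a′ : List V}
    (pk : PickEdge (E S) v y E′) (pa : Pick (a S) v a′) (B : VSet) where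

    lift-in-∈∈ : v ∈ B → y ∈ B → ∀ {c c′} → Rep S B c c′ → Rep (lift-in S v y E′ a′) B c c′
    lift-in-∈∈ v∈ y∈ r rewrite pick-d B pk | pick-e B pk | pick-# B pa | v∈ | y∈ = inside r

    lift-in-∈∉ : v ∈ B → y ∉ B → ∀ {c c′} → Rep S B (suc c) (suc c′) → Rep (lift-in S v y E′ a′) B c c′
    lift-in-∈∉ v∈ y∉ r rewrite pick-d B pk | pick-e B pk | pick-# B pa | v∈ | y∉ =
      drop-in (d B E′) (# B a′) (# B (b S)) (leave r)

    lift-in-∉∈ : v ∉ B → y ∈ B → ∀ {c c′} → Rep S B c (suc c′) → Rep (lift-in S v y E′ a′) B c (suc c′)
    lift-in-∉∈ v∉ y∈ r rewrite pick-d B pk | pick-e B pk | pick-# B pa | v∉ | y∈ =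
      add-in (d B E′) (# B a′) (# B (b S)) (enter r)

    lift-in-∉∉ : v ∉ B → y ∉ B → ∀ {c c′} → Rep S B c c′ → Rep (lift-in S v y E′ a′) B c c′
    lift-in-∉∉ v∉ y∉ r rewrite pick-d B pk | pick-e B pk | pick-# B pa | v∉ | y∉ = r

    flip-in-∈∈ : v ∈ B → y ∈ B → ∀ {c c′} → Rep S B (suc c) c′ → Rep (flip-in S v y E′ a′) B c (c′ + h)
    flip-in-∈∈ v∈ y∈ r rewrite pick-d B pk | pick-e B pk | pick-# B pa | #-++ B (replicate h v) (b S) |
      #-replicate-∈ B h v∈ | v∈ | y∈ = inside (in⇒outs (d B E′) _ _ (# B (o S)) r)

    flip-in-∈∉ : v ∈ B → y ∉ B → ∀ {c c′} → Rep S B (suc c) c′ → Rep (flip-in S v y E′ a′) B c (c′ + h′)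
    flip-in-∈∉ v∈ y∉ {c} {c′} r rewrite pick-d B pk | pick-e B pk | pick-# B pa | #-++ B (replicate h v) (b S) |
      #-replicate-∈ B h v∈ | v∈ | y∉ =
      enter-+ h′ (in⇒outs (suc (d B E′)) (# B a′) (# B (b S)) (# B (o S)) r)

    flip-in-∉∈ : v ∉ B → y ∈ B → ∀ {c c′} → Rep S B (suc c) c′ → Rep (flip-in S v y E′ a′) B c c′
    flip-in-∉∈ v∉ y∈ r rewrite pick-d B pk | pick-e B pk | pick-# B pa | #-++ B (replicate h v) (b S) |
      #-replicate-∉ B h v∉ | v∉ | y∈ = leave r

    flip-in-∉∉ : v ∉ B → y ∉ B → ∀ {c c′} → Rep S B c c′ → Rep (flip-in S v y E′ a′) B c c′
    flip-in-∉∉ v∉ y∉ r rewrite pick-d B pk | pick-e B pk | pick-# B pa | #-++ B (replicate h v) (b S) |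
      #-replicate-∉ B h v∉ | v∉ | y∉ = r

  module _ {S : State} {v y : V} {E′ : List Ends} {b′ : List V}
    (pk : PickEdge (E S) v y E′) (pb : Pick (b S) v b′) (B : VSet) where

    lift-out-∈∈ : v ∈ B → y ∈ B → ∀ {c c′} → Rep S B c c′ → Rep (lift-out S v y E′ b′) B c c′
    lift-out-∈∈ v∈ y∈ r rewrite pick-d B pk | pick-e B pk | pick-# B pb | v∈ | y∈ = inside r

    lift-out-∈∉ : v ∈ B → y ∉ B → ∀ {c c′} → Rep S B (suc c) (suc c′) → Rep (lift-out S v y E′ b′) B c c′
    lift-out-∈∉ v∈ y∉ r rewrite pick-d B pk | pick-e B pk | pick-# B pb | v∈ | y∉ =
      drop-out (d B E′) _ _ (# B (o S)) (enter r)

    lift-out-∉∈ : v ∉ B → y ∈ B → ∀ {c c′} → Rep S B (suc c) c′ → Rep (lift-out S v y E′ b′) B (suc c) c′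
    lift-out-∉∈ v∉ y∈ r rewrite pick-d B pk | pick-e B pk | pick-# B pb | v∉ | y∈ =
      add-out (d B E′) _ _ (# B (o S)) (leave r)

    lift-out-∉∉ : v ∉ B → y ∉ B → ∀ {c c′} → Rep S B c c′ → Rep (lift-out S v y E′ b′) B c c′
    lift-out-∉∉ v∉ y∉ r rewrite pick-d B pk | pick-e B pk | pick-# B pb | v∉ | y∉ = r

    flip-out-∈∈ : v ∈ B → y ∈ B → ∀ {c c′} → Rep S B c (suc c′) → Rep (flip-out S v y E′ b′) B (c + h) c′
    flip-out-∈∈ v∈ y∈ r rewrite pick-d B pk | pick-e B pk | pick-# B pb | #-++ B (replicate h v) (a S) |
      #-replicate-∈ B h v∈ | v∈ | y∈ = inside (out⇒ins (d B E′) _ _ (# B (o S)) r)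

    flip-out-∈∉ : v ∈ B → y ∉ B → ∀ {c c′} → Rep S B c (suc c′) → Rep (flip-out S v y E′ b′) B (c + h′) c′
    flip-out-∈∉ v∈ y∉ {c} {c′} r rewrite pick-d B pk | pick-e B pk | pick-# B pb | #-++ B (replicate h v) (a S) |
      #-replicate-∈ B h v∈ | v∈ | y∉ =
      leave-+ h′ (out⇒ins (suc (d B E′)) (# B (a S)) (# B b′) (# B (o S)) r)

    flip-out-∉∈ : v ∉ B → y ∈ B → ∀ {c c′} → Rep S B c (suc c′) → Rep (flip-out S v y E′ b′) B c c′
    flip-out-∉∈ v∉ y∈ r rewrite pick-d B pk | pick-e B pk | pick-# B pb | #-++ B (replicate h v) (a S) |
      #-replicate-∉ B h v∉ | v∉ | y∈ = enter r

    flip-out-∉∉ : v ∉ B → y ∉ B → ∀ {c c′} → Rep S B c c′ → Rep (flip-out S v y E′ b′) B c c′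
    flip-out-∉∉ v∉ y∉ r rewrite pick-d B pk | pick-e B pk | pick-# B pb | #-++ B (replicate h v) (a S) |
      #-replicate-∉ B h v∉ | v∉ | y∉ = r

  module _ {S : State} {v y y′ : V} {E₁ E′ : List Ends}
    (pk : PickEdge (E S) v y E₁) (pk′ : PickEdge E₁ v y′ E′) (B : VSet) where

    lift-separated : v ∈ B → y ∉ B → y′ ∉ B → ∀ {c c′} →
      Rep S B (suc c) (suc c′) → Rep (lift S v y y′ E′) B c c′
    lift-separated v∈ y∉ y′∉ r rewrite pick-d B pk | pick-e B pk | pick-d B pk′ | pick-e B pk′ |
      v∈ | y∉ | y′∉ = enter (leave r)

    lift-separated′ : v ∉ B → y ∈ B → y′ ∈ B → ∀ {c c′} →
      Rep S B (suc c) (suc c′) → Rep (lift S v y y′ E′) B c c′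
    lift-separated′ v∉ y∈ y′∈ {c} r rewrite pick-d B pk | pick-e B pk | pick-d B pk′ | pick-e B pk′ |
      v∉ | y∈ | y′∈ with enter (leave r)
    ... | eq , con = eq , ≈-trans con (≈-reflexive (cong (_+ c) (sym (+-suc (# B (s S)) (e B E′)))))

    lift-∈ : v ∈ B → y ∈ B ⊎ y′ ∈ B → ∀ {c c′} → Rep S B c c′ → Rep (lift S v y y′ E′) B c c′
    lift-∈ v∈ (inj₁ y∈) r rewrite pick-d B pk | pick-e B pk | pick-d B pk′ | pick-e B pk′ |
      v∈ | y∈ with B y′
    ... | true  = inside r
    ... | false = inside r
    lift-∈ v∈ (inj₂ y′∈) r rewrite pick-d B pk | pick-e B pk | pick-d B pk′ | pick-e B pk′ |
      v∈ | y′∈ with B y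
    ... | true  = inside r
    ... | false = inside r

    lift-∉ : v ∉ B → y ∉ B ⊎ y′ ∉ B → ∀ {c c′} → Rep S B c c′ → Rep (lift S v y y′ E′) B c c′
    lift-∉ v∉ (inj₁ y∉) r rewrite pick-d B pk | pick-e B pk | pick-d B pk′ | pick-e B pk′ |
      v∉ | y∉ with B y′
    ... | true  = r
    ... | false = r
    lift-∉ v∉ (inj₂ y′∉) r rewrite pick-d B pk | pick-e B pk | pick-d B pk′ | pick-e B pk′ |
      v∉ | y′∉ with B y
    ... | true  = r
    ... | false = r

  module _ {S S′ : State} {B : VSet} where

    same : (∀ {c c′} → Rep S B c c′ → Rep S′ B c c′) → Good S B → Good S′ B
    same f (c , c′ , q , q′ , r) = c , c′ , q , q′ , f r

    fewer-out : (∀ {c c′} → Rep S B (suc c) c′ → Rep S′ B c c′) → Out S B → Good S′ B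
    fewer-out f (suc c , c′ , s≤s q , q′ , r) = c , c′ , q , q′ , f r

    fewer-in : (∀ {c c′} → Rep S B c (suc c′) → Rep S′ B c c′) → In S B → Good S′ B
    fewer-in f (c , suc c′ , q , s≤s q′ , r) = c , c′ , q , q′ , f r

    fewer : (∀ {c c′} → Rep S B (suc c) (suc c′) → Rep S′ B c c′) → Strong S B → Good S′ B
    fewer f (suc c , suc c′ , s≤s q , s≤s q′ , r) = c , c′ , q , q′ , f r

    same-in : (∀ {c c′} → Rep S B c (suc c′) → Rep S′ B c (suc c′)) → Good S B → Good S′ B
    same-in f (c , suc c′ , q , q′ , r) = c , suc c′ , q , q′ , f r

    same-out : (∀ {c c′} → Rep S B (suc c) c′ → Rep S′ B (suc c) c′) → Good S B → Good S′ B
    same-out f (suc c , c′ , q , q′ , r) = suc c , c′ , q , q′ , f r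

    flip-in-good : ∀ k → (∀ {c c′} → Rep S B (suc c) c′ → Rep S′ B c (c′ + k)) → Out S B → Good S′ B
    flip-in-good k f (suc c , c′ , s≤s q , q′ , r) = c , c′ + k , q , ≤-trans q′ (m≤m+n c′ k) , f r

    flip-out-good : ∀ k → (∀ {c c′} → Rep S B c (suc c′) → Rep S′ B (c + k) c′) → In S B → Good S′ B
    flip-out-good k f (c , suc c′ , q , s≤s q′ , r) = c + k , c′ , ≤-trans q (m≤m+n c k) , q′ , f r

  sol-delete : ∀ {U S x y E′} → PickEdge (E S) x y E′ → Sol U (delete S x E′) → Sol U S
  sol-delete {U} {S} {x} pk (D , or , demand) = let D′ , or′ , eq = orient-pick pk or in
    D′ , or′ , λ {v} v∈ → ≈-trans (demand v∈) (≈-reflexive (begin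
      ι (⁅ v ⁆ x) + # ⁅ v ⁆ (s S) + # ⁅ v ⁆ (src D)    ≡⟨ arrange (ι (⁅ v ⁆ x)) _ _ ⟩
      # ⁅ v ⁆ (s S) + (ι (⁅ v ⁆ x) + # ⁅ v ⁆ (src D))  ≡⟨ cong (# ⁅ v ⁆ (s S) +_) (eq ⁅ v ⁆) ⟨
      # ⁅ v ⁆ (s S) + # ⁅ v ⁆ (src D′)                 ∎))
    where
    open ≡-Reasoning
    arrange : ∀ a b c → a + b + c ≡ b + (a + c)
    arrange = solve-∀

  -- The new edge is subdivided by `v` again. The path leaves `v` exactly once in either direction,
  -- which is the entry `v` that `lift` puts into `s`.
  sol-lift : ∀ {U S v y y′ E₁ E′} → PickEdge (E S) v y E₁ → PickEdge E₁ v y′ E′ →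
    Sol U (lift S v y y′ E′) → Sol U S
  sol-lift {U} {S} {v} {y} {y′} {E₁} pk pk′ (D , keep or , demand) =
    sol-delete {U} {S} (pick-sym pk) (sol-delete {U} {delete S y E₁} pk′
      (_ , or , λ {u} u∈ → ≈-trans (demand u∈) (≈-reflexive
        (arrange (ι (⁅ u ⁆ v)) (# ⁅ u ⁆ (s S)) (ι (⁅ u ⁆ y)) _))))
    where
    arrange : ∀ a b c d → a + b + (c + d) ≡ a + (c + b) + d
    arrange = solve-∀
  sol-lift {U} {S} {v} {y} {y′} {E₁} pk pk′ (D , turn or , demand) =
    sol-delete {U} {S} pk (sol-delete {U} {delete S v E₁} (pick-sym pk′)
      (_ , or , λ {u} u∈ → ≈-trans (demand u∈) (≈-reflexive
        (arrange (ι (⁅ u ⁆ v)) (# ⁅ u ⁆ (s S)) (ι (⁅ u ⁆ y′)) _))))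
    where
    arrange : ∀ a b c d → a + b + (c + d) ≡ c + (a + b) + d
    arrange = solve-∀

  -- Lifting at the exceptional vertex

  Nontrivial : VSet → State → Set
  Nontrivial U S = ∀ B → B ⊑ U → ∀ {x x′ y} → x ∈ B → x′ ∈ B → x ≢ x′ → y ∈ U → y ∉ B → Strong S B

  total-delete : ∀ {U X S x y E′} → Valid U X S → PickEdge (E S) x y E′ →
    # U (o S) ≈ ι (U x) + # U (s S) + length E′
  total-delete {U} {X} {S} {x} {E′ = E′} val pk = ≈-trans (total val) (≈-reflexive (begin
    # U (s S) + length (E S)         ≡⟨ cong (# U (s S) +_) (pick-length pk) ⟩
    # U (s S) + suc (length E′)      ≡⟨ +-suc (# U (s S)) (length E′) ⟩
    1 + # U (s S) + length E′        ≡⟨ cong (λ t → ι t + # U (s S) + length E′) (proj₁ (proj₁ (pick-within pk (within val)))) ⟨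
    ι (U x) + # U (s S) + length E′  ∎))
    where open ≡-Reasoning

  module _ {U X : VSet} {S : State} (val : Valid U X S) (nt : Nontrivial U S)
    {v : V} (v∈U : v ∈ U) (v∈X : v ∈ X) where

    private
      -- An ordinary vertex differs from `v`, so a set containing both is covered by `nt`.
      around : ∀ B → B ⊑ U → ∀ {x z} → x ∈ B → x ∉ X → z ∈ U → z ∉ B → v ∈ B → Strong S B
      around B sub {x} x∈ x∉ z∈ z∉ v∈ =
        nt B sub x∈ v∈ (λ x≡v → ∈∉-elim {B = X} (trans (cong X x≡v) v∈X) x∉) z∈ z∉

      only : ∀ {S′ m} → Rep S′ ⁅ v ⁆ m m → ∀ {u} → u ∈ U → u ∈ X → ∃ λ m → Rep S′ ⁅ u ⁆ m m
      only r u∈ u∈X with refl ← unique val u∈ v∈U u∈X v∈X = _ , r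

    -- Only sets that contain `v` but not `y` lose degree, one edge in each direction. Those with an
    -- ordinary vertex have the slack for it, and `v` itself stays balanced with `m` in place of
    -- `suc m`.
    lift-in-valid : ∀ {m y E′ a′} → Rep S ⁅ v ⁆ (suc m) (suc m) → y ≢ v →
      PickEdge (E S) v y E′ → Pick (a S) v a′ → Valid U X (lift-in S v y E′ a′)
    lift-in-valid {m} {y} {E′} {a′} r y≢v pk pa = record
      { within      = proj₂ ends
      ; total       = total-delete val pk
      ; balanced    = subst (λ t → Balanced t (# U (b S))) moved (balanced val)
      ; good        = good′
      ; exceptional = only {S′} {m} (lift-in-∈∉ {S} pk pa ⁅ v ⁆ (x∈⁅x⁆ {v}) (∉⁅⁆ y≢v) r)
      ; unique      = unique val
      }
      where
      S′ = lift-in S v y E′ a′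
      ends = pick-within pk (within val)
      moved : # U (a S) ≡ # U (y ∷ a′)
      moved = trans (pick-# U pa)
        (cong (λ t → ι t + # U a′) (trans (proj₁ (proj₁ ends)) (sym (proj₂ (proj₁ ends)))))
      good′ : ∀ B → B ⊑ U → ∀ {x z} → x ∈ B → x ∉ X → z ∈ U → z ∉ B → Good S′ B
      good′ B sub x∈ x∉ z∈ z∉ with ∈⊎∉ B v | ∈⊎∉ B y
      ... | inj₁ v∈ | inj₁ y∈ = same {S} {S′} (lift-in-∈∈ {S} pk pa B v∈ y∈) (good val B sub x∈ x∉ z∈ z∉)
      ... | inj₁ v∈ | inj₂ y∉ = fewer {S} {S′} (lift-in-∈∉ {S} pk pa B v∈ y∉) (around B sub x∈ x∉ z∈ z∉ v∈)
      ... | inj₂ v∉ | inj₁ y∈ = same-in {S} {S′} (lift-in-∉∈ {S} pk pa B v∉ y∈) (good val B sub x∈ x∉ z∈ z∉)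
      ... | inj₂ v∉ | inj₂ y∉ = same {S} {S′} (lift-in-∉∉ {S} pk pa B v∉ y∉) (good val B sub x∈ x∉ z∈ z∉)

    lift-out-valid : ∀ {m y E′ b′} → Rep S ⁅ v ⁆ (suc m) (suc m) → y ≢ v →
      PickEdge (E S) v y E′ → Pick (b S) v b′ → Valid U X (lift-out S v y E′ b′)
    lift-out-valid {m} {y} {E′} {b′} r y≢v pk pb = record
      { within      = proj₂ ends
      ; total       = total-delete val (pick-sym pk)
      ; balanced    = subst (Balanced (# U (a S))) moved (balanced val)
      ; good        = good′
      ; exceptional = only {S′} {m} (lift-out-∈∉ {S} pk pb ⁅ v ⁆ (x∈⁅x⁆ {v}) (∉⁅⁆ y≢v) r)
      ; unique      = unique val
      }
      where
      S′ = lift-out S v y E′ b′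
      ends = pick-within pk (within val)
      moved : # U (b S) ≡ # U (y ∷ b′)
      moved = trans (pick-# U pb)
        (cong (λ t → ι t + # U b′) (trans (proj₁ (proj₁ ends)) (sym (proj₂ (proj₁ ends)))))
      good′ : ∀ B → B ⊑ U → ∀ {x z} → x ∈ B → x ∉ X → z ∈ U → z ∉ B → Good S′ B
      good′ B sub x∈ x∉ z∈ z∉ with ∈⊎∉ B v | ∈⊎∉ B y
      ... | inj₁ v∈ | inj₁ y∈ = same {S} {S′} (lift-out-∈∈ {S} pk pb B v∈ y∈) (good val B sub x∈ x∉ z∈ z∉)
      ... | inj₁ v∈ | inj₂ y∉ = fewer {S} {S′} (lift-out-∈∉ {S} pk pb B v∈ y∉) (around B sub x∈ x∉ z∈ z∉ v∈)
      ... | inj₂ v∉ | inj₁ y∈ = same-out {S} {S′} (lift-out-∉∈ {S} pk pb B v∉ y∈) (good val B sub x∈ x∉ z∈ z∉)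
      ... | inj₂ v∉ | inj₂ y∉ = same {S} {S′} (lift-out-∉∉ {S} pk pb B v∉ y∉) (good val B sub x∈ x∉ z∈ z∉)

    -- Besides the sets separating `v` from both neighbours, those containing `y` and `y′` but not
    -- `v` lose an edge in each direction. Their slack is a hypothesis, since `y` and `y′` may
    -- coincide and such a set may be a single vertex.
    lift-valid : ∀ {m y y′ E₁ E′} → Rep S ⁅ v ⁆ (suc m) (suc m) → y ≢ v → y′ ≢ v →
      PickEdge (E S) v y E₁ → PickEdge E₁ v y′ E′ →
      (∀ B → B ⊑ U → ∀ {z} → y ∈ B → y′ ∈ B → z ∈ U → z ∉ B → Strong S B) →
      Valid U X (lift S v y y′ E′)
    lift-valid {m} {y} {y′} {E₁} {E′} r y≢v y′≢v pk pk′ both = record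
      { within      = (proj₂ (proj₁ ends) , proj₂ (proj₁ ends′)) ∷ proj₂ ends′
      ; total       = ≈-trans (total-delete val pk)
          (≈-reflexive (cong (ι (U v) + # U (s S) +_) (pick-length pk′)))
      ; balanced    = balanced val
      ; good        = good′
      ; exceptional = only {S′} {m}
          (lift-separated {S} pk pk′ ⁅ v ⁆ (x∈⁅x⁆ {v}) (∉⁅⁆ y≢v) (∉⁅⁆ y′≢v) r)
      ; unique      = unique val
      }
      where
      S′ = lift S v y y′ E′
      ends  = pick-within pk (within val)
      ends′ = pick-within pk′ (proj₂ ends)
      good′ : ∀ B → B ⊑ U → ∀ {x z} → x ∈ B → x ∉ X → z ∈ U → z ∉ B → Good S′ B
      good′ B sub x∈ x∉ z∈ z∉ with ∈⊎∉ B v | ∈⊎∉ B y | ∈⊎∉ B y′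
      ... | inj₁ v∈ | inj₁ y∈ | _ = same {S} {S′} (lift-∈ {S} pk pk′ B v∈ (inj₁ y∈)) (good val B sub x∈ x∉ z∈ z∉)
      ... | inj₁ v∈ | inj₂ y∉ | inj₁ y′∈ = same {S} {S′} (lift-∈ {S} pk pk′ B v∈ (inj₂ y′∈)) (good val B sub x∈ x∉ z∈ z∉)
      ... | inj₁ v∈ | inj₂ y∉ | inj₂ y′∉ =
        fewer {S} {S′} (lift-separated {S} pk pk′ B v∈ y∉ y′∉) (around B sub x∈ x∉ z∈ z∉ v∈)
      ... | inj₂ v∉ | inj₂ y∉ | _ = same {S} {S′} (lift-∉ {S} pk pk′ B v∉ (inj₁ y∉)) (good val B sub x∈ x∉ z∈ z∉)
      ... | inj₂ v∉ | inj₁ y∈ | inj₂ y′∉ = same {S} {S′} (lift-∉ {S} pk pk′ B v∉ (inj₂ y′∉)) (good val B sub x∈ x∉ z∈ z∉)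
      ... | inj₂ v∉ | inj₁ y∈ | inj₁ y′∈ =
        fewer {S} {S′} (lift-separated′ {S} pk pk′ B v∉ y∈ y′∈) (both B sub y∈ y′∈ z∈ z∉)

  -- As soon as the set has a vertex besides `x`, it is strong; so bounds up to `p` need to be known
  -- for single vertices only.
  promote : ∀ {U S} → Nontrivial U S → ∀ {m m′ x} → m ≤ p → m′ ≤ p → AtLeast m m′ S ⁅ x ⁆ →
    ∀ B → B ⊑ U → x ∈ B → ∀ {z} → z ∈ U → z ∉ B → AtLeast m m′ S B
  promote {U} {S} nt {x = x} m≤ m′≤ at B sub x∈ z∈ z∉ with singleton-or-more B {x} x∈
  ... | inj₁ (u , u∈ , u≢x) = weaken {S = S} {B} m≤ m′≤ (nt B sub u∈ x∈ u≢x z∈ z∉)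
  ... | inj₂ single = atLeast-cong {S} (λ u → sym (single u)) at

  infixr 6 _∪_
  _∪_ : VSet → VSet → VSet
  (B ∪ C) u = B u ∨ C u

  -- All edges leaving `B` end in `C`. The form is that of an unsuccessful `pick-edge` for an edge
  -- from `B` to a vertex outside both sets.
  Hanging : VSet → VSet → List Ends → Set
  Hanging B C = All (λ (x , y) →
    (B x ∧ (not (B y) ∧ not (C y))) ≡ false × (B y ∧ (not (B x) ∧ not (C x))) ≡ false)

  module _ (B C : VSet) (disjoint : ∀ u → (B u ∧ C u) ≡ false) where

    #-∪ : ∀ l → # (B ∪ C) l ≡ # B l + # C l
    #-∪ [] = refl
    #-∪ (u ∷ l) = trans (cong₂ _+_ (add (B u) (C u) (disjoint u)) (#-∪ l))
      (arrange (ι (B u)) (ι (C u)) (# B l) (# C l))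
      where
      add : ∀ b c → (b ∧ c) ≡ false → ι (b ∨ c) ≡ ι b + ι c
      add false c     _ = refl
      add true  false _ = refl
      arrange : ∀ w x y z → w + x + (y + z) ≡ w + y + (x + z)
      arrange = solve-∀

    private
      edge : ∀ b c b′ c′ → (b ∧ c) ≡ false → (b′ ∧ c′) ≡ false →
        (b ∧ (not b′ ∧ not c′)) ≡ false → (b′ ∧ (not b ∧ not c)) ≡ false →
        ι (c xor c′) ≡ ι ((b ∨ c) xor (b′ ∨ c′)) + ι (b xor b′) ×
        ι ((b ∨ c) ∧ (b′ ∨ c′)) ≡ ι (c ∧ c′) + ι (b ∧ b′) + ι (b xor b′)
      edge true  false true  false _ _ _ _ = refl , refl
      edge true  false false true  _ _ _ _ = refl , refl
      edge false true  true  false _ _ _ _ = refl , refl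
      edge false true  false true  _ _ _ _ = refl , refl
      edge false true  false false _ _ _ _ = refl , refl
      edge false false false true  _ _ _ _ = refl , refl
      edge false false false false _ _ _ _ = refl , refl

    hanging-counts : ∀ E → Hanging B C E →
      d C E ≡ d (B ∪ C) E + d B E × e (B ∪ C) E ≡ e C E + e B E + d B E
    hanging-counts [] [] = refl , refl
    hanging-counts ((x , y) ∷ E) ((q , q′) ∷ hs) =
      let eq , eq′ = edge (B x) (C x) (B y) (C y) (disjoint x) (disjoint y) q q′
          ih , ih′ = hanging-counts E hs in
      trans (cong₂ _+_ {y = ι ((B x ∨ C x) xor (B y ∨ C y)) + ι (B x xor B y)} eq ih)
        (arrange (ι ((B x ∨ C x) xor (B y ∨ C y))) (ι (B x xor B y)) (d (B ∪ C) E) (d B E)) ,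
      trans (cong₂ _+_ {y = ι (C x ∧ C y) + ι (B x ∧ B y) + ι (B x xor B y)} eq′ ih′)
        (arrange′ (ι (C x ∧ C y)) (ι (B x ∧ B y)) (ι (B x xor B y)) (e C E) (e B E) (d B E))
      where
      arrange : ∀ w x y z → w + x + (y + z) ≡ w + y + (x + z)
      arrange = solve-∀
      arrange′ : ∀ u v w x y z → u + v + w + (x + y + z) ≡ u + x + (v + y) + (w + z)
      arrange′ = solve-∀

    -- Taking `B` away from `B ∪ C` turns the edges between `B` and `C` into boundary edges of `C`.
    -- The balanced split of `B` allots `m` of them to each direction.
    hanging-rep : ∀ {S c c′ m} → d C (E S) ≡ d (B ∪ C) (E S) + d B (E S) →
      e (B ∪ C) (E S) ≡ e C (E S) + e B (E S) + d B (E S) → # B (a S) ≡ 0 → # B (b S) ≡ 0 →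
      Rep S B m m → Rep S (B ∪ C) c c′ → Rep S C (c + m) (c′ + m)
    hanging-rep {S} {c} {c′} {m} d≡ e≡ a≡ b≡ (eq , con) (eq′ , con′)
      rewrite #-∪ (a S) | #-∪ (b S) | #-∪ (o S) | #-∪ (s S) | a≡ | b≡ | d≡ | e≡ |
        +-identityʳ (d B (E S)) | +-identityʳ (# B (o S)) | eq =
      trans (arrange (d (B ∪ C) (E S)) m (# C (a S)) (# C (b S)))
        (trans (cong (_+ (m + m)) eq′) (arrange′ c c′ m)) ,
      +-cancelʳ-≈ (# B (o S)) (begin
        # C (o S) + # C (b S) + # B (o S)
          ≡⟨ arrange″ (# C (o S)) (# C (b S)) (# B (o S)) ⟩
        # B (o S) + # C (o S) + # C (b S)
          ≈⟨ con′ ⟩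
        # B (s S) + # C (s S) + (e C (E S) + e B (E S) + (m + m)) + c
          ≡⟨ arrange‴ (# B (s S)) (# C (s S)) (e C (E S)) (e B (E S)) m c ⟩
        # C (s S) + e C (E S) + (c + m) + (# B (s S) + e B (E S) + m)
          ≈⟨ +-cong-≈ (≈-refl {# C (s S) + e C (E S) + (c + m)}) con ⟨
        # C (s S) + e C (E S) + (c + m) + # B (o S) ∎)
      where
      open ≈-Reasoning
      arrange : ∀ d m a b → d + (m + m) + (a + b) ≡ d + (a + b) + (m + m)
      arrange = solve-∀
      arrange′ : ∀ c c′ m → c + c′ + (m + m) ≡ c + m + (c′ + m)
      arrange′ = solve-∀
      arrange″ : ∀ x y z → x + y + z ≡ z + x + y
      arrange″ = solve-∀
      arrange‴ : ∀ s s₁ e e₁ m c → s + s₁ + (e + e₁ + (m + m)) + c ≡ s₁ + e + (c + m) + (s + e₁ + m)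
      arrange‴ = solve-∀

  module _ {U X : VSet} {S : State} (val : Valid U X S) (nt : Nontrivial U S)
    {v w w′ : V} (v∈U : v ∈ U) (v∈X : v ∈ X)
    (w∈ : w ∈ U) (w′∈ : w′ ∈ U) (w≢v : w ≢ v) (w′≢v : w′ ≢ v) (w≢w′ : w ≢ w′)
    (rec : ∀ S′ → length (E S′) < length (E S) → Valid U X S′ → Sol U S′) where

    private
      shorter : ∀ {x y E′} → PickEdge (E S) x y E′ → length E′ < length (E S)
      shorter pk = ≤-reflexive (sym (pick-length pk))

      ∉⇒≢ : ∀ {y} → y ∉ ⁅ v ⁆ → y ≢ v
      ∉⇒≢ y∉ refl = ∈∉-elim {B = ⁅ v ⁆} {v} (x∈⁅x⁆ {v}) y∉

      outside : ∀ y → ∃ λ z → z ∈ U × z ≢ v × z ≢ y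
      outside y with w Fin.≟ y
      ... | yes refl = w′ , w′∈ , w′≢v , λ w′≡ → w≢w′ (sym w′≡)
      ... | no w≢y   = w , w∈ , w≢v , w≢y

      -- The complement of `v` has at least two vertices and so allows `p` edges in each direction.
      -- With the `m` edges of `v` this makes `m + p` both ways, and `cut` yields `m + p ≤ d + h`.
      enough-edges : ∀ {m} → Rep S ⁅ v ⁆ m m → m < d ⁅ v ⁆ (E S)
      enough-edges {m} r with nt (∁ U ⁅ v ⁆) (∁-⊑ {U = U} {⁅ v ⁆}) (∁-∈ {U = U} {⁅ v ⁆} w∈ (∉⁅⁆ w≢v))
        (∁-∈ {U = U} {⁅ v ⁆} w′∈ (∉⁅⁆ w′≢v)) w≢w′ v∈U (∁-∉ {U = U} {⁅ v ⁆} {v} v∈U (x∈⁅x⁆ {v}))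
      ... | c , c′ , q , q′ , r′ = +-cancelʳ-≤ h (suc m) (d ⁅ v ⁆ (E S))
        (≤-trans (≤-reflexive (sym (+-suc m h)))
          (cut val (⁅⁆-⊑ {U} {v} v∈U) r r′ (+-monoʳ-≤ m q) (+-monoʳ-≤ m q′)))

    -- An edge at z is lifted together with a free edge as long as `v` has one. Otherwise two free
    -- edges are lifted, to distinct neighbours if possible, because then every set containing both
    -- neighbours is nontrivial. If there is only one neighbour, `strong-neighbour` provides the
    -- slack.
    exceptional-step : Sol U S
    exceptional-step with exceptional val v∈U v∈X
    ... | m , r with enough-edges r | pick-crossing ⁅ v ⁆ (E S)
    ...   | lt | inj₂ none with () ← subst (m <_) none lt
    ...   | lt | inj₁ (x , y , E′ , x∈ , y∉ , pk) with refl ← ∈⁅⁆⇒≡ {v} {x} x∈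
      with m | r | pick-token ⁅ v ⁆ (a S) | pick-token ⁅ v ⁆ (b S)
    ... | zero | eq , _ | _ | _ with () ← subst (0 <_) (m+n≡0⇒m≡0 _ eq) lt
    ... | suc m | r | inj₁ (x , a′ , x∈ , pa) | _ with refl ← ∈⁅⁆⇒≡ {v} {x} x∈ =
      sol-delete {U} {S} pk (rec (lift-in S v y E′ a′) (shorter pk)
        (lift-in-valid val nt v∈U v∈X r (∉⇒≢ y∉) pk pa))
    ... | suc m | r | inj₂ _ | inj₁ (x , b′ , x∈ , pb) with refl ← ∈⁅⁆⇒≡ {v} {x} x∈ =
      sol-delete {U} {S} (pick-sym pk) (rec (lift-out S v y E′ b′) (shorter pk)
        (lift-out-valid val nt v∈U v∈X r (∉⇒≢ y∉) pk pb))
    ... | suc m | r | inj₂ a≡0 | inj₂ b≡0 = second-edge (pick-edge (λ x y′ → ⁅ v ⁆ x ∧ (not (⁅ v ⁆ y′) ∧ not (⁅ y ⁆ y′))) E′)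
      where
      y≢v = ∉⇒≢ y∉
      distinct : ∀ x y′ → (⁅ v ⁆ x ∧ (not (⁅ v ⁆ y′) ∧ not (⁅ y ⁆ y′))) ≡ true → x ≡ v × y′ ≢ v × y′ ≢ y
      distinct x y′ eq with x Fin.≟ v | y′ Fin.≟ v | y′ Fin.≟ y
      ... | yes x≡v | no y′≢v | no y′≢y = x≡v , y′≢v , y′≢y

      finish : ∀ {y′ E″} → y′ ≢ v → PickEdge E′ v y′ E″ →
        (∀ B → B ⊑ U → ∀ {z} → y ∈ B → y′ ∈ B → z ∈ U → z ∉ B → Strong S B) → Sol U S
      finish {y′} {E″} y′≢v pk′ both = sol-lift {U} {S} pk pk′ (rec (lift S v y y′ E″)
        (≤-reflexive (sym (trans (pick-length pk) (cong suc (pick-length pk′)))))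
        (lift-valid val nt v∈U v∈X r y≢v y′≢v pk pk′ both))

      disjoint : ∀ u → (⁅ v ⁆ u ∧ ⁅ y ⁆ u) ≡ false
      disjoint u with u Fin.≟ v | u Fin.≟ y
      ... | no _     | _        = refl
      ... | yes _    | no _     = refl
      ... | yes refl | yes refl = ⊥-elim (y≢v refl)

      -- If v is adjacent to y only, then a vertex set containing y but not v
      -- gains slack from the one containing both.
      strong-neighbour : Hanging ⁅ v ⁆ ⁅ y ⁆ E′ → Strong S ⁅ y ⁆
      strong-neighbour hs =
        let z , z∈ , z≢v , z≢y = outside y
            c , c′ , q , q′ , r′ = nt (⁅ v ⁆ ∪ ⁅ y ⁆) sub
              (cong (_∨ ⁅ y ⁆ v) (x∈⁅x⁆ {v})) (trans (cong (⁅ v ⁆ y ∨_) (x∈⁅x⁆ {y})) (Bool.∨-zeroʳ _))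
              (λ v≡y → y≢v (sym v≡y)) z∈ (cong₂ _∨_ (∉⁅⁆ z≢v) (∉⁅⁆ z≢y))
            d≡ , e≡ = hanging-counts ⁅ v ⁆ ⁅ y ⁆ disjoint (E S) (restore pk hs)
        in _ , _ , ≤-trans q (m≤m+n c _) , ≤-trans q′ (m≤m+n c′ _) ,
           hanging-rep ⁅ v ⁆ ⁅ y ⁆ disjoint {S} d≡ e≡ a≡0 b≡0 r r′
        where
        sub : (⁅ v ⁆ ∪ ⁅ y ⁆) ⊑ U
        sub {u} u∈ with u Fin.≟ v | u Fin.≟ y
        ... | yes refl | _        = v∈U
        ... | no _     | yes refl = proj₂ (proj₁ (pick-within pk (within val)))
        here₁ : (⁅ v ⁆ v ∧ (not (⁅ v ⁆ y) ∧ not (⁅ y ⁆ y))) ≡ false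
        here₁ rewrite x∈⁅x⁆ {y} | Bool.∧-zeroʳ (not (⁅ v ⁆ y)) = Bool.∧-zeroʳ _
        here₂ : (⁅ v ⁆ y ∧ (not (⁅ v ⁆ v) ∧ not (⁅ y ⁆ v))) ≡ false
        here₂ rewrite ∉⁅⁆ y≢v = refl
        restore : ∀ {E E′} → PickEdge E v y E′ → Hanging ⁅ v ⁆ ⁅ y ⁆ E′ → Hanging ⁅ v ⁆ ⁅ y ⁆ E
        restore here       hs       = (here₁ , here₂) ∷ hs
        restore here′      hs       = (here₂ , here₁) ∷ hs
        restore (there pk) (q ∷ hs) = q ∷ restore pk hs

      second-edge : (∃ λ x → ∃₂ λ y′ E″ → (⁅ v ⁆ x ∧ (not (⁅ v ⁆ y′) ∧ not (⁅ y ⁆ y′))) ≡ true × PickEdge E′ x y′ E″) ⊎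
        Hanging ⁅ v ⁆ ⁅ y ⁆ E′ → Sol U S
      second-edge (inj₁ (x , y′ , E″ , eq , pk′)) with distinct x y′ eq
      ... | refl , y′≢v , y′≢y = finish y′≢v pk′
        λ B sub y∈ y′∈ z∈ z∉ → nt B sub y′∈ y∈ y′≢y z∈ z∉
      second-edge (inj₂ hs) with pick-crossing ⁅ v ⁆ E′
      ... | inj₁ (x , y′ , E″ , x∈ , y′∉ , pk′) with refl ← ∈⁅⁆⇒≡ {v} {x} x∈ = finish (∉⇒≢ y′∉) pk′
        λ B sub y∈ y′∈ z∈ z∉ → promote {U} {S} nt {x = y} ≤-refl ≤-refl (strong-neighbour hs) B sub y∈ z∈ z∉
      -- More than `suc m` free edges meet `v`, so a second one is left after the first is removed.
      ... | inj₂ none with s≤s () ← ≤-trans lt (≤-reflexive (trans (pick-d ⁅ v ⁆ pk)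
        (trans (cong₂ _+_ (cong₂ (λ t t′ → ι (t xor t′)) (x∈⁅x⁆ {v}) (∉⁅⁆ y≢v)) none) refl)))

  -- Steps without an exceptional vertex: deleting, dropping and flipping

  balanced-≤ : ∀ {α γ α′ γ′} → α′ ≤ α → γ′ ≤ γ → Balanced α γ → Balanced α′ γ′
  balanced-≤ α≤ γ≤ (q , q′ , low) = ≤-trans α≤ q , ≤-trans γ≤ q′ ,
    [ (λ r → inj₁ (≤-trans α≤ r)) , (λ r → inj₂ (≤-trans γ≤ r)) ] low

  -- With no edges at z, whatever leaves one side of the cut enters the other, so the parts change
  -- places.
  complement-rep : ∀ {U X S B} → Valid U X S → B ⊑ U → # U (a S) ≡ 0 → # U (b S) ≡ 0 →
    ∀ {c c′} → Rep S (∁ U B) c c′ → Rep S B c′ c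
  complement-rep {U} {X} {S} {B} val sub a≡0 b≡0 {c} {c′} (eq , con)
    rewrite m+n≡0⇒m≡0 (# B (a S)) (trans (sym (#-∁ sub (a S))) a≡0)
    | m+n≡0⇒n≡0 (# B (a S)) (trans (sym (#-∁ sub (a S))) a≡0)
    | m+n≡0⇒m≡0 (# B (b S)) (trans (sym (#-∁ sub (b S))) b≡0)
    | m+n≡0⇒n≡0 (# B (b S)) (trans (sym (#-∁ sub (b S))) b≡0)
    | d-∁ {U = U} {B} (E S) (within val) | +-identityʳ (d B (E S))
    | +-identityʳ (# (∁ U B) (o S)) | +-identityʳ (# B (o S)) =
    trans eq (+-comm c c′) , +-cancelʳ-≈ (# A (o S)) (begin
      # B (o S) + # A (o S)    ≡⟨ #-∁ sub (o S) ⟨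
      # U (o S)                ≈⟨ total val ⟩
      # U (s S) + length (E S) ≡⟨ cong₂ _+_ (#-∁ sub (s S)) (length-split (E S) (within val)) ⟩
      # B (s S) + # A (s S) + (e B (E S) + e A (E S) + d B (E S))
        ≡⟨ cong (λ t → # B (s S) + # A (s S) + (e B (E S) + e A (E S) + t)) eq ⟩
      # B (s S) + # A (s S) + (e B (E S) + e A (E S) + (c + c′))
        ≡⟨ arrange (# B (s S)) (# A (s S)) (e B (E S)) (e A (E S)) c c′ ⟩
      # B (s S) + e B (E S) + c′ + (# A (s S) + e A (E S) + c)
        ≈⟨ +-cong-≈ (≈-refl {# B (s S) + e B (E S) + c′}) con ⟨
      # B (s S) + e B (E S) + c′ + # A (o S) ∎)
    where
    open ≈-Reasoning
    A = ∁ U B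
    arrange : ∀ s s₁ e e₁ c c′ → s + s₁ + (e + e₁ + (c + c′)) ≡ s + e + c′ + (s₁ + e₁ + c)
    arrange = solve-∀

  module _ {U X : VSet} {S : State} (val : Valid U X S) (nt : Nontrivial U S)
    (ordinary : ∀ {u} → u ∈ U → u ∉ X) where

    private
      no-exception : ∀ S′ {u} → u ∈ U → u ∈ X → ∃ λ m → Rep S′ ⁅ u ⁆ m m
      no-exception _ u∈ u∈X = ∈∉-elim {B = X} u∈X (ordinary u∈)

    -- Only sets separating `x` from `y` lose an edge, and in one direction only; `promote` carries
    -- the slack of the two ends to them.
    delete-valid : ∀ {x y E′} → PickEdge (E S) x y E′ → Out S ⁅ x ⁆ → In S ⁅ y ⁆ → Valid U X (delete S x E′)
    delete-valid {x} {y} {E′} pk out in′ = record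
      { within      = proj₂ (pick-within pk (within val))
      ; total       = total-delete val pk
      ; balanced    = balanced val
      ; good        = good′
      ; exceptional = no-exception S′
      ; unique      = unique val
      }
      where
      S′ = delete S x E′
      good′ : ∀ B → B ⊑ U → ∀ {u z} → u ∈ B → u ∉ X → z ∈ U → z ∉ B → Good S′ B
      good′ B sub u∈ u∉ z∈ z∉ with ∈⊎∉ B x | ∈⊎∉ B y
      ... | inj₁ x∈ | inj₁ y∈ = same {S} {S′} (delete-∈∈ {S} pk B x∈ y∈) (good val B sub u∈ u∉ z∈ z∉)
      ... | inj₁ x∈ | inj₂ y∉ = fewer-out {S} {S′} (delete-∈∉ {S} pk B x∈ y∉)
        (promote {U} {S} nt {x = x} ≤-refl h≤p out B sub x∈ z∈ z∉)
      ... | inj₂ x∉ | inj₁ y∈ = fewer-in {S} {S′} (delete-∉∈ {S} pk B x∉ y∈)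
        (promote {U} {S} nt {x = y} h≤p ≤-refl in′ B sub y∈ z∈ z∉)
      ... | inj₂ x∉ | inj₂ y∉ = same {S} {S′} (delete-∉∉ {S} pk B x∉ y∉) (good val B sub u∈ u∉ z∈ z∉)

    -- The problem to be solved stays the same. The sets through `x` pay one entering edge, and
    -- fewer edges at z cannot spoil its balance.
    drop-in-valid : ∀ {x a′} → Pick (a S) x a′ → In S ⁅ x ⁆ → Valid U X (drop-in-state S a′)
    drop-in-valid {x} {a′} pa in′ = record
      { within      = within val
      ; total       = total val
      ; balanced    = balanced-≤ (≤-trans (m≤n+m (# U a′) (ι (U x))) (≤-reflexive (sym (pick-# U pa)))) ≤-refl (balanced val)
      ; good        = good′
      ; exceptional = no-exception S′
      ; unique      = unique val
      }
      where
      S′ = drop-in-state S a′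
      good′ : ∀ B → B ⊑ U → ∀ {u z} → u ∈ B → u ∉ X → z ∈ U → z ∉ B → Good S′ B
      good′ B sub u∈ u∉ z∈ z∉ with ∈⊎∉ B x
      ... | inj₁ x∈ = fewer-in {S} {S′} (drop-in-∈ {S} pa B x∈)
        (promote {U} {S} nt {x = x} h≤p ≤-refl in′ B sub x∈ z∈ z∉)
      ... | inj₂ x∉ = same {S} {S′} (drop-in-∉ {S} pa B x∉) (good val B sub u∈ u∉ z∈ z∉)

    drop-out-valid : ∀ {x b′} → Pick (b S) x b′ → Out S ⁅ x ⁆ → Valid U X (drop-out-state S b′)
    drop-out-valid {x} {b′} pb out = record
      { within      = within val
      ; total       = total val
      ; balanced    = balanced-≤ ≤-refl (≤-trans (m≤n+m (# U b′) (ι (U x))) (≤-reflexive (sym (pick-# U pb)))) (balanced val)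
      ; good        = good′
      ; exceptional = no-exception S′
      ; unique      = unique val
      }
      where
      S′ = drop-out-state S b′
      good′ : ∀ B → B ⊑ U → ∀ {u z} → u ∈ B → u ∉ X → z ∈ U → z ∉ B → Good S′ B
      good′ B sub u∈ u∉ z∈ z∉ with ∈⊎∉ B x
      ... | inj₁ x∈ = fewer-out {S} {S′} (drop-out-∈ {S} pb B x∈)
        (promote {U} {S} nt {x = x} ≤-refl h≤p out B sub x∈ z∈ z∉)
      ... | inj₂ x∉ = same {S} {S′} (drop-out-∉ {S} pb B x∉) (good val B sub u∈ u∉ z∈ z∉)

    -- No edge entered z before, so exactly the `h` new ones do now, and z stays balanced. Sets
    -- through `x` pay one leaving edge for `h` entering ones, which cover the deleted edge from `y`
    -- to `x`; the other sets through `y` pay that edge as a leaving one.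
    flip-in-valid : ∀ {x y E′ a′} → PickEdge (E S) x y E′ → Pick (a S) x a′ → # U (b S) ≡ 0 →
      Out S ⁅ x ⁆ → Out S ⁅ y ⁆ → Valid U X (flip-in S x y E′ a′)
    flip-in-valid {x} {y} {E′} {a′} pk pa b≡0 out out′ = record
      { within      = proj₂ ends
      ; total       = total-delete val (pick-sym pk)
      ; balanced    =
          ≤-trans (≤-trans (m≤n+m (# U a′) (ι (U x))) (≤-reflexive (sym (pick-# U pa)))) (proj₁ (balanced val)) ,
          ≤-trans (≤-reflexive outs) (m≤n+m h p) , inj₂ (≤-reflexive outs)
      ; good        = good′
      ; exceptional = no-exception S′
      ; unique      = unique val
      }
      where
      S′ = flip-in S x y E′ a′
      ends = pick-within pk (within val)
      outs : # U (replicate h x ++ b S) ≡ h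
      outs = trans (#-++ U (replicate h x) (b S))
        (trans (cong₂ _+_ (#-replicate-∈ U h (proj₁ (proj₁ ends))) b≡0) (+-identityʳ h))
      good′ : ∀ B → B ⊑ U → ∀ {u z} → u ∈ B → u ∉ X → z ∈ U → z ∉ B → Good S′ B
      good′ B sub u∈ u∉ z∈ z∉ with ∈⊎∉ B x | ∈⊎∉ B y
      ... | inj₁ x∈ | inj₁ y∈ = flip-in-good {S} {S′} h (flip-in-∈∈ {S} pk pa B x∈ y∈)
        (promote {U} {S} nt {x = x} ≤-refl h≤p out B sub x∈ z∈ z∉)
      ... | inj₁ x∈ | inj₂ y∉ = flip-in-good {S} {S′} h′ (flip-in-∈∉ {S} pk pa B x∈ y∉)
        (promote {U} {S} nt {x = x} ≤-refl h≤p out B sub x∈ z∈ z∉)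
      ... | inj₂ x∉ | inj₁ y∈ = fewer-out {S} {S′} (flip-in-∉∈ {S} pk pa B x∉ y∈)
        (promote {U} {S} nt {x = y} ≤-refl h≤p out′ B sub y∈ z∈ z∉)
      ... | inj₂ x∉ | inj₂ y∉ = same {S} {S′} (flip-in-∉∉ {S} pk pa B x∉ y∉) (good val B sub u∈ u∉ z∈ z∉)

    flip-out-valid : ∀ {x y E′ b′} → PickEdge (E S) x y E′ → Pick (b S) x b′ → # U (a S) ≡ 0 →
      In S ⁅ x ⁆ → In S ⁅ y ⁆ → Valid U X (flip-out S x y E′ b′)
    flip-out-valid {x} {y} {E′} {b′} pk pb a≡0 in′ in″ = record
      { within      = proj₂ ends
      ; total       = total-delete val pk
      ; balanced    =
          ≤-trans (≤-reflexive ins) (m≤n+m h p) ,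
          ≤-trans (≤-trans (m≤n+m (# U b′) (ι (U x))) (≤-reflexive (sym (pick-# U pb)))) (proj₁ (proj₂ (balanced val))) ,
          inj₁ (≤-reflexive ins)
      ; good        = good′
      ; exceptional = no-exception S′
      ; unique      = unique val
      }
      where
      S′ = flip-out S x y E′ b′
      ends = pick-within pk (within val)
      ins : # U (replicate h x ++ a S) ≡ h
      ins = trans (#-++ U (replicate h x) (a S))
        (trans (cong₂ _+_ (#-replicate-∈ U h (proj₁ (proj₁ ends))) a≡0) (+-identityʳ h))
      good′ : ∀ B → B ⊑ U → ∀ {u z} → u ∈ B → u ∉ X → z ∈ U → z ∉ B → Good S′ B
      good′ B sub u∈ u∉ z∈ z∉ with ∈⊎∉ B x | ∈⊎∉ B y
      ... | inj₁ x∈ | inj₁ y∈ = flip-out-good {S} {S′} h (flip-out-∈∈ {S} pk pb B x∈ y∈)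
        (promote {U} {S} nt {x = x} h≤p ≤-refl in′ B sub x∈ z∈ z∉)
      ... | inj₁ x∈ | inj₂ y∉ = flip-out-good {S} {S′} h′ (flip-out-∈∉ {S} pk pb B x∈ y∉)
        (promote {U} {S} nt {x = x} h≤p ≤-refl in′ B sub x∈ z∈ z∉)
      ... | inj₂ x∉ | inj₁ y∈ = fewer-in {S} {S′} (flip-out-∉∈ {S} pk pb B x∉ y∈)
        (promote {U} {S} nt {x = y} h≤p ≤-refl in″ B sub y∈ z∈ z∉)
      ... | inj₂ x∉ | inj₂ y∉ = same {S} {S′} (flip-out-∉∉ {S} pk pb B x∉ y∉) (good val B sub u∈ u∉ z∈ z∉)

    module _
      (others : ∀ v → ∃₂ λ w w′ → w ∈ U × w′ ∈ U × w ≢ v × w′ ≢ v × w ≢ w′)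
      (rec : ∀ X′ S′ → length (E S′) < length (E S) → Valid U X′ S′ → Sol U S′)
      (rec-z : ∀ a′ b′ → # U a′ + # U b′ < # U (a S) + # U (b S) →
        Valid U X (state (E S) (o S) (s S) a′ b′) → Sol U S) where

      private
        shorter : ∀ {x y E′} → PickEdge (E S) x y E′ → length E′ < length (E S)
        shorter pk = ≤-reflexive (sym (pick-length pk))

        -- Both sides allow `h` edges in each direction, so `cut` with the bound `h + h` leaves at
        -- least `h` free edges between them, and `h` is positive.
        crossing : ∀ B → B ⊑ U → ∀ {u z} → u ∈ B → z ∈ U → z ∉ B →
          ∃ λ x → ∃₂ λ y E′ → x ∈ B × y ∉ B × PickEdge (E S) x y E′
        crossing B sub {u} {z} u∈ z∈ z∉ with pick-crossing B (E S)
        ... | inj₁ found = found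
        ... | inj₂ none =
          let c , c′ , q , q′ , r = good val B sub u∈ (ordinary (sub u∈)) z∈ z∉
              c₁ , c₁′ , q₁ , q₁′ , r₁ = good val (∁ U B) (∁-⊑ {U = U} {B}) (∁-∈ {U = U} {B} z∈ z∉) (ordinary z∈)
                (sub u∈) (∁-∉ {U = U} {B} {u} (sub u∈) u∈)
          in ⊥-elim (<-irrefl refl (≤-trans (s≤s z≤n) (subst (h ≤_) none
               (+-cancelʳ-≤ h h (d B (E S)) (cut val sub r r₁ (+-mono-≤ q q₁) (+-mono-≤ q′ q₁′))))))

        neighbour : ∀ {x} → x ∈ U → ∃₂ λ y E′ → y ∈ U × PickEdge (E S) x y E′
        neighbour {x} x∈ with others x
        ... | w , _ , w∈ , _ , w≢x , _ with crossing ⁅ x ⁆ (⁅⁆-⊑ {U} {x} x∈) {x} (x∈⁅x⁆ {x}) w∈ (∉⁅⁆ w≢x)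
        ... | x′ , y , E′ , x′∈ , _ , pk with refl ← ∈⁅⁆⇒≡ {x} {x′} x′∈ =
          y , E′ , proj₂ (proj₁ (pick-within pk (within val))) , pk

        -- The complement of `y` has two vertices, hence slack, and `complement-rep` returns it to
        -- `y`.
        strong : # U (a S) ≡ 0 → # U (b S) ≡ 0 → ∀ {y} → y ∈ U → Strong S ⁅ y ⁆
        strong a≡0 b≡0 {y} y∈ with others y
        ... | w , w′ , w∈ , w′∈ , w≢y , w′≢y , w≢w′
          with nt (∁ U ⁅ y ⁆) (∁-⊑ {U = U} {⁅ y ⁆}) (∁-∈ {U = U} {⁅ y ⁆} w∈ (∉⁅⁆ w≢y))
            (∁-∈ {U = U} {⁅ y ⁆} w′∈ (∉⁅⁆ w′≢y)) w≢w′ y∈ (∁-∉ {U = U} {⁅ y ⁆} {y} y∈ (x∈⁅x⁆ {y}))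
        ... | c , c′ , q , q′ , r = c′ , c , q′ , q , complement-rep val (⁅⁆-⊑ {U} {y} y∈) a≡0 b≡0 r

      all-out : ∀ {v} → v ∈ U → (∀ u → u ∈ U → Out S ⁅ u ⁆) → Sol U S
      all-out {v} v∈ out with pick-token U (b S) | pick-token U (a S)
      ... | inj₁ (x , b′ , x∈ , pb) | _ = rec-z (a S) b′
        (+-monoʳ-< (# U (a S)) (≤-reflexive (sym (trans (pick-# U pb) (cong (λ t → ι t + # U b′) x∈)))))
        (drop-out-valid pb (out x x∈))
      ... | inj₂ b≡0 | inj₁ (x , a′ , x∈ , pa) =
        let y , E′ , y∈ , pk = neighbour x∈ in
        sol-delete {U} {S} (pick-sym pk) (rec X (flip-in S x y E′ a′) (shorter pk)
          (flip-in-valid pk pa b≡0 (out x x∈) (out y y∈)))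
      ... | inj₂ b≡0 | inj₂ a≡0 =
        let y , E′ , y∈ , pk = neighbour v∈ in
        sol-delete {U} {S} pk (rec X (delete S v E′) (shorter pk)
          (delete-valid pk (out v v∈) (weaken {S = S} {⁅ y ⁆} h≤p ≤-refl (strong a≡0 b≡0 y∈))))

      all-in : ∀ {v} → v ∈ U → (∀ u → u ∈ U → In S ⁅ u ⁆) → Sol U S
      all-in {v} v∈ in′ with pick-token U (a S) | pick-token U (b S)
      ... | inj₁ (x , a′ , x∈ , pa) | _ = rec-z a′ (b S)
        (+-monoˡ-< (# U (b S)) (≤-reflexive (sym (trans (pick-# U pa) (cong (λ t → ι t + # U a′) x∈)))))
        (drop-in-valid pa (in′ x x∈))
      ... | inj₂ a≡0 | inj₁ (x , b′ , x∈ , pb) =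
        let y , E′ , y∈ , pk = neighbour x∈ in
        sol-delete {U} {S} pk (rec X (flip-out S x y E′ b′) (shorter pk)
          (flip-out-valid pk pb a≡0 (in′ x x∈) (in′ y y∈)))
      ... | inj₂ a≡0 | inj₂ b≡0 =
        let y , E′ , y∈ , pk = neighbour v∈ in
        sol-delete {U} {S} (pick-sym pk) (rec X (delete S y E′) (shorter pk)
          (delete-valid (pick-sym pk) (weaken {S = S} {⁅ y ⁆} ≤-refl h≤p (strong a≡0 b≡0 y∈)) (in′ v v∈)))

      exceptional-vertex : ∀ {v} → v ∈ U → Rep S ⁅ v ⁆ h h → Sol U S
      exceptional-vertex {v} v∈ r with others v
      ... | w , w′ , w∈ , w′∈ , w≢v , w′≢v , w≢w′ =
        exceptional-step val′ nt v∈ (x∈⁅x⁆ {v}) w∈ w′∈ w≢v w′≢v w≢w′ (rec ⁅ v ⁆)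
        where
        val′ : Valid U ⁅ v ⁆ S
        val′ = record
          { within      = within val
          ; total       = total val
          ; balanced    = balanced val
          ; good        = λ B sub u∈ _ → good val B sub u∈ (ordinary (sub u∈))
          ; exceptional = λ {u} _ u∈ → h , subst (λ u → Rep S ⁅ u ⁆ h h) (sym (∈⁅⁆⇒≡ {v} {u} u∈)) r
          ; unique      = λ {u} {u′} _ _ u∈ u′∈ → trans (∈⁅⁆⇒≡ {v} {u} u∈) (sym (∈⁅⁆⇒≡ {v} {u′} u′∈))
          }

      ordinary-step : ∀ {v} → v ∈ U → Sol U S
      ordinary-step {v₀} v₀∈ with search classify
        where
        classify : ∀ v → (v ∈ U × Rep S ⁅ v ⁆ h h) ⊎ (v ∉ U ⊎ (v ∈ U × Out S ⁅ v ⁆) ⊎ (v ∈ U × In S ⁅ v ⁆))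
        classify v with ∈⊎∉ U v
        ... | inj₂ v∉ = inj₂ (inj₁ v∉)
        ... | inj₁ v∈ with others v
        ... | w , _ , w∈ , _ , w≢v , _
          with good val ⁅ v ⁆ (⁅⁆-⊑ {U} {v} v∈) (x∈⁅x⁆ {v}) (ordinary v∈) w∈ (∉⁅⁆ w≢v)
        ... | c , c′ , q , q′ , r with m≤n⇒m<n∨m≡n q | m≤n⇒m<n∨m≡n q′
        ...   | inj₁ lt   | _         = inj₂ (inj₂ (inj₁ (v∈ , c , c′ , lt , q′ , r)))
        ...   | inj₂ _    | inj₁ lt   = inj₂ (inj₂ (inj₂ (v∈ , c , c′ , q , lt , r)))
        ...   | inj₂ refl | inj₂ refl = inj₁ (v∈ , r)
      ... | inj₁ (v , v∈ , r) = exceptional-vertex v∈ r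
      ... | inj₂ label = mixed (search some-in) (search some-out)
        where
        -- The vertices labelled with slack for leaving edges. The remaining vertices of `U` are
        -- labelled with slack for entering ones, so every edge leaving `B` is deletable.
        B : VSet
        B v with label v
        ... | inj₂ (inj₁ _) = true
        ... | _             = false
        B-out : ∀ {v} → v ∈ B → v ∈ U × Out S ⁅ v ⁆
        B-out {v} v∈ with inj₂ (inj₁ q) ← label v = q
        B-in : ∀ {v} → v ∈ U → v ∉ B → In S ⁅ v ⁆
        B-in {v} v∈ v∉ with label v
        ... | inj₁ v∉U           = ∈∉-elim {B = U} v∈ v∉U
        ... | inj₂ (inj₂ (_ , q)) = q
        some-in : ∀ v → (v ∈ U × v ∉ B) ⊎ (v ∈ U → Out S ⁅ v ⁆)
        some-in v with label v
        ... | inj₁ v∉U            = inj₂ λ v∈ → ∈∉-elim {B = U} v∈ v∉U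
        ... | inj₂ (inj₁ (_ , q)) = inj₂ λ _ → q
        ... | inj₂ (inj₂ (v∈ , _)) = inj₁ (v∈ , refl)
        some-out : ∀ v → v ∈ B ⊎ (v ∈ U → In S ⁅ v ⁆)
        some-out v with label v
        ... | inj₁ v∉U            = inj₂ λ v∈ → ∈∉-elim {B = U} v∈ v∉U
        ... | inj₂ (inj₁ _)       = inj₁ refl
        ... | inj₂ (inj₂ (_ , q)) = inj₂ λ _ → q
        mixed : (∃ λ v → v ∈ U × v ∉ B) ⊎ (∀ v → v ∈ U → Out S ⁅ v ⁆) →
          (∃ λ v → v ∈ B) ⊎ (∀ v → v ∈ U → In S ⁅ v ⁆) → Sol U S
        mixed (inj₂ out) _ = all-out v₀∈ out
        mixed _ (inj₂ in′) = all-in v₀∈ in′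
        mixed (inj₁ (z , z∈ , z∉)) (inj₁ (u , u∈)) =
          let x , y , E′ , x∈ , y∉ , pk = crossing B (λ {v} v∈ → proj₁ (B-out {v} v∈)) u∈ z∈ z∉ in
          sol-delete {U} {S} pk (rec X (delete S x E′) (shorter pk)
            (delete-valid pk (proj₂ (B-out {x} x∈)) (B-in (proj₂ (proj₁ (pick-within pk (within val)))) y∉)))

  -- Contracting a set without slack

  size-< : ∀ {U U′ : VSet} {v} → U′ ⊑ U → v ∈ U → v ∉ U′ → size U′ < size U
  size-< {v = v} sub v∈ v∉ = #-mono-< sub (∈-allFin v) v∈ v∉

  mapEdge : (V → V) → Ends {V} → Ends {V}
  mapEdge f (x , y) = f x , f y

  d-map : ∀ B f E → d B (map (mapEdge f) E) ≡ d (B ∘ f) E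
  d-map B f []            = refl
  d-map B f ((x , y) ∷ E) = cong (ι (B (f x) xor B (f y)) +_) (d-map B f E)

  e-map : ∀ B f E → e B (map (mapEdge f) E) ≡ e (B ∘ f) E
  e-map B f []            = refl
  e-map B f ((x , y) ∷ E) = cong (ι (B (f x) ∧ B (f y)) +_) (e-map B f E)

  src-map : ∀ f D → src (map (mapEdge f) D) ≡ map f (src D)
  src-map f []      = refl
  src-map f (_ ∷ D) = cong (_ ∷_) (src-map f D)

  orient-map⁻ : ∀ f E {D′} → Orient (map (mapEdge f) E) D′ → ∃ λ D → Orient E D × D′ ≡ map (mapEdge f) D
  orient-map⁻ f [] [] = [] , [] , refl
  orient-map⁻ f (_ ∷ E) (keep or) = let D , or′ , eq = orient-map⁻ f E or in _ , keep or′ , cong (_ ∷_) eq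
  orient-map⁻ f (_ ∷ E) (turn or) = let D , or′ , eq = orient-map⁻ f E or in _ , turn or′ , cong (_ ∷_) eq

  mapState : (V → V) → State → State
  mapState f S = state (map (mapEdge f) (E S)) (map f (o S)) (map f (s S)) (map f (a S)) (map f (b S))

  rep-map : ∀ {S} f B {c c′} → Rep S (B ∘ f) c c′ → Rep (mapState f S) B c c′
  rep-map {S} f B r rewrite d-map B f (E S) | e-map B f (E S) | #-map B f (o S) | #-map B f (s S) |
    #-map B f (a S) | #-map B f (b S) = r

  inner outer : VSet → List Ends → List Ends
  inner A [] = []
  inner A ((x , y) ∷ E) = if A x ∧ A y then (x , y) ∷ inner A E else inner A E
  outer A [] = []
  outer A ((x , y) ∷ E) = if A x ∧ A y then outer A E else (x , y) ∷ outer A E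

  module _ (A : VSet) where

    inner-within : ∀ E → Within A (inner A E)
    inner-within [] = []
    inner-within ((x , y) ∷ E) with A x in x∈ | A y in y∈
    ... | true  | true  = (x∈ , y∈) ∷ inner-within E
    ... | true  | false = inner-within E
    ... | false | _     = inner-within E

    inner-length : ∀ E → length (inner A E) ≡ e A E
    inner-length [] = refl
    inner-length ((x , y) ∷ E) with A x | A y
    ... | true  | true  = cong suc (inner-length E)
    ... | true  | false = inner-length E
    ... | false | _     = inner-length E

    inner-d : ∀ E → d A (inner A E) ≡ 0
    inner-d [] = refl
    inner-d ((x , y) ∷ E) with A x in x∈ | A y in y∈
    ... | true  | true  rewrite x∈ | y∈ = inner-d E
    ... | true  | false = inner-d E
    ... | false | _     = inner-d E

    inner-e : ∀ {B} → B ⊑ A → ∀ E → e B (inner A E) ≡ e B E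
    inner-e sub [] = refl
    inner-e {B} sub ((x , y) ∷ E) with A x in x∈ | A y in y∈
    ... | true  | true  = cong (ι (B x ∧ B y) +_) (inner-e sub E)
    ... | true  | false rewrite ∉-⊑ {B = B} {A} {y} sub y∈ | Bool.∧-zeroʳ (B x) = inner-e sub E
    ... | false | _     rewrite ∉-⊑ {B = B} {A} {x} sub x∈ = inner-e sub E

    outer-orient : ∀ {E D} → Orient E D → Orient (outer A E) (outer A D)
    outer-orient [] = []
    outer-orient (keep {x} {y} or) with A x ∧ A y
    ... | true  = outer-orient or
    ... | false = keep (outer-orient or)
    outer-orient (turn {x} {y} or) rewrite ∧-comm (A y) (A x) with A x ∧ A y
    ... | true  = outer-orient or
    ... | false = turn (outer-orient or)

    d-split : ∀ B E → d B E ≡ d B (inner A E) + d B (outer A E)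
    d-split B [] = refl
    d-split B ((x , y) ∷ E) with A x ∧ A y
    ... | true  = trans (cong (ι (B x xor B y) +_) (d-split B E)) (sym (+-assoc (ι (B x xor B y)) _ _))
    ... | false = trans (cong (ι (B x xor B y) +_) (d-split B E))
      (arrange (ι (B x xor B y)) (d B (inner A E)) (d B (outer A E)))
      where
      arrange : ∀ x y z → x + (y + z) ≡ y + (x + z)
      arrange = solve-∀

    -- An edge in `outer` has at most one end in `A`, so none of them is counted both as source and
    -- as target in `B`.
    d-outer : ∀ {B} → B ⊑ A → ∀ D → d B (outer A D) ≡ # B (src (outer A D)) + # B (tgt (outer A D))
    d-outer sub [] = refl
    d-outer {B} sub ((x , y) ∷ D) with A x in x∈ | A y in y∈
    ... | true  | true  = d-outer sub D
    ... | false | _     rewrite ∉-⊑ {B = B} {A} {x} sub x∈ =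
      trans (cong (ι (B y) +_) (d-outer sub D)) (arrange (ι (B y)) (# B (src (outer A D))) _)
      where
      arrange : ∀ x y z → x + (y + z) ≡ y + (x + z)
      arrange = solve-∀
    ... | true  | false rewrite ∉-⊑ {B = B} {A} {y} sub y∈ | Bool.xor-identityʳ (B x) =
      trans (cong (ι (B x) +_) (d-outer sub D)) (sym (+-assoc (ι (B x)) _ _))

    src-outer : ∀ D → # A (src D) ≡ e A D + # A (src (outer A D))
    src-outer [] = refl
    src-outer ((x , y) ∷ D) with A x in x∈ | A y
    ... | true  | true  = cong suc (src-outer D)
    ... | true  | false rewrite x∈ = trans (cong suc (src-outer D)) (sym (+-suc (e A D) _))
    ... | false | _     rewrite x∈ = src-outer D

    src-outer-disjoint : ∀ {B} → (∀ {u} → u ∈ A → u ∉ B) → ∀ D → # B (src (outer A D)) ≡ # B (src D)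
    src-outer-disjoint dis [] = refl
    src-outer-disjoint {B} dis ((x , y) ∷ D) with A x in x∈ | A y
    ... | true  | true  rewrite dis x∈ = src-outer-disjoint dis D
    ... | true  | false = cong (ι (B x) +_) (src-outer-disjoint dis D)
    ... | false | _     = cong (ι (B x) +_) (src-outer-disjoint dis D)

    within-disjoint : ∀ {B} → (∀ {u} → u ∈ A → u ∉ B) → ∀ {D} → Within A D → # B (src D) ≡ 0
    within-disjoint dis [] = refl
    within-disjoint dis ((x∈ , _) ∷ w) rewrite dis x∈ = within-disjoint dis w

    merge : ∀ E {R D} → Orient (outer A E) R → Orient (inner A E) D →
      ∃ λ D′ → Orient E D′ × (∀ B → # B (src D′) ≡ # B (src R) + # B (src D))
    merge [] [] [] = [] , [] , λ _ → refl
    merge ((x , y) ∷ E) {R} or or′ with A x ∧ A y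
    merge ((x , y) ∷ E) {R} or (keep or′) | true = let D′ , or″ , eq = merge E or or′ in
      _ , keep or″ , λ B → trans (cong (ι (B x) +_) (eq B)) (arrange (ι (B x)) (# B (src R)) _)
      where
      arrange : ∀ x y z → x + (y + z) ≡ y + (x + z)
      arrange = solve-∀
    merge ((x , y) ∷ E) {R} or (turn or′) | true = let D′ , or″ , eq = merge E or or′ in
      _ , turn or″ , λ B → trans (cong (ι (B y) +_) (eq B)) (arrange (ι (B y)) (# B (src R)) _)
      where
      arrange : ∀ x y z → x + (y + z) ≡ y + (x + z)
      arrange = solve-∀
    merge ((x , y) ∷ E) (keep or) or′ | false = let D′ , or″ , eq = merge E or or′ in
      _ , keep or″ , λ B → trans (cong (ι (B x) +_) (eq B)) (sym (+-assoc (ι (B x)) _ _))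
    merge ((x , y) ∷ E) (turn or) or′ | false = let D′ , or″ , eq = merge E or or′ in
      _ , turn or″ , λ B → trans (cong (ι (B y) +_) (eq B)) (sym (+-assoc (ι (B y)) _ _))

  d-orient : ∀ (B : VSet) {E D} → Orient E D → d B D ≡ d B E
  d-orient B []                 = refl
  d-orient B (keep {x} {y} or)  = cong (ι (B x xor B y) +_) (d-orient B or)
  d-orient B (turn {x} {y} or)  = cong₂ (λ t k → ι t + k) (xor-comm (B y) (B x)) (d-orient B or)

  e-orient : ∀ (B : VSet) {E D} → Orient E D → e B D ≡ e B E
  e-orient B []                 = refl
  e-orient B (keep {x} {y} or)  = cong (ι (B x ∧ B y) +_) (e-orient B or)
  e-orient B (turn {x} {y} or)  = cong₂ (λ t k → ι t + k) (∧-comm (B y) (B x)) (e-orient B or)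

  orient-refl : ∀ (E : List (Ends {V})) → Orient E E
  orient-refl []      = []
  orient-refl (_ ∷ E) = keep (orient-refl E)

  src-within : ∀ {U : VSet} {D} → Within U D → # U (src D) ≡ length D
  src-within []             = refl
  src-within {U} ((x∈ , _) ∷ w) rewrite x∈ = cong suc (src-within w)

  module _ {U X : VSet} {S : State} (val : Valid U X S) {A : VSet} (A⊑U : A ⊑ U)
    {x₀ x₁ : V} (x₀∈ : x₀ ∈ A) (x₁∈ : x₁ ∈ A) (x₀≢x₁ : x₀ ≢ x₁) where

    -- Contraction keeps the vertex type: `x₀` stands for all of `A`, and the vertex set shrinks to
    -- the fixed points.
    collapse : V → V
    collapse u = if A u then x₀ else u

    private
      collapse-∈ : ∀ {u} → u ∈ A → collapse u ≡ x₀
      collapse-∈ u∈ rewrite u∈ = refl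

      collapse-∉ : ∀ {u} → u ∉ A → collapse u ≡ u
      collapse-∉ u∉ rewrite u∉ = refl

    -- The contracted vertex always counts as ordinary. This is justified because `A` has two
    -- vertices, at most one of which is exceptional.
    U/A X/A : VSet
    U/A u = U u ∧ does (collapse u Fin.≟ u)
    X/A u = X u ∧ not (A u)

    private
      f = collapse

      U/A-⊑ : U/A ⊑ U
      U/A-⊑ {u} u∈ with true ← U u = refl

      U/A-fixed : ∀ {u} → u ∈ U/A → f u ≡ u
      U/A-fixed {u} u∈ with true ← U u | yes eq ← f u Fin.≟ u = eq

      ∈-U/A : ∀ {u} → u ∈ U → f u ≡ u → u ∈ U/A
      ∈-U/A {u} u∈ eq rewrite u∈ = dec-true (f u Fin.≟ u) eq

      f-∈ : ∀ {u} → u ∈ U → f u ∈ U/A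
      f-∈ {u} u∈ with ∈⊎∉ A u
      ... | inj₁ q rewrite collapse-∈ q = ∈-U/A (A⊑U x₀∈) (collapse-∈ x₀∈)
      ... | inj₂ q rewrite collapse-∉ q = ∈-U/A u∈ (collapse-∉ q)

      f⁻¹-∈ : ∀ {u} → f u ∈ U/A → u ∈ U
      f⁻¹-∈ {u} fu∈ with ∈⊎∉ A u
      ... | inj₁ q = A⊑U q
      ... | inj₂ q = U/A-⊑ (subst (_∈ U/A) (collapse-∉ q) fu∈)

      U/A∘f : (U/A ∘ f) ≗ U
      U/A∘f u with ∈⊎∉ U u
      ... | inj₁ q = trans (f-∈ q) (sym q)
      ... | inj₂ q with ∈⊎∉ U/A (f u)
      ...   | inj₁ r = ∈∉-elim {B = U} (f⁻¹-∈ r) q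
      ...   | inj₂ r = trans r (sym q)

      #-collapse : ∀ l → # U/A (map f l) ≡ # U l
      #-collapse l = trans (#-map U/A f l) (#-cong U/A∘f l)

      x₁∉U/A : x₁ ∉ U/A
      x₁∉U/A with ∈⊎∉ U/A x₁
      ... | inj₁ q = ⊥-elim (x₀≢x₁ (trans (sym (collapse-∈ x₁∈)) (U/A-fixed q)))
      ... | inj₂ q = q

      X/A-∉ : ∀ {u} → u ∉ X/A → u ∉ A → u ∉ X
      X/A-∉ {u} u∉ u∉A rewrite u∉A = trans (sym (Bool.∧-identityʳ (X u))) u∉

      X/A-∈ : ∀ {u} → u ∈ X/A → u ∈ X × u ∉ A
      X/A-∈ {u} u∈ with true ← X u | false ← A u = refl , refl

      ⁅⁆∘f : ∀ {v} → v ∉ A → (⁅ v ⁆ ∘ f) ≗ ⁅ v ⁆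
      ⁅⁆∘f {v} v∉ u with ∈⊎∉ A u
      ... | inj₂ q rewrite collapse-∉ q = refl
      ... | inj₁ q rewrite collapse-∈ q =
        trans (∉⁅⁆ (∈∉⇒≢ {A} x₀∈ v∉)) (sym (∉⁅⁆ (∈∉⇒≢ {A} q v∉)))

      ⁅x₀⁆∘f : (⁅ x₀ ⁆ ∘ f) ≗ A
      ⁅x₀⁆∘f u with ∈⊎∉ A u
      ... | inj₁ q rewrite collapse-∈ q = trans (x∈⁅x⁆ {x₀}) (sym q)
      ... | inj₂ q rewrite collapse-∉ q = trans (∉⁅⁆ (λ u≡ → ∈∉⇒≢ {A} x₀∈ q (sym u≡))) (sym q)

    size-contract : size U/A < size U
    size-contract = size-< {U} {U/A} {x₁} U/A-⊑ (A⊑U x₁∈) x₁∉U/A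

    -- Taking preimages under `f` changes neither boundaries nor demands, so every condition is one
    -- of `S` at the preimage.
    contract-valid : Valid U/A X/A (mapState f S)
    contract-valid = record
      { within      = map⁺ (All.map (λ (q , q′) → f-∈ q , f-∈ q′) (within val))
      ; total       = subst₂ _≈_ (sym (#-collapse (o S)))
          (sym (cong₂ _+_ (#-collapse (s S)) (length-map (mapEdge f) (E S)))) (total val)
      ; balanced    = subst₂ Balanced (sym (#-collapse (a S))) (sym (#-collapse (b S))) (balanced val)
      ; good        = good′
      ; exceptional = λ {v} v∈ v∈X → let q , v∉ = X/A-∈ v∈X
                                         m , r = exceptional val (U/A-⊑ v∈) q in
          m , rep-map {S} f ⁅ v ⁆ (rep-cong {S} (λ u → sym (⁅⁆∘f v∉ u)) r)
      ; unique      = λ u∈ v∈ u∈X v∈X → unique val (U/A-⊑ u∈) (U/A-⊑ v∈) (proj₁ (X/A-∈ u∈X)) (proj₁ (X/A-∈ v∈X))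
      }
      where
      good′ : ∀ B → B ⊑ U/A → ∀ {x z} → x ∈ B → x ∉ X/A → z ∈ U/A → z ∉ B → Good (mapState f S) B
      good′ B sub {x} {z} x∈ x∉ z∈ z∉ with member
        where
        at : x ∈ A → ∀ {w} → w ∈ A → f w ∈ B
        at x∈A w∈ = subst (_∈ B)
          (trans (sym (U/A-fixed (sub x∈))) (trans (collapse-∈ x∈A) (sym (collapse-∈ w∈)))) x∈
        -- The preimage must contain an ordinary vertex. If `x` is the contracted vertex, one of
        -- `x₀` and `x₁` will do.
        member : ∃ λ w → f w ∈ B × w ∉ X
        member with ∈⊎∉ A x
        ... | inj₂ x∉A = x , subst (_∈ B) (sym (U/A-fixed (sub x∈))) x∈ , X/A-∉ x∉ x∉A
        ... | inj₁ x∈A with ∈⊎∉ X x₀ | ∈⊎∉ X x₁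
        ...   | inj₂ q | _      = x₀ , at x∈A x₀∈ , q
        ...   | inj₁ _ | inj₂ q = x₁ , at x∈A x₁∈ , q
        ...   | inj₁ q | inj₁ q′ = ⊥-elim (x₀≢x₁ (unique val (A⊑U x₀∈) (A⊑U x₁∈) q q′))
      ... | w , w∈ , w∉ with good val (B ∘ f) (λ u∈ → f⁻¹-∈ (sub u∈)) {w} {z} w∈ w∉ (U/A-⊑ z∈)
        (subst (_∉ B) (sym (U/A-fixed z∈)) z∉)
      ... | c , c′ , q , q′ , r = c , c′ , q , q′ , rep-map {S} f B r

    -- The part of S inside A, after the edges not inside A have been directed
    -- as in D.
    restrict : List Ends → State
    restrict D = state (inner A (E S)) (o S) (s S ++ src (outer A D))
      (a S ++ tgt (outer A D)) (b S ++ src (outer A D))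

    module _ {D : List Ends} (or : Orient (E S) D) where

      private
        R = outer A D
        S′ = restrict D

        degrees : ∀ {B} → B ⊑ A → d B (E S) ≡ d B (inner A (E S)) + (# B (src R) + # B (tgt R))
        degrees {B} sub = trans (d-split A B (E S)) (cong (d B (inner A (E S)) +_)
          (trans (sym (d-orient B (outer-orient A or))) (d-outer A sub D)))

        rep-restrict : ∀ {B} → B ⊑ A → ∀ {c c′} → Rep S B c c′ → Rep S′ B c c′
        rep-restrict {B} sub {c} {c′} (eq , con)
          rewrite inner-e A {B} sub (E S) | #-++ B (s S) (src R) | #-++ B (a S) (tgt R) | #-++ B (b S) (src R)
          | degrees {B} sub =
          trans (arrange (d B (inner A (E S))) (# B (a S)) (# B (b S)) (# B (src R)) (# B (tgt R))) eq ,
          ≈-trans (≈-reflexive (sym (+-assoc (# B (o S)) (# B (b S)) (# B (src R)))))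
            (≈-trans (+-cong-≈ con (≈-refl {# B (src R)}))
              (≈-reflexive (arrange′ (# B (s S)) (e B (E S)) c (# B (src R)))))
          where
          arrange : ∀ d a b r t → d + (a + t + (b + r)) ≡ d + (r + t) + (a + b)
          arrange = solve-∀
          arrange′ : ∀ s e c r → s + e + c + r ≡ s + r + e + c
          arrange′ = solve-∀

      -- All edges leaving `A` now end in the new z. Were this z not balanced, `balanced-or-large`
      -- would shift its degrees into a split of `A` with at least `p` edges in both directions.
      restrict-valid : # A (o S) ≈ # A (s S) + # A (src D) → ¬ Strong S A → Valid A X (restrict D)
      restrict-valid demand weak = record
        { within      = inner-within A (E S)
        ; total       = ≈-trans demand (≈-reflexive total′)
        ; balanced    = balanced′
        ; good        = λ B sub x∈ x∉ z∈ z∉ → let c , c′ , q , q′ , r = good val B (λ u∈ → A⊑U (sub u∈)) x∈ x∉ (A⊑U z∈) z∉ in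
            c , c′ , q , q′ , rep-restrict sub r
        ; exceptional = λ {v} v∈ v∈X → let m , r = exceptional val (A⊑U v∈) v∈X in m , rep-restrict (⁅⁆-⊑ {A} {v} v∈) r
        ; unique      = λ u∈ v∈ → unique val (A⊑U u∈) (A⊑U v∈)
        }
        where
        outs : # A (src D) ≡ e A (E S) + # A (src R)
        outs = trans (src-outer A D) (cong (_+ # A (src R)) (e-orient A or))
        total′ : # A (s S) + # A (src D) ≡ # A (s S ++ src R) + length (inner A (E S))
        total′ rewrite outs | #-++ A (s S) (src R) | inner-length A (E S) =
          arrange (# A (s S)) (e A (E S)) (# A (src R))
          where
          arrange : ∀ s e r → s + (e + r) ≡ s + r + e
          arrange = solve-∀
        degree : deg S A ≡ # A (b S ++ src R) + # A (a S ++ tgt R)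
        degree rewrite degrees {A} (λ q → q) | inner-d A (E S) | #-++ A (a S) (tgt R) | #-++ A (b S) (src R) =
          arrange (# A (a S)) (# A (b S)) (# A (src R)) (# A (tgt R))
          where
          arrange : ∀ a b r t → r + t + (a + b) ≡ b + r + (a + t)
          arrange = solve-∀
        balanced′ : Balanced (# A (a S ++ tgt R)) (# A (b S ++ src R))
        balanced′ with balanced-or-large (# A (b S ++ src R)) (# A (a S ++ tgt R))
        ... | inj₁ bal = bal
        ... | inj₂ (c , c′ , q , q′ , eq , con) = ⊥-elim (weak (c , c′ , q , q′ , trans degree eq , (begin
            # A (o S) + # A (b S)
              ≈⟨ +-cong-≈ demand (≈-refl {# A (b S)}) ⟩
            # A (s S) + # A (src D) + # A (b S)
              ≡⟨ cong (λ t → # A (s S) + t + # A (b S)) outs ⟩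
            # A (s S) + (e A (E S) + # A (src R)) + # A (b S)
              ≡⟨ arrange (# A (s S)) (e A (E S)) (# A (src R)) (# A (b S)) ⟩
            # A (s S) + e A (E S) + (# A (b S) + # A (src R))
              ≡⟨ cong (# A (s S) + e A (E S) +_) (#-++ A (b S) (src R)) ⟨
            # A (s S) + e A (E S) + # A (b S ++ src R)
              ≈⟨ +-cong-≈ (≈-refl {# A (s S) + e A (E S)}) con ⟩
            # A (s S) + e A (E S) + c ∎)))
          where
          open ≈-Reasoning
          arrange : ∀ s e r b → s + (e + r) + b ≡ s + e + (b + r)
          arrange = solve-∀

      sol-glue : (∀ {v} → v ∈ U → v ∉ A → # ⁅ v ⁆ (o S) ≈ # ⁅ v ⁆ (s S) + # ⁅ v ⁆ (src D)) →
        Sol A (restrict D) → Sol U S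
      sol-glue demand (D₁ , or₁ , demand₁) with merge A (E S) (outer-orient A or) or₁
      ... | D₂ , or₂ , eq = D₂ , or₂ , demand₂
        where
        demand₂ : ∀ {v} → v ∈ U → # ⁅ v ⁆ (o S) ≈ # ⁅ v ⁆ (s S) + # ⁅ v ⁆ (src D₂)
        demand₂ {v} v∈ rewrite eq ⁅ v ⁆ with ∈⊎∉ A v
        ... | inj₁ v∈A = ≈-trans (demand₁ v∈A) (≈-reflexive
          (trans (cong (_+ # ⁅ v ⁆ (src D₁)) (#-++ ⁅ v ⁆ (s S) (src R))) (+-assoc (# ⁅ v ⁆ (s S)) (# ⁅ v ⁆ (src R)) _)))
        ... | inj₂ v∉A rewrite src-outer-disjoint A {⁅ v ⁆} (λ u∈ → ∉⁅⁆ (∈∉⇒≢ {A} u∈ v∉A)) D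
          | within-disjoint A {⁅ v ⁆} (λ u∈ → ∉⁅⁆ (∈∉⇒≢ {A} u∈ v∉A)) (orient-within or₁ (inner-within A (E S)))
          | +-identityʳ (# ⁅ v ⁆ (src D)) = demand v∈ v∉A

    contract-step : (Valid U/A X/A (mapState f S) → Sol U/A (mapState f S)) →
      (∀ S′ → Valid A X S′ → Sol A S′) → ¬ Strong S A → Sol U S
    contract-step solve-outside solve-inside weak with solve-outside contract-valid
    ... | D′ , or′ , demand with orient-map⁻ f (E S) or′
    ... | D , or , refl = sol-glue or apart (solve-inside (restrict D) (restrict-valid or block weak))
      where
      pulled : ∀ {v B} → v ∈ U/A → (⁅ v ⁆ ∘ f) ≗ B → # B (o S) ≈ # B (s S) + # B (src D)
      pulled {v} {B} v∈ eq = subst₂ _≈_ (count (o S)) (cong₂ _+_ (count (s S))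
        (trans (cong (# ⁅ v ⁆) (src-map f D)) (count (src D)))) (demand v∈)
        where
        count : ∀ l → # ⁅ v ⁆ (map f l) ≡ # B l
        count l = trans (#-map ⁅ v ⁆ f l) (#-cong eq l)
      block : # A (o S) ≈ # A (s S) + # A (src D)
      block = pulled (∈-U/A (A⊑U x₀∈) (collapse-∈ x₀∈)) ⁅x₀⁆∘f
      apart : ∀ {v} → v ∈ U → v ∉ A → # ⁅ v ⁆ (o S) ≈ # ⁅ v ⁆ (s S) + # ⁅ v ⁆ (src D)
      apart v∈ v∉ = pulled (∈-U/A v∈ (collapse-∉ v∉)) (⁅⁆∘f v∉)

  -- Searching for a set without slack

  infix 4 _≈?_
  _≈?_ : ∀ x y → Dec (x ≈ y)
  x ≈? y = map′ same-remainder _≈_.remainder (x % p ≟ y % p)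

  strong? : ∀ S B → Dec (Strong S B)
  strong? S B = map′ to from (Fin.any? λ c → (p ≤? Fin.toℕ c) ×-dec (p ≤? deg S B ∸ Fin.toℕ c) ×-dec
      (# B (o S) + # B (b S) ≈? # B (s S) + e B (E S) + Fin.toℕ c))
    where
    to : (∃ λ (c : Fin (suc (deg S B))) → p ≤ Fin.toℕ c × p ≤ deg S B ∸ Fin.toℕ c ×
      # B (o S) + # B (b S) ≈ # B (s S) + e B (E S) + Fin.toℕ c) → Strong S B
    to (c , q , q′ , con) = Fin.toℕ c , deg S B ∸ Fin.toℕ c , q , q′ ,
      (sym (m+[n∸m]≡n (Fin.toℕ≤pred[n] c)) , con)
    from : Strong S B → ∃ λ (c : Fin (suc (deg S B))) → p ≤ Fin.toℕ c × p ≤ deg S B ∸ Fin.toℕ c ×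
      # B (o S) + # B (b S) ≈ # B (s S) + e B (E S) + Fin.toℕ c
    from (c , c′ , q , q′ , (eq , con)) = Fin.fromℕ< c< , subst Condition (sym (Fin.toℕ-fromℕ< c<))
      (q , subst (p ≤_) (sym (trans (cong (_∸ c) eq) (m+n∸m≡n c c′))) q′ , con)
      where
      c< : c < suc (deg S B)
      c< = s≤s (≤-trans (m≤m+n c c′) (≤-reflexive (sym eq)))
      Condition : ℕ → Set
      Condition c = p ≤ c × p ≤ deg S B ∸ c × # B (o S) + # B (b S) ≈ # B (s S) + e B (E S) + c

  Weak : VSet → State → VSet → Set
  Weak U S A = A ⊑ U × (∃₂ λ x₀ x₁ → x₀ ∈ A × x₁ ∈ A × x₀ ≢ x₁) × (∃ λ y → y ∈ U × y ∉ A) × ¬ Strong S A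

  weak-or-nontrivial : ∀ U S → ∃ (Weak U S) ⊎ Nontrivial U S
  weak-or-nontrivial U S with anySubset? (weak? ∘ Vec.lookup)
    where
    weak? : ∀ A → Dec (Weak U S A)
    weak? A = map′ (λ q {v} → q v) (λ q v → q) (Fin.all? λ v → (A v Bool.≟ true) →-dec (U v Bool.≟ true))
      ×-dec (Fin.any? λ x₀ → Fin.any? λ x₁ → (A x₀ Bool.≟ true) ×-dec (A x₁ Bool.≟ true) ×-dec ¬? (x₀ Fin.≟ x₁))
      ×-dec (Fin.any? λ y → (U y Bool.≟ true) ×-dec (A y Bool.≟ false)) ×-dec ¬? (strong? S A)
  ... | yes (A , weak) = inj₁ (Vec.lookup A , weak)
  ... | no none = inj₂ λ B sub {x} {x′} {y} x∈ x′∈ x≢x′ y∈ y∉ → decidable-stable (strong? S B) λ weak →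
    let same = Vec.lookup∘tabulate B in
    none (Vec.tabulate B , (λ {v} v∈ → sub (trans (sym (same v)) v∈)) ,
      (x , x′ , trans (same x) x∈ , trans (same x′) x′∈ , x≢x′) , (y , y∈ , trans (same y) y∉) ,
      λ strong → weak (atLeast-cong {S} same strong))

  -- Graphs with at most two vertices

  -- All edges are loops, so every orientation gives the out-degree `length (E S)`, and the demand
  -- is the condition `total`.
  single-vertex : ∀ {U X S} → Valid U X S → (∀ {u v} → u ∈ U → v ∈ U → u ≡ v) → Sol U S
  single-vertex {U} {X} {S} val one = E S , orient-refl (E S) , λ {v} v∈ →
    let whole = ⁅⁆≗ v∈ in
    subst₂ _≈_ (sym (#-cong whole (o S)))
      (sym (cong₂ _+_ (#-cong whole (s S)) (trans (#-cong whole (src (E S))) (src-within (within val))))) (total val)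
    where
    ⁅⁆≗ : ∀ {v} → v ∈ U → ⁅ v ⁆ ≗ U
    ⁅⁆≗ {v} v∈ u with u Fin.≟ v
    ... | yes refl = sym v∈
    ... | no u≢v with ∈⊎∉ U u
    ...   | inj₁ u∈ = ⊥-elim (u≢v (one u∈ v∈))
    ...   | inj₂ u∉ = sym u∉

  module _ {U X : VSet} {S : State} (val : Valid U X S) {x y : V} (x∈ : x ∈ U) (y∈ : y ∈ U)
    (y≢x : y ≢ x) (two : ∀ {u} → u ∈ U → u ≡ x ⊎ u ≡ y) where

    private
      complement : ∁ U ⁅ x ⁆ ≗ ⁅ y ⁆
      complement u with u Fin.≟ x | u Fin.≟ y
      ... | yes refl | yes refl = ⊥-elim (y≢x refl)
      ... | yes _    | no _     = Bool.∧-zeroʳ (U u)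
      ... | no _     | yes refl = trans (Bool.∧-identityʳ (U u)) y∈
      ... | no u≢x   | no u≢y   with ∈⊎∉ U u
      ...   | inj₁ u∈ = ⊥-elim ([ u≢x , u≢y ] (two u∈))
      ...   | inj₂ u∉ = trans (Bool.∧-identityʳ (U u)) u∉

      #-two : ∀ l → # U l ≡ # ⁅ x ⁆ l + # ⁅ y ⁆ l
      #-two l = trans (#-∁ {U = U} {⁅ x ⁆} (⁅⁆-⊑ {U} {x} x∈) l) (cong (# ⁅ x ⁆ l +_) (#-cong complement l))

    -- It suffices to direct `u` of the crossing edges away from `x`; the demand at `y` then follows
    -- from the total.
    two-vertices : ∀ {u} → u ≤ d ⁅ x ⁆ (E S) →
      # ⁅ x ⁆ (o S) ≈ # ⁅ x ⁆ (s S) + (u + e ⁅ x ⁆ (E S)) → Sol U S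
    two-vertices {u} u≤ demand with orient-with-out ⁅ x ⁆ (E S) u≤
    ... | D , or , eq = D , or , λ v∈ → [ (λ { refl → at-x }) , (λ { refl → at-y }) ] (two v∈)
      where
      at-x : # ⁅ x ⁆ (o S) ≈ # ⁅ x ⁆ (s S) + # ⁅ x ⁆ (src D)
      at-x rewrite eq = demand
      at-y : # ⁅ y ⁆ (o S) ≈ # ⁅ y ⁆ (s S) + # ⁅ y ⁆ (src D)
      at-y = +-cancelʳ-≈ (# ⁅ x ⁆ (o S)) (begin
        # ⁅ y ⁆ (o S) + # ⁅ x ⁆ (o S)          ≡⟨ +-comm (# ⁅ y ⁆ (o S)) _ ⟩
        # ⁅ x ⁆ (o S) + # ⁅ y ⁆ (o S)          ≡⟨ #-two (o S) ⟨
        # U (o S)                              ≈⟨ total val ⟩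
        # U (s S) + length (E S)               ≡⟨ cong (# U (s S) +_) (orient-length or) ⟨
        # U (s S) + length D                   ≡⟨ cong (# U (s S) +_) (src-within (orient-within or (within val))) ⟨
        # U (s S) + # U (src D)                ≡⟨ cong₂ _+_ (#-two (s S)) (#-two (src D)) ⟩
        # ⁅ x ⁆ (s S) + # ⁅ y ⁆ (s S) + (# ⁅ x ⁆ (src D) + # ⁅ y ⁆ (src D))
          ≡⟨ arrange (# ⁅ x ⁆ (s S)) (# ⁅ y ⁆ (s S)) (# ⁅ x ⁆ (src D)) (# ⁅ y ⁆ (src D)) ⟩
        # ⁅ y ⁆ (s S) + # ⁅ y ⁆ (src D) + (# ⁅ x ⁆ (s S) + # ⁅ x ⁆ (src D))
          ≈⟨ +-cong-≈ (≈-refl {# ⁅ y ⁆ (s S) + # ⁅ y ⁆ (src D)}) at-x ⟨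
        # ⁅ y ⁆ (s S) + # ⁅ y ⁆ (src D) + # ⁅ x ⁆ (o S) ∎)
        where
        open ≈-Reasoning
        arrange : ∀ s s₁ r r₁ → s + s₁ + (r + r₁) ≡ s₁ + r₁ + (s + r)
        arrange = solve-∀

    private
      other-good : y ∉ X → Good S (∁ U ⁅ x ⁆)
      other-good y∉ = good val (∁ U ⁅ x ⁆) (∁-⊑ {U = U} {⁅ x ⁆}) (∁-∈ {U = U} {⁅ x ⁆} y∈ (∉⁅⁆ y≢x)) y∉
        x∈ (∁-∉ {U = U} {⁅ x ⁆} {x} x∈ (x∈⁅x⁆ {x}))

    -- Of the `m` edges that are to leave `x`, `β` go to z and `m ∸ β` must be free. The bound
    -- `m ≤ d` comes from `cut` with the other vertex, and `β ≤ m` follows since the degree is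
    -- `m + m`.
    two-exceptional : x ∈ X → Sol U S
    two-exceptional x∈X with exceptional val x∈ x∈X | ∈⊎∉ X y
    ... | _ | inj₁ y∈X = ⊥-elim (y≢x (unique val y∈ x∈ y∈X x∈X))
    ... | m , r@(eq , con) | inj₂ y∉X with other-good y∉X
    ...   | c , c′ , q , q′ , r′ = two-vertices (≤-trans (m∸n≤m m β) m≤d)
        (+-cancelʳ-≈ β (begin
          # ⁅ x ⁆ (o S) + β                                     ≈⟨ con ⟩
          # ⁅ x ⁆ (s S) + e ⁅ x ⁆ (E S) + m                     ≡⟨ cong (# ⁅ x ⁆ (s S) + e ⁅ x ⁆ (E S) +_) (m∸n+n≡m β≤m) ⟨
          # ⁅ x ⁆ (s S) + e ⁅ x ⁆ (E S) + (m ∸ β + β)           ≡⟨ arrange (# ⁅ x ⁆ (s S)) (e ⁅ x ⁆ (E S)) (m ∸ β) β ⟩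
          # ⁅ x ⁆ (s S) + (m ∸ β + e ⁅ x ⁆ (E S)) + β           ∎))
        where
        open ≈-Reasoning
        β = # ⁅ x ⁆ (b S)
        m≤d : m ≤ d ⁅ x ⁆ (E S)
        m≤d = +-cancelʳ-≤ h m _ (cut val (⁅⁆-⊑ {U} {x} x∈) r r′ (+-monoʳ-≤ m q) (+-monoʳ-≤ m q′))
        β≤m : β ≤ m
        β≤m = +-cancelˡ-≤ m β m (≤-trans (+-mono-≤ m≤d (m≤n+m β (# ⁅ x ⁆ (a S)))) (≤-reflexive eq))
        arrange : ∀ s e u b → s + e + (u + b) ≡ s + (u + e) + b
        arrange = solve-∀

    -- There are at least `h` crossing edges, by `cut` with the bound `h + h`, so the number
    -- directed away from `x` can have any residue modulo `p`.
    two-ordinary : x ∉ X → y ∉ X → Sol U S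
    two-ordinary x∉ y∉ with other-good y∉ | good val ⁅ x ⁆ (⁅⁆-⊑ {U} {x} x∈) (x∈⁅x⁆ {x}) x∉ y∈ (∉⁅⁆ y≢x)
    ... | c , c′ , q , q′ , r | c₁ , c₁′ , q₁ , q₁′ , r₁ = two-vertices
        (≤-trans (s≤s⁻¹ (m%n<n (# ⁅ x ⁆ (o S) + t * h) p)) h≤d) (≈-sym (begin
          # ⁅ x ⁆ (s S) + (u + e ⁅ x ⁆ (E S))     ≡⟨ arrange (# ⁅ x ⁆ (s S)) u (e ⁅ x ⁆ (E S)) ⟩
          t + u                                  ≈⟨ +-cong-≈ (≈-refl {t}) (same-remainder (m%n%n≡m%n (# ⁅ x ⁆ (o S) + t * h) p)) ⟩
          t + (# ⁅ x ⁆ (o S) + t * h)            ≡⟨ arrange′ t (# ⁅ x ⁆ (o S)) h ⟩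
          # ⁅ x ⁆ (o S) + t * p                  ≈⟨ +-multiple-≈ (# ⁅ x ⁆ (o S)) t ⟩
          # ⁅ x ⁆ (o S)                          ∎))
        where
        open ≈-Reasoning
        t = # ⁅ x ⁆ (s S) + e ⁅ x ⁆ (E S)
        -- Since `h` is -1 modulo `p`, this is the residue of the demand minus `t`.
        u = (# ⁅ x ⁆ (o S) + t * h) % p
        h≤d : h ≤ d ⁅ x ⁆ (E S)
        h≤d = +-cancelʳ-≤ h h _ (cut val (⁅⁆-⊑ {U} {x} x∈) r₁ r (+-mono-≤ q₁ q) (+-mono-≤ q₁′ q′))
        arrange : ∀ s u e → s + (u + e) ≡ s + e + u
        arrange = solve-∀
        arrange′ : ∀ t o h → t + (o + t * h) ≡ o + t * suc h
        arrange′ = solve-∀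

  two-vertex-graph : ∀ {U X S} → Valid U X S → ∀ {x y} → x ∈ U → y ∈ U → y ≢ x →
    (∀ {u} → u ∈ U → u ≡ x ⊎ u ≡ y) → Sol U S
  two-vertex-graph {U} {X} {S} val {x} {y} x∈ y∈ y≢x two with ∈⊎∉ X x | ∈⊎∉ X y
  ... | inj₁ x∈X | _        = two-exceptional val x∈ y∈ y≢x two x∈X
  ... | inj₂ _   | inj₁ y∈X = two-exceptional val y∈ x∈ (λ x≡y → y≢x (sym x≡y)) (λ u∈ → Sum.swap (two u∈)) y∈X
  ... | inj₂ x∉X | inj₂ y∉X = two-ordinary val x∈ y∈ y≢x two x∉X y∉X

  -- Assembling the induction

  -- The case `one` includes the empty set. The case `three` states the size in the form in which it
  -- is used: two vertices avoiding any given one.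
  data Order (U : VSet) : Set where
    one   : (∀ {u v} → u ∈ U → v ∈ U → u ≡ v) → Order U
    two   : ∀ {x y} → x ∈ U → y ∈ U → y ≢ x → (∀ {u} → u ∈ U → u ≡ x ⊎ u ≡ y) → Order U
    three : ∀ {x} → x ∈ U → (∀ v → ∃₂ λ w w′ → w ∈ U × w′ ∈ U × w ≢ v × w′ ≢ v × w ≢ w′) → Order U

  order : ∀ U → Order U
  order U with Fin.any? (λ x → U x Bool.≟ true)
  ... | no none = one λ u∈ _ → ⊥-elim (none (_ , u∈))
  ... | yes (x , x∈) with Fin.any? (λ y → (U y Bool.≟ true) ×-dec ¬? (y Fin.≟ x))
  ...   | no none = one λ {u} {v} u∈ v∈ → trans (is-x u∈) (sym (is-x v∈))
    where
    is-x : ∀ {u} → u ∈ U → u ≡ x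
    is-x {u} u∈ = decidable-stable (u Fin.≟ x) λ u≢x → none (u , u∈ , u≢x)
  ...   | yes (y , y∈ , y≢x) with Fin.any? (λ z → (U z Bool.≟ true) ×-dec ¬? (z Fin.≟ x) ×-dec ¬? (z Fin.≟ y))
  ...     | no none = two x∈ y∈ y≢x x-or-y
    where
    x-or-y : ∀ {u} → u ∈ U → u ≡ x ⊎ u ≡ y
    x-or-y {u} u∈ with u Fin.≟ x | u Fin.≟ y
    ... | yes u≡x | _       = inj₁ u≡x
    ... | no _    | yes u≡y = inj₂ u≡y
    ... | no u≢x  | no u≢y  = ⊥-elim (none (u , u∈ , u≢x , u≢y))
  ...     | yes (z , z∈ , z≢x , z≢y) = three x∈ others
    where
    others : ∀ v → ∃₂ λ w w′ → w ∈ U × w′ ∈ U × w ≢ v × w′ ≢ v × w ≢ w′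
    others v with x Fin.≟ v | y Fin.≟ v
    ... | yes refl | _        = y , z , y∈ , z∈ , y≢x , z≢x , λ y≡z → z≢y (sym y≡z)
    ... | no x≢v   | yes refl = x , z , x∈ , z∈ , x≢v , z≢y , λ x≡z → z≢x (sym x≡z)
    ... | no x≢v   | no y≢v   = x , y , x∈ , y∈ , x≢v , y≢v , λ x≡y → y≢x (sym x≡y)

  step : ∀ {U X S} → Valid U X S →
    (∀ {U′ X′ S′} → size U′ < size U → Valid U′ X′ S′ → Sol U′ S′) →
    (∀ X′ S′ → length (E S′) < length (E S) → Valid U X′ S′ → Sol U S′) →
    (∀ a′ b′ → # U a′ + # U b′ < # U (a S) + # U (b S) → Valid U X (state (E S) (o S) (s S) a′ b′) → Sol U S) →
    Sol U S
  step {U} {X} {S} val rec-size rec-edges rec-z with order U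
  ... | one all-equal        = single-vertex val all-equal
  ... | two x∈ y∈ y≢x either = two-vertex-graph val x∈ y∈ y≢x either
  ... | three {x} x∈ others with weak-or-nontrivial U S
  ...   | inj₁ (A , A⊑U , (x₀ , x₁ , x₀∈ , x₁∈ , x₀≢x₁) , (y , y∈ , y∉) , weak) =
    contract-step val A⊑U x₀∈ x₁∈ x₀≢x₁ (rec-size (size-contract val A⊑U x₀∈ x₁∈ x₀≢x₁))
      (λ S′ → rec-size (size-< {U} {A} {y} A⊑U y∈ y∉)) weak
  ...   | inj₂ nt with Fin.any? (λ v → (U v Bool.≟ true) ×-dec (X v Bool.≟ true))
  ...     | yes (v , v∈ , v∈X) =
    let w , w′ , w∈ , w′∈ , w≢v , w′≢v , w≢w′ = others v in
    exceptional-step val nt v∈ v∈X w∈ w′∈ w≢v w′≢v w≢w′ (rec-edges X)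
  ...     | no none = ordinary-step val nt ordinary others rec-edges rec-z x∈
    where
    ordinary : ∀ {u} → u ∈ U → u ∉ X
    ordinary {u} u∈ with ∈⊎∉ X u
    ... | inj₁ u∈X = ⊥-elim (none (u , u∈ , u∈X))
    ... | inj₂ u∉X = u∉X

  -- Lexicographic recursion on vertices, free edges and edges at z. Restricting to `A` may add
  -- edges at z but has fewer vertices; flipping may add edges at z but uses up a free edge;
  -- dropping lowers only the last number.
  solve-bounded : ∀ N M W {U X S} → size U < N → length (E S) < M → # U (a S) + # U (b S) < W →
    Valid U X S → Sol U S
  solve-bounded (suc N) (suc M) (suc W) {S = S} (s≤s size≤) (s≤s length≤) (s≤s z≤) val = step val
    (λ lt → solve-bounded N _ _ (<-≤-trans lt size≤) ≤-refl ≤-refl)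
    (λ X′ S′ lt → solve-bounded (suc N) M _ (s≤s size≤) (<-≤-trans lt length≤) ≤-refl)
    (λ a′ b′ lt → solve-bounded (suc N) (suc M) W {S = state (E S) (o S) (s S) a′ b′}
      (s≤s size≤) (s≤s length≤) (<-≤-trans lt z≤))

  solve : ∀ {U X S} → Valid U X S → Sol U S
  solve = solve-bounded _ _ _ ≤-refl ≤-refl ≤-refl

  -- Cuts with 3h edges satisfy the induction hypothesis: every residue class meets
  -- the interval from h to 2h.
  orient-modulo : ∀ E o → # (λ _ → true) o ≈ length E →
    (∀ B {x y} → x ∈ B → y ∉ B → h + h + h ≤ d B E) →
    ∃ λ D → Orient E D × (∀ v → # ⁅ v ⁆ o ≈ # ⁅ v ⁆ (src D))
  orient-modulo E o total cuts = let D , or , demand = solve {full} {none} {S} val in D , or , λ v → demand {v} refl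
    where
    full none : VSet
    full _ = true
    none _ = false
    S = state E o [] [] []
    within-full : ∀ E → Within full E
    within-full []      = []
    within-full (_ ∷ E) = (refl , refl) ∷ within-full E
    good′ : ∀ B → B ⊑ full → ∀ {x y} → x ∈ B → x ∉ none → y ∈ full → y ∉ B → Good S B
    good′ B _ x∈ _ _ y∉ = h + r , d B E ∸ (h + r) , m≤m+n h r , m+n≤o⇒m≤o∸n h (≤-trans (≤-reflexive (sym (+-assoc h h r))) enough) ,
      (trans (+-identityʳ (d B E)) (sym (m+[n∸m]≡n (≤-trans (m≤n+m (h + r) h) (≤-trans (≤-reflexive (sym (+-assoc h h r))) enough)))) , ≈-sym (begin
        e B E + (h + r)                          ≡⟨ +-assoc (e B E) h r ⟨
        t + r                                    ≈⟨ +-cong-≈ (≈-refl {t}) (same-remainder (m%n%n≡m%n (# B o + t * h) p)) ⟩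
        t + (# B o + t * h)                      ≡⟨ arrange t (# B o) h ⟩
        # B o + 0 + t * p                        ≈⟨ +-multiple-≈ (# B o + 0) t ⟩
        # B o + 0                                ∎))
      where
      open ≈-Reasoning
      t = e B E + h
      r = (# B o + t * h) % p
      enough : h + h + r ≤ d B E
      enough = ≤-trans (+-monoʳ-≤ (h + h) (s≤s⁻¹ (m%n<n (# B o + t * h) p))) (cuts B x∈ y∉)
      arrange : ∀ t o h → t + (o + t * h) ≡ o + 0 + t * suc h
      arrange = solve-∀
    val : Valid full none S
    val = record
      { within      = within-full E
      ; total       = total
      ; balanced    = z≤n , z≤n , inj₁ z≤n
      ; good        = good′
      ; exceptional = λ _ ()
      ; unique      = λ _ _ ()
      }

-- Switching and the signs in cuts

module Switching (G : Graph) where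

  open Graph G hiding (EdgeConnected)

  VSet : Set
  VSet = Vertex → Bool

  flipIf : Bool → Sign → Sign
  flipIf b s = if b then opposite s else s

  switchSet : VSet → Signature G → Signature G
  switchSet B σ f = flipIf (B (end f 0F)) (flipIf (B (end f 1F)) (σ f))

  infixl 6 _△_
  _△_ : VSet → VSet → VSet
  (A △ B) u = A u xor B u

  switchSet-△ : ∀ A B σ → switchSet B (switchSet A σ) ≗ switchSet (A △ B) σ
  switchSet-△ A B σ f = flips (A (end f 0F)) (A (end f 1F)) (B (end f 0F)) (B (end f 1F)) (σ f)
    where
    flips : ∀ a a′ b b′ s → flipIf b (flipIf b′ (flipIf a (flipIf a′ s))) ≡ flipIf (a xor b) (flipIf (a′ xor b′) s)
    flips false false b     b′    s      = refl
    flips true  false false false s      = refl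
    flips true  false true  false Sign.+ = refl
    flips true  false true  false Sign.- = refl
    flips true  false false true  Sign.+ = refl
    flips true  false false true  Sign.- = refl
    flips true  false true  true  Sign.+ = refl
    flips true  false true  true  Sign.- = refl
    flips false true  b     false s      = refl
    flips false true  false true  Sign.+ = refl
    flips false true  false true  Sign.- = refl
    flips false true  true  true  Sign.+ = refl
    flips false true  true  true  Sign.- = refl
    flips true  true  false false s      = refl
    flips true  true  false true  Sign.+ = refl
    flips true  true  false true  Sign.- = refl
    flips true  true  true  false Sign.+ = refl
    flips true  true  true  false Sign.- = refl
    flips true  true  true  true  Sign.+ = refl
    flips true  true  true  true  Sign.- = refl

  switchSet-cong : ∀ {A B} σ → A ≗ B → switchSet A σ ≗ switchSet B σ
  switchSet-cong σ eq f = cong₂ (λ b b′ → flipIf b (flipIf b′ (σ f))) (eq (end f 0F)) (eq (end f 1F))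

  -- Switching twice at a vertex cancels, so a sequence of switchings acts through the parity of the
  -- occurrences.
  odd : ∀ {m} → List (Fin m) → Fin m → Bool
  odd []       u = false
  odd (v ∷ vs) u = does (u Fin.≟ v) xor odd vs u

  foldl-switch : ∀ vs σ → foldl (switch G) σ vs ≗ switchSet (odd vs) σ
  foldl-switch []       σ f = refl
  foldl-switch (v ∷ vs) σ f = trans (foldl-switch vs (switch G σ v) f)
    (switchSet-△ (λ u → does (u Fin.≟ v)) (odd vs) σ f)

  select : ∀ {m} → (Fin m → Bool) → List (Fin m) → List (Fin m)
  select B []       = []
  select B (v ∷ vs) = if B v then v ∷ select B vs else select B vs

  odd-select : ∀ {m} (B : Fin m → Bool) vs u → odd (select B vs) u ≡ B u ∧ odd vs u
  odd-select B []       u = sym (Bool.∧-zeroʳ (B u))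
  odd-select B (v ∷ vs) u with u Fin.≟ v
  ... | yes refl with B u in eq
  ...   | true  rewrite dec-true (u Fin.≟ u) refl = cong not (trans (odd-select B vs u) (cong (_∧ odd vs u) eq))
  ...   | false = trans (odd-select B vs u) (cong (_∧ odd vs u) eq)
  odd-select B (v ∷ vs) u | no u≢v with B v
  ... | false = odd-select B vs u
  ... | true  rewrite dec-false (u Fin.≟ v) u≢v = odd-select B vs u

  odd-suc : ∀ {m} (vs : List (Fin m)) → odd (map suc vs) zero ≡ false × (∀ u → odd (map suc vs) (suc u) ≡ odd vs u)
  odd-suc []       = refl , λ _ → refl
  odd-suc (v ∷ vs) = proj₁ (odd-suc vs) , λ u → cong (does (u Fin.≟ v) xor_) (proj₂ (odd-suc vs) u)

  odd-allFin : ∀ m u → odd (allFin m) u ≡ true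
  odd-allFin (suc m) u = trans (cong (λ l → odd (zero ∷ l) u) (sym (map-tabulate id suc))) (each u)
    where
    each : ∀ u → odd (zero ∷ map suc (allFin m)) u ≡ true
    each zero    = cong not (proj₁ (odd-suc (allFin m)))
    each (suc u) = trans (proj₂ (odd-suc (allFin m)) u) (odd-allFin m u)

  switchSet-equivalent : ∀ σ B → Equivalent G σ (switchSet B σ)
  switchSet-equivalent σ B = vs , λ f → sym (trans (foldl-switch vs σ f) (switchSet-cong σ odd-B f))
    where
    vs = select B (allFin order)
    odd-B : odd vs ≗ B
    odd-B u = trans (odd-select B (allFin order) u)
      (trans (cong (B u ∧_) (odd-allFin order u)) (Bool.∧-identityʳ (B u)))

  negatives : Signature G → ℕ
  negatives σ = ∑ λ f → ι (has Sign.- (σ f))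

  crosses : VSet → Edge → Bool
  crosses B f = B (end f 0F) xor B (end f 1F)

  cutOf : Sign → Signature G → VSet → ℕ
  cutOf s σ B = ∑ λ f → ι (has s (σ f) ∧ crosses B f)

  -- Switching at all of `B` exchanges the two signs on the crossing edges and changes no other
  -- edge.
  negatives-switchSet : ∀ B σ → negatives (switchSet B σ) + cutOf Sign.- σ B ≡ negatives σ + cutOf Sign.+ σ B
  negatives-switchSet B σ = trans (sym (∑-+ _ (λ f → ι (has Sign.- (σ f) ∧ crosses B f))))
    (trans (∑-cong λ f → edge (B (end f 0F)) (B (end f 1F)) (σ f))
      (∑-+ _ (λ f → ι (has Sign.+ (σ f) ∧ crosses B f))))
    where
    edge : ∀ b b′ s → ι (has Sign.- (flipIf b (flipIf b′ s))) + ι (has Sign.- s ∧ (b xor b′)) ≡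
      ι (has Sign.- s) + ι (has Sign.+ s ∧ (b xor b′))
    edge false false Sign.+ = refl
    edge false false Sign.- = refl
    edge false true  Sign.+ = refl
    edge false true  Sign.- = refl
    edge true  false Sign.+ = refl
    edge true  false Sign.- = refl
    edge true  true  Sign.+ = refl
    edge true  true  Sign.- = refl

  cutOf-cong : ∀ s σ {B B′} → B ≗ B′ → cutOf s σ B ≡ cutOf s σ B′
  cutOf-cong s σ eq = ∑-cong λ f → cong (λ t → ι (has s (σ f) ∧ t)) (cong₂ _xor_ (eq (end f 0F)) (eq (end f 1F)))

  FewNegative : Signature G → Set
  FewNegative σ = ∀ B → cutOf Sign.- σ B ≤ cutOf Sign.+ σ B

  -- Switching at a cut with a negative majority lowers the number of negative edges, so the descent
  -- stops.
  few-negative-switching : ∀ σ → ∃ λ A → FewNegative (switchSet A σ)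
  few-negative-switching σ = descend (suc (negatives (switchSet (λ _ → false) σ))) (λ _ → false) ≤-refl
    where
    negatives-cong : ∀ {σ σ′} → σ ≗ σ′ → negatives σ ≡ negatives σ′
    negatives-cong eq = ∑-cong λ f → cong (ι ∘ has Sign.-) (eq f)
    descend : ∀ bound A → negatives (switchSet A σ) < bound → ∃ λ A → FewNegative (switchSet A σ)
    descend (suc bound) A (s≤s neg≤) with anySubset? (λ B →
      cutOf Sign.+ (switchSet A σ) (Vec.lookup B) <? cutOf Sign.- (switchSet A σ) (Vec.lookup B))
    ... | no none = A , λ B → ≮⇒≥ λ lt → none (Vec.tabulate B , subst₂ _<_
      (cutOf-cong Sign.+ (switchSet A σ) (sym ∘ Vec.lookup∘tabulate B))
      (cutOf-cong Sign.- (switchSet A σ) (sym ∘ Vec.lookup∘tabulate B)) lt)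
    ... | yes (B′ , lt) = descend bound (A △ B) (<-≤-trans fewer neg≤)
      where
      B = Vec.lookup B′
      τ = switchSet A σ
      fewer : negatives (switchSet (A △ B) σ) < negatives τ
      fewer = subst (_< negatives τ) (negatives-cong (switchSet-△ A B σ))
        (+-cancelʳ-< (cutOf Sign.- τ B) (negatives (switchSet B τ)) (negatives τ)
          (≤-<-trans (≤-reflexive (negatives-switchSet B τ)) (+-monoʳ-< (negatives τ) lt)))

  cutOf-sum : ∀ σ B → cutOf Sign.+ σ B + cutOf Sign.- σ B ≡ ∑ (ι ∘ crosses B)
  cutOf-sum σ B = trans (sym (∑-+ _ (λ f → ι (has Sign.- (σ f) ∧ crosses B f)))) (∑-cong λ f → edge (σ f) (crosses B f))
    where
    edge : ∀ s b → ι (has Sign.+ s ∧ b) + ι (has Sign.- s ∧ b) ≡ ι b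
    edge Sign.+ b = +-identityʳ (ι b)
    edge Sign.- b = refl

  -- If fewer than `c` edges crossed, they could all be deleted, yet a path from `x` to `y` has to
  -- use one of them.
  edgeConnected-cut : ∀ {c} → EdgeConnected G c → ∀ B {x y} → x ∈ B → y ∉ B → c ≤ ∑ (ι ∘ crosses B)
  edgeConnected-cut {c} conn B {x} {y} x∈ y∉ = ≮⇒≥ λ lt →
    blocked (conn F (subst (_< c) (sym (∣tabulate∣ (crosses B))) lt) x y) x∈ y∉
    where
    F = Vec.tabulate (crosses B)
    crossing∈F : ∀ f → crosses B f ≡ true → f Subset.∈ F
    crossing∈F f cr = Vec.lookup⇒[]= f F (trans (Vec.lookup∘tabulate (crosses B) f) cr)
    blocked : ∀ {x y} → Star (λ u v → ∃ λ f → f Subset.∉ F × Joins f u v) x y → x ∈ B → ¬ (y ∉ B)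
    blocked ε x∈ y∉ with () ← trans (sym x∈) y∉
    blocked (_◅_ {j = v} (f , f∉ , joins) path) x∈ y∉ with ∈⊎∉ B v | joins
    ... | inj₁ v∈ | _ = blocked path v∈ y∉
    ... | inj₂ v∉ | inj₁ (refl , refl) = f∉ (crossing∈F f (cong₂ _xor_ x∈ v∉))
    ... | inj₂ v∉ | inj₂ (refl , refl) = f∉ (crossing∈F f (cong₂ _xor_ v∉ x∈))

≈⇒∣ : ∀ h → let open Congruence h in ∀ {x y} → x ≈ y → ℤ.+ p ℤ.∣ (ℤ.+ x ℤ.- ℤ.+ y)
≈⇒∣ h {x} {y} x≈y with ≈-split x≈y
  where open Congruence h
... | inj₁ refl rewrite ℤ.+-inverseʳ (ℤ.+ x) = _ ∣0
... | inj₂ (inj₁ (q , refl)) = subst (suc h ∣_) (sym distance) (n∣m*n (suc q))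
  where
  distance : ℤ.∣ ℤ.+ (y + suc q * suc h) ℤ.- ℤ.+ y ∣ ≡ suc q * suc h
  distance rewrite ℤ.m-n≡m⊖n (y + suc q * suc h) y | ℤ.∣m⊖n∣≡∣n⊖m∣ (y + suc q * suc h) y |
    ℤ.∣⊖∣-≤ (m≤m+n y (suc q * suc h)) = m+n∸m≡n y (suc q * suc h)
... | inj₂ (inj₂ (q , refl)) = subst (suc h ∣_) (sym distance) (n∣m*n (suc q))
  where
  distance : ℤ.∣ ℤ.+ x ℤ.- ℤ.+ (x + suc q * suc h) ∣ ≡ suc q * suc h
  distance rewrite ℤ.m-n≡m⊖n x (x + suc q * suc h) | ℤ.∣⊖∣-≤ (m≤m+n x (suc q * suc h)) =
    m+n∸m≡n x (suc q * suc h)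

-- Sinks, sources and the demands on positive edges

module _ (k₀ : ℕ) where

  private
    k h′ : ℕ
    k  = suc k₀
    -- With this form `suc h′` is `2 * k` by definition, so `p` is `suc (2 * k)`.
    h′ = k₀ + suc (k₀ + 0)

  open Congruence (suc h′)

  -- An even number is halved. An odd number that is at least `p` is `p` plus twice some `q ∸ k`, so
  -- the two parts can be made to differ by exactly `p`.
  sinks-sources : ∀ n → 2 ∣ n ⊎ 2 * k + 1 ≤ n → ∃₂ λ sinks sources → sinks + sources ≡ n × sinks ≈ sources
  sinks-sources n (inj₁ (divides q refl)) = q , q , arrange q , ≈-refl
    where
    arrange : ∀ q → q + q ≡ q * 2
    arrange = solve-∀
  sinks-sources n (inj₂ p≤n) with even-or-odd n
    where
    even-or-odd : ∀ n → (∃ λ q → n ≡ q + q) ⊎ (∃ λ q → n ≡ suc (q + q))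
    even-or-odd zero = inj₁ (0 , refl)
    even-or-odd (suc n) with even-or-odd n
    ... | inj₁ (q , refl) = inj₂ (q , refl)
    ... | inj₂ (q , refl) = inj₁ (suc q , cong suc (sym (+-suc q q)))
  ... | inj₁ (q , eq) = q , q , sym eq , ≈-refl
  ... | inj₂ (q , refl) = q ∸ k + p , q ∸ k , total , +-p-≈ (q ∸ k)
    where
    k≤q : k ≤ q
    k≤q = ≮⇒≥ λ q<k → <⇒≱ (begin
      suc (suc (q + q))  ≡⟨ cong suc (+-suc q q) ⟨
      suc q + suc q      ≤⟨ +-mono-≤ q<k q<k ⟩
      k + k              ≤⟨ m≤m+n (k + k) 1 ⟩
      k + k + 1          ≡⟨ arrange k ⟩
      2 * k + 1          ∎) p≤n
      where
      open ≤-Reasoning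
      arrange : ∀ k → k + k + 1 ≡ 2 * k + 1
      arrange = solve-∀
    total : q ∸ k + p + (q ∸ k) ≡ suc (q + q)
    total = trans (arrange (q ∸ k) k) (cong (λ t → suc (t + t)) (m∸n+n≡m k≤q))
      where
      arrange : ∀ u k → u + suc (2 * k) + u ≡ suc (u + k + (u + k))
      arrange = solve-∀

  -- The contribution of one edge to the demanded out-degrees on positive edges:
  -- at each vertex the demand is half its positive degree minus half the net
  -- out-degree from the negative edges, and 1/2 is k + 1, −1/2 is k modulo 2k + 1.
  tokens : ∀ {A : Set} → Sign → Sign → A → A → List A
  tokens Sign.+ t      x y = replicate (suc k) x ++ replicate (suc k) y
  tokens Sign.- Sign.+ x y = replicate k x ++ replicate k y
  tokens Sign.- Sign.- x y = replicate (suc k) x ++ replicate (suc k) y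

  #-copies : ∀ {A : Set} (B : A → Bool) m x y → # B (replicate m x ++ replicate m y) ≡ m * (ι (B x) + ι (B y))
  #-copies B m x y = trans (#-++ B (replicate m x) (replicate m y))
    (trans (cong₂ _+_ (copies m x) (copies m y)) (sym (*-distribˡ-+ m (ι (B x)) (ι (B y)))))
    where
    copies : ∀ m x → # B (replicate m x) ≡ m * ι (B x)
    copies zero    x = refl
    copies (suc m) x = cong (ι (B x) +_) (copies m x)

posEdge : ∀ {A : Set} → Sign → A → A → List (A × A)
posEdge Sign.+ x y = (x , y) ∷ []
posEdge Sign.- x y = []

tail : ∀ {A : Set} → (A → Bool) → Sign → Sign → A → A → ℕ
tail B Sign.+ Sign.+ x y = ι (B x)
tail B Sign.+ Sign.- x y = ι (B y)
tail B Sign.- _      x y = 0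

directions : ∀ {A : Set} {m} (σ : Fin m → Sign) (x y : Fin m → A) {D} →
  Orient (gather λ i → posEdge (σ i) (x i) (y i)) D →
  ∃ λ (ρ : Fin m → Sign) → ∀ B → # B (src D) ≡ ∑ λ i → tail B (σ i) (ρ i) (x i) (y i)
directions {m = zero} σ x y [] = (λ ()) , λ B → refl
directions {m = suc m} σ x y or with σ zero | or
... | Sign.- | or′ = let ρ , tails = directions (σ ∘ suc) (x ∘ suc) (y ∘ suc) or′ in
  Fin.∀-cons Sign.+ ρ , tails
... | Sign.+ | keep or′ = let ρ , tails = directions (σ ∘ suc) (x ∘ suc) (y ∘ suc) or′ in
  Fin.∀-cons Sign.+ ρ , λ B → cong (ι (B (x zero)) +_) (tails B)
... | Sign.+ | turn or′ = let ρ , tails = directions (σ ∘ suc) (x ∘ suc) (y ∘ suc) or′ in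
  Fin.∀-cons Sign.- ρ , λ B → cong (ι (B (y zero)) +_) (tails B)

distribute : ∀ {m} (σ : Fin m → Sign) a b → a + b ≡ ∑ (λ i → ι (has Sign.- (σ i))) →
  ∃ λ (τ : Fin m → Sign) → ∑ (λ i → ι (has Sign.- (σ i) ∧ has Sign.+ (τ i))) ≡ a ×
    ∑ (λ i → ι (has Sign.- (σ i) ∧ has Sign.- (τ i))) ≡ b
distribute {zero} σ zero zero eq = (λ ()) , refl , refl
distribute {suc m} σ a b eq with σ zero
distribute {suc m} σ a b eq | Sign.+ = let τ , q , q′ = distribute (σ ∘ suc) a b eq in
  Fin.∀-cons Sign.+ τ , q , q′
distribute {suc m} σ (suc a) b eq | Sign.- = let τ , q , q′ = distribute (σ ∘ suc) a b (suc-injective eq) in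
  Fin.∀-cons Sign.+ τ , cong suc q , q′
distribute {suc m} σ zero (suc b) eq | Sign.- = let τ , q , q′ = distribute (σ ∘ suc) zero b (suc-injective eq) in
  Fin.∀-cons Sign.- τ , q , cong suc q′

-- From the demands to the orientation of the signed graph

module SignedGraph (k₀ : ℕ) (G : Graph) (σ₀ : Signature G) (A : Graph.Vertex G → Bool) (τ : Graph.Edge G → Sign) where

  open Graph G hiding (EdgeConnected)
  open Switching G

  k h′ h : ℕ
  k  = suc k₀
  h′ = k₀ + suc (k₀ + 0)
  h  = suc h′

  open Congruence h

  σ : Signature G
  σ = switchSet A σ₀

  x y : Edge → Vertex
  x f = end f 0F
  y f = end f 1F

  positiveEdges : List (Vertex × Vertex)
  positiveEdges = gather λ f → posEdge (σ f) (x f) (y f)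

  demand : List Vertex
  demand = gather λ f → tokens k₀ (σ f) (τ f) (x f) (y f)

  all : Vertex → Bool
  all _ = true

  Sinks≈Sources : Set
  Sinks≈Sources = ∑ (λ f → ι (has Sign.- (σ f) ∧ has Sign.+ (τ f))) ≈ ∑ (λ f → ι (has Sign.- (σ f) ∧ has Sign.- (τ f)))

  -- A positive edge and a source contribute `2 * k + 2`, which is 1 modulo `p`, and a sink
  -- contributes `2 * k`, which is -1. The surplus over the number of positive edges is thus sources
  -- minus sinks.
  demand-total : Sinks≈Sources → # all demand ≈ length positiveEdges
  demand-total sinks≈sources = +-cancelʳ-≈ sinks (begin
    # all demand + sinks              ≡⟨ cong (_+ sinks) (#-gather all (λ f → tokens k₀ (σ f) (τ f) (x f) (y f))) ⟩
    ∑ token + sinks                   ≡⟨ ∑-+ token sink ⟨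
    ∑ (λ f → token f + sink f)        ≈⟨ ∑-≈ h (λ f → edge (σ f) (τ f) (x f) (y f)) ⟩
    ∑ (λ f → len f + source f)        ≡⟨ ∑-+ len source ⟩
    ∑ len + sources                   ≈⟨ +-cong-≈ (≈-refl {∑ len}) (≈-sym sinks≈sources) ⟩
    ∑ len + sinks                     ≡⟨ cong (_+ sinks) (length-gather (λ f → posEdge (σ f) (x f) (y f))) ⟨
    length positiveEdges + sinks      ∎)
    where
    open ≈-Reasoning
    token sink source len : Edge → ℕ
    token f  = # all (tokens k₀ (σ f) (τ f) (x f) (y f))
    sink f   = ι (has Sign.- (σ f) ∧ has Sign.+ (τ f))
    source f = ι (has Sign.- (σ f) ∧ has Sign.- (τ f))
    len f    = length (posEdge (σ f) (x f) (y f))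
    sinks   = ∑ sink
    sources = ∑ source
    edge : ∀ s t u v → # all (tokens k₀ s t u v) + ι (has Sign.- s ∧ has Sign.+ t) ≈
      length (posEdge s u v) + ι (has Sign.- s ∧ has Sign.- t)
    edge Sign.+ t      u v = ≈-trans (≈-reflexive (trans (cong (_+ 0) (#-copies k₀ all (suc k) u v)) (arrange k))) (+-p-≈ 1)
      where
      arrange : ∀ k → suc k * 2 + 0 ≡ 1 + suc (2 * k)
      arrange = solve-∀
    edge Sign.- Sign.+ u v = ≈-trans (≈-reflexive (trans (cong (_+ 1) (#-copies k₀ all k u v)) (arrange k))) (+-p-≈ 0)
      where
      arrange : ∀ k → k * 2 + 1 ≡ suc (2 * k)
      arrange = solve-∀
    edge Sign.- Sign.- u v = ≈-trans (≈-reflexive (trans (cong (_+ 0) (#-copies k₀ all (suc k) u v)) (arrange k))) (+-p-≈ 1)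
      where
      arrange : ∀ k → suc k * 2 + 0 ≡ 1 + suc (2 * k)
      arrange = solve-∀

  cut-positive : ∀ B → d B positiveEdges ≡ cutOf Sign.+ σ B
  cut-positive B = trans (d-gather B (λ f → posEdge (σ f) (x f) (y f))) (∑-cong λ f → edge (σ f) (x f) (y f))
    where
    edge : ∀ s u v → d B (posEdge s u v) ≡ ι (has Sign.+ s ∧ (B u xor B v))
    edge Sign.+ u v = +-identityʳ (ι (B u xor B v))
    edge Sign.- u v = refl

  -- At least half of the `12 * k ∸ 1` or more edges of a cut are positive. As `12 * k ∸ 1` is odd,
  -- rounding up gives `6 * k`, which is `h + h + h`.
  cuts : EdgeConnected G (12 * k ∸ 1) → FewNegative σ → ∀ B {u v} → u ∈ B → v ∉ B → h + h + h ≤ d B positiveEdges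
  cuts conn few B u∈ v∉ rewrite cut-positive B = ≮⇒≥ λ lt → <⇒≱ (begin
      suc (suc (pos + pos))          ≡⟨ cong suc (+-suc pos pos) ⟨
      suc pos + suc pos              ≤⟨ +-mono-≤ lt lt ⟩
      h + h + h + (h + h + h)        ≡⟨ arrange k ⟩
      12 * k                         ∎) (begin
      12 * k                         ≤⟨ m≤n+m∸n (12 * k) 1 ⟩
      1 + (12 * k ∸ 1)               ≤⟨ s≤s (edgeConnected-cut conn B u∈ v∉) ⟩
      suc (∑ (ι ∘ crosses B))        ≡⟨ cong suc (cutOf-sum σ B) ⟨
      suc (pos + cutOf Sign.- σ B)   ≤⟨ s≤s (+-monoʳ-≤ pos (few B)) ⟩
      suc (pos + pos)                ∎)
    where
    open ≤-Reasoning
    pos = cutOf Sign.+ σ B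
    arrange : ∀ k → 2 * k + 2 * k + 2 * k + (2 * k + 2 * k + 2 * k) ≡ 12 * k
    arrange = solve-∀

  open ModuloOrientation order h′ using (orient-modulo; ⁅_⁆)

  Meets : (Edge → Sign) → Set
  Meets ρ = ∀ v → # ⁅ v ⁆ demand ≈ ∑ λ f → tail ⁅ v ⁆ (σ f) (ρ f) (x f) (y f)

  positive-signs : EdgeConnected G (12 * k ∸ 1) → FewNegative σ → Sinks≈Sources → ∃ Meets
  positive-signs conn few sinks≈sources =
    let D , or , meets = orient-modulo positiveEdges demand (demand-total sinks≈sources) (cuts conn few)
        ρ , tails = directions σ x y or
    in ρ , λ v → ≈-trans (meets v) (≈-reflexive (tails ⁅ v ⁆))

  pick : Sign → Sign → Sign → Sign
  pick Sign.+ r t = r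
  pick Sign.- r t = t

  module _ (ρ : Edge → Sign) (ρ-meets : Meets ρ) where

    -- Marks at the two ends in the switched graph. Multiplication by `opposite (σ f)` keeps the
    -- mark on a negative edge and reverses it on a positive one.
    first second : Edge → Sign
    first f  = pick (σ f) (ρ f) (τ f)
    second f = opposite (σ f) Sign.* first f

    degree : Sign → Vertex → ℕ
    degree s v = ∑ λ f → ι (has s (first f) ∧ ⁅ v ⁆ (x f)) + ι (has s (second f) ∧ ⁅ v ⁆ (y f))

    -- Doubling removes the factor 1/2 in the demands: in-degree plus twice the positive out-degree
    -- agrees with out-degree plus twice the tokens, and this can be checked edge by edge. Tokens
    -- and positive out-degree agree by `ρ-meets` and cancel.
    degree-balanced : ∀ v → degree Sign.+ v ≈ degree Sign.- v
    degree-balanced v = ≈-sym (+-cancelʳ-≈ (tails + tails) (begin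
      degree Sign.- v + (tails + tails)             ≡⟨ cong (degree Sign.- v +_) (∑-+ out out) ⟨
      degree Sign.- v + ∑ (λ f → out f + out f)     ≡⟨ ∑-+ (half Sign.-) (λ f → out f + out f) ⟨
      ∑ (λ f → half Sign.- f + (out f + out f))     ≈⟨ ∑-≈ h (λ f → edge (σ f) (ρ f) (τ f) (x f) (y f)) ⟩
      ∑ (λ f → half Sign.+ f + (token f + token f)) ≡⟨ ∑-+ (half Sign.+) (λ f → token f + token f) ⟩
      degree Sign.+ v + ∑ (λ f → token f + token f) ≡⟨ cong (degree Sign.+ v +_) (∑-+ token token) ⟩
      degree Sign.+ v + (∑ token + ∑ token)         ≈⟨ +-cong-≈ (≈-refl {degree Sign.+ v}) (+-cong-≈ meets meets) ⟩
      degree Sign.+ v + (tails + tails)             ∎))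
      where
      open ≈-Reasoning
      B = ⁅ v ⁆
      out token : Edge → ℕ
      out f   = tail B (σ f) (ρ f) (x f) (y f)
      token f = # B (tokens k₀ (σ f) (τ f) (x f) (y f))
      half : Sign → Edge → ℕ
      half s f = ι (has s (first f) ∧ B (x f)) + ι (has s (second f) ∧ B (y f))
      tails = ∑ out
      meets : ∑ token ≈ tails
      meets = ≈-trans (≈-reflexive (sym (#-gather B (λ f → tokens k₀ (σ f) (τ f) (x f) (y f))))) (ρ-meets v)
      edge : ∀ s r t u w → let i = pick s r t ; j = opposite s Sign.* i in
        ι (has Sign.- i ∧ B u) + ι (has Sign.- j ∧ B w) + (tail B s r u w + tail B s r u w) ≈
        ι (has Sign.+ i ∧ B u) + ι (has Sign.+ j ∧ B w) + (# B (tokens k₀ s t u w) + # B (tokens k₀ s t u w))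
      edge Sign.+ Sign.+ t u w =
        ≈-sym (≈-trans (≈-reflexive (trans (cong (λ t → ι (B u) + 0 + (t + t)) (#-copies k₀ B (suc k) u w)) (arrange k (ι (B u)) (ι (B w))))) (+-multiple-≈ (ι (B w) + (ι (B u) + ι (B u))) (ι (B u) + ι (B w))))
        where
        arrange : ∀ k a b → a + 0 + (suc k * (a + b) + suc k * (a + b)) ≡ b + (a + a) + (a + b) * suc (2 * k)
        arrange = solve-∀
      edge Sign.+ Sign.- t u w =
        ≈-sym (≈-trans (≈-reflexive (trans (cong (λ t → ι (B w) + (t + t)) (#-copies k₀ B (suc k) u w)) (arrange k (ι (B u)) (ι (B w))))) (+-multiple-≈ (ι (B u) + 0 + (ι (B w) + ι (B w))) (ι (B u) + ι (B w))))
        where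
        arrange : ∀ k a b → b + (suc k * (a + b) + suc k * (a + b)) ≡ a + 0 + (b + b) + (a + b) * suc (2 * k)
        arrange = solve-∀
      edge Sign.- r Sign.+ u w =
        ≈-sym (≈-trans (≈-reflexive (trans (cong (λ t → ι (B u) + ι (B w) + (t + t)) (#-copies k₀ B k u w)) (arrange k (ι (B u)) (ι (B w))))) (+-multiple-≈ 0 (ι (B u) + ι (B w))))
        where
        arrange : ∀ k a b → a + b + (k * (a + b) + k * (a + b)) ≡ 0 + (a + b) * suc (2 * k)
        arrange = solve-∀
      edge Sign.- r Sign.- u w =
        ≈-sym (≈-trans (≈-reflexive (trans (cong (λ t → 0 + (t + t)) (#-copies k₀ B (suc k) u w)) (arrange k (ι (B u)) (ι (B w))))) (+-multiple-≈ (ι (B u) + ι (B w) + 0) (ι (B u) + ι (B w))))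
        where
        arrange : ∀ k a b → suc k * (a + b) + suc k * (a + b) ≡ a + b + 0 + (a + b) * suc (2 * k)
        arrange = solve-∀

    -- Reversing the marks at all ends in `A` undoes the switching, since the sign of an edge
    -- changes exactly when one of its two marks does.
    direction : Edge → Fin 2 → Sign
    direction f 0F = flipIf (A (x f)) (first f)
    direction f 1F = flipIf (A (y f)) (second f)

    orientation : Orientation G σ₀
    orientation = record
      { dir      = direction
      ; positive = λ f → positive-edge (A (x f)) (A (y f)) (first f)
      ; negative = λ f → negative-edge (A (x f)) (A (y f)) (first f)
      }
      where
      positive-edge : ∀ b b′ t {s} → s ≡ Sign.+ →
        flipIf b′ (opposite (flipIf b (flipIf b′ s)) Sign.* t) ≡ opposite (flipIf b t)
      positive-edge false false t      refl = refl
      positive-edge false true  Sign.+ refl = refl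
      positive-edge false true  Sign.- refl = refl
      positive-edge true  false Sign.+ refl = refl
      positive-edge true  false Sign.- refl = refl
      positive-edge true  true  t      refl = refl
      negative-edge : ∀ b b′ t {s} → s ≡ Sign.- →
        flipIf b′ (opposite (flipIf b (flipIf b′ s)) Sign.* t) ≡ flipIf b t
      negative-edge false false t      refl = refl
      negative-edge false true  Sign.+ refl = refl
      negative-edge false true  Sign.- refl = refl
      negative-edge true  false Sign.+ refl = refl
      negative-edge true  false Sign.- refl = refl
      negative-edge true  true  Sign.+ refl = refl
      negative-edge true  true  Sign.- refl = refl

    open Orientation orientation using (E; d⁺; d⁻; Modulo)

    -- All marks at `v` are reversed together or not at all, so at a vertex of `A` out- and
    -- in-degree change places, which does not affect their congruence.
    degree-E : ∀ s v → length (E s v) ≡ degree (flipIf (A v) s) v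
    degree-E s v = trans
      (length-filter-pairs (λ (f , i) → end f i Fin.≟ v ×-dec direction f i Sign.≟ s) id)
      (∑-cong λ f → cong₂ _+_ (half (x f) (first f)) (half (y f) (second f)))
      where
      has-opposite : ∀ s t → has s (opposite t) ≡ has (opposite s) t
      has-opposite Sign.+ Sign.+ = refl
      has-opposite Sign.+ Sign.- = refl
      has-opposite Sign.- Sign.+ = refl
      has-opposite Sign.- Sign.- = refl
      flip-has : ∀ b t → has s (flipIf b t) ≡ has (flipIf b s) t
      flip-has false t = refl
      flip-has true  t = has-opposite s t
      half : ∀ u t → ι (does (u Fin.≟ v) ∧ has s (flipIf (A u) t)) ≡ ι (has (flipIf (A v) s) t ∧ ⁅ v ⁆ u)
      half u t with u Fin.≟ v
      ... | yes refl = cong ι (trans (flip-has (A u) t) (sym (Bool.∧-identityʳ _)))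
      ... | no _     = cong ι (sym (Bool.∧-zeroʳ (has (flipIf (A v) s) t)))

    modulo : Modulo (2 * k + 1)
    modulo v = subst (λ m → ℤ.+ m ℤ.∣ (ℤ.+ d⁺ v ℤ.- ℤ.+ d⁻ v)) (+-comm 1 (2 * k))
      (≈⇒∣ h (subst₂ _≈_ (sym (degree-E Sign.+ v)) (sym (degree-E Sign.- v)) balanced))
      where
      balanced : degree (flipIf (A v) Sign.+) v ≈ degree (flipIf (A v) Sign.-) v
      balanced with A v
      ... | false = degree-balanced v
      ... | true  = ≈-sym (degree-balanced v)

negative-signs : ∀ k₀ {m} (σ : Fin m → Sign) → let open Congruence (2 * suc k₀) in
  2 ∣ ∑ (λ f → ι (has Sign.- (σ f))) ⊎ 2 * suc k₀ + 1 ≤ ∑ (λ f → ι (has Sign.- (σ f))) →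
  ∃ λ (τ : Fin m → Sign) →
    ∑ (λ f → ι (has Sign.- (σ f) ∧ has Sign.+ (τ f))) ≈ ∑ (λ f → ι (has Sign.- (σ f) ∧ has Sign.- (τ f)))
negative-signs k₀ σ even-or-many =
  let sinks , sources , total , eq = sinks-sources k₀ _ even-or-many
      τ , q , q′ = distribute σ sinks sources total
  in τ , subst₂ (Congruence._≈_ (2 * suc k₀)) (sym q) (sym q′) eq

theorem4 : (k : ℕ) → 1 ≤ k →
    (G : Graph) (σ : Signature G) →
    EdgeConnected G (12 * k ∸ 1) →
    EssentiallyUnbalanced G (2 * k + 1) σ →
    HasModuloOrientation (2 * k + 1) G σ
theorem4 (suc k) _ G σ connected unbalanced =
  let open Switching G
      A , few = few-negative-switching σ
      τ , sinks≈sources = negative-signs k (switchSet A σ)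
        (subst (λ t → 2 ∣ t ⊎ 2 * suc k + 1 ≤ t) (length-filter-tabulate (λ f → switchSet A σ f Sign.≟ Sign.-) id)
          (unbalanced (switchSet A σ) (switchSet-equivalent σ A)))
      open SignedGraph k G σ A τ
      ρ , meets = positive-signs connected few sinks≈sources
  in orientation ρ meets , modulo ρ meets
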